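{- Let $q\ge 7$ be an odd prime power, $\Sigma_\infty$ a hyperplane of $\mathrm{PG}(4,q)$, and let $\mathcal C$ be a set of $q^2$ affine points together with a set of affine planes ($\mathcal C$-planes) satisfying: (A1) each $\mathcal C$-plane meets $\mathcal C$ in a $q$-arc, and every plane meeting $\mathcal C$ in more than four points is a $\mathcal C$-plane; (A2) any two distinct points of $\mathcal C$ lie in exactly one $\mathcal C$-plane; (A3) each affine point is either in $\mathcal C$, or on no $\mathcal C$-plane, or on exactly two $\mathcal C$-planes. Then for every point $A\in\mathcal C$, the set $t_A$ is a line of $\Sigma_\infty$.
   Context: Affine points/lines/planes are those not contained in $\Sigma_\infty$. A $k$-arc is a set of $k$ points of a plane, no three collinear. For a $\mathcal C$-plane $\pi$, the $q$-arc $\pi\cap\mathcal C$ lies ($q$ odd) in a unique conic $(\pi\cap\mathcal C)\cup\{\pi_\infty\}$ of $\pi$. For $A\in\mathcal C$ and a $\mathcal C$-plane $\pi$ through $A$, let $A_\pi$ be the point where the tangent line at $A$ (in $\pi$) to the conic $(\pi\cap\mathcal C)\cup\{\pi_\infty\}$ meets $\Sigma_\infty$. There are exactly $q+1$ $\mathcal C$-planes $\pi_1,\dots,\pi_{q+1}$ through $A$, and $t_A=\{A_{\pi_1},\dots,A_{\pi_{q+1}}\}$. -}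

module Defs where

open import Level using (0ℓ)
open import Data.Nat as ℕ using (ℕ; suc)
open import Data.Nat.Primality using (Prime)
open import Data.Fin using (Fin)
open import Data.Vec using (Vec; []; _∷_; map; zipWith; foldr; replicate)
open import Data.List using (List; length)
open import Data.List.Membership.Propositional using (_∈_)
open import Data.List.Relation.Unary.Unique.Propositional using (Unique)
open import Data.List.Relation.Unary.All using (All)
open import Data.Product using (Σ; ∃; ∃₂; _×_; _,_)
open import Data.Sum using (_⊎_)
open import Relation.Nullary using (¬_)
open import Relation.Binary.PropositionalEquality using (_≡_; _≢_)
open import Algebra.Core using (Op₁; Op₂)
open import Algebra.Structures using (IsCommutativeRing)

IsPrimePower : ℕ → Set
IsPrimePower q = ∃₂ λ p k → Prime p × q ≡ p ℕ.^ suc k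

IsOdd : ℕ → Set
IsOdd q = ∃ λ k → q ≡ suc (2 ℕ.* k)

-- A field structure on the q-element set Fin q (so GF(q) up to isomorphism).
record FField (q : ℕ) : Set where
  field
    _+_ _*_ : Op₂ (Fin q)
    -_      : Op₁ (Fin q)
    0# 1#   : Fin q
    isCommutativeRing : IsCommutativeRing _≡_ _+_ _*_ -_ 0# 1#
    0≢1     : 0# ≢ 1#
    inverse : ∀ x → x ≢ 0# → ∃ λ y → x * y ≡ 1#

-- Projective geometry PG(4,q): points are nonzero vectors of GF(q)^5 up to
-- nonzero scalars; subspaces are spans of linearly independent vectors.
module Geo {q : ℕ} (F : FField q) where
  open FField F

  V : ℕ → Set
  V n = Vec (Fin q) n

  𝟘 : ∀ {n} → V n
  𝟘 = replicate _ 0#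

  _⊕_ : ∀ {n} → V n → V n → V n
  _⊕_ = zipWith _+_

  _·_ : ∀ {n} → Fin q → V n → V n
  c · v = map (c *_) v

  dot : ∀ {n} → V n → V n → Fin q
  dot u v = foldr _ _+_ 0# (zipWith _*_ u v)

  Nonzero : ∀ {n} → V n → Set
  Nonzero v = v ≢ 𝟘

  comb : ∀ {k n} → Vec (V n) k → V k → V n
  comb us cs = foldr _ _⊕_ 𝟘 (zipWith _·_ cs us)

  Independent : ∀ {k n} → Vec (V n) k → Set
  Independent us = ∀ cs → comb us cs ≡ 𝟘 → cs ≡ 𝟘

  InSpan : ∀ {k n} → Vec (V n) k → V n → Set
  InSpan us v = ∃ λ cs → v ≡ comb us cs

  record Plane : Set where
    field
      gens  : Vec (V 5) 3
      indep : Independent gens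
  open Plane public

  record Line : Set where
    field
      lgens  : Vec (V 5) 2
      lindep : Independent lgens
  open Line public

  -- the (projective) point represented by v lies on π (v assumed nonzero)
  OnPlane : Plane → V 5 → Set
  OnPlane π v = InSpan (gens π) v

  SamePlane : Plane → Plane → Set
  SamePlane π ρ = ∀ v → (OnPlane π v → OnPlane ρ v) × (OnPlane ρ v → OnPlane π v)

  Collinear : V 5 → V 5 → V 5 → Set
  Collinear a b c = ¬ Independent (a ∷ b ∷ c ∷ [])

  -- 3x3 matrices (in the coordinates of a plane w.r.t. its generators)
  Mat3 : Set
  Mat3 = Vec (V 3) 3

  _▹_ : Mat3 → V 3 → V 3
  M ▹ x = map (λ row → dot row x) M

  Symmetric : Mat3 → Set
  Symmetric M = ∀ x y → dot x (M ▹ y) ≡ dot y (M ▹ x)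

  Nondegenerate : Mat3 → Set
  Nondegenerate M = ∀ x → M ▹ x ≡ 𝟘 → x ≡ 𝟘

  OnConic : Plane → Mat3 → V 5 → Set
  OnConic π M v = ∃ λ x → v ≡ comb (gens π) x × dot x (M ▹ x) ≡ 0#

  -- Everything below is relative to the hyperplane Σ∞ = {x : h·x = 0}
  -- and the point set 𝒞, given by its affine representatives (h·c = 1).
  module Config (h : V 5) (C : List (V 5)) (CPlane : Plane → Set) where

    AtInfinity : V 5 → Set
    AtInfinity v = Nonzero v × dot h v ≡ 0#

    AffinePlane : Plane → Set
    AffinePlane π = ∃ λ v → OnPlane π v × dot h v ≢ 0#

    Sect : Plane → V 5 → Set
    Sect π v = v ∈ C × OnPlane π v

    MeetsInQArc : Plane → Set
    MeetsInQArc π =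
      (∃ λ xs → length xs ≡ q × Unique xs
         × (∀ v → (v ∈ xs → Sect π v) × (Sect π v → v ∈ xs)))
      × (∀ a b c → Sect π a → Sect π b → Sect π c →
           a ≢ b → a ≢ c → b ≢ c → ¬ Collinear a b c)

    MeetsInMoreThanFour : Plane → Set
    MeetsInMoreThanFour π = ∃ λ xs → length xs ≡ 5 × Unique xs × All (Sect π) xs

    record Hypotheses : Set where
      field
        C-affine     : All (λ c → dot h c ≡ 1#) C
        C-unique     : Unique C
        C-size       : length C ≡ q ℕ.* q
        CPlane-resp  : ∀ π ρ → SamePlane π ρ → CPlane π → CPlane ρ
        CPlane-affine : ∀ π → CPlane π → AffinePlane π
        A1-arc       : ∀ π → CPlane π → MeetsInQArc π
        A1-five      : ∀ π → MeetsInMoreThanFour π → CPlane π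
        A2           : ∀ a b → a ∈ C → b ∈ C → a ≢ b →
                         ∃ λ π → CPlane π × OnPlane π a × OnPlane π b
                           × (∀ ρ → CPlane ρ → OnPlane ρ a → OnPlane ρ b → SamePlane π ρ)
        A3           : ∀ P → dot h P ≡ 1# →
                         P ∈ C
                         ⊎ (∀ π → CPlane π → ¬ OnPlane π P)
                         ⊎ (∃₂ λ π₁ π₂ → CPlane π₁ × CPlane π₂ × OnPlane π₁ P × OnPlane π₂ P
                              × ¬ SamePlane π₁ π₂
                              × (∀ ρ → CPlane ρ → OnPlane ρ P → SamePlane ρ π₁ ⊎ SamePlane ρ π₂))

    -- X represents A_π: the point at infinity of the tangent line at A (in π)
    -- to the conic of π containing the q-arc π ∩ 𝒞 (unique by the context).
    TangentPointAtInfinity : V 5 → Plane → V 5 → Set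
    TangentPointAtInfinity A π X =
      AtInfinity X × OnPlane π X ×
      (∃ λ M → Symmetric M × Nondegenerate M
         × (∀ c → Sect π c → OnConic π M c)
         × (∃₂ λ a x → A ≡ comb (gens π) a × X ≡ comb (gens π) x
              × dot a (M ▹ x) ≡ 0#))

    t : V 5 → V 5 → Set
    t A X = ∃ λ π → CPlane π × OnPlane π A × TangentPointAtInfinity A π X

    IsLineOfΣ∞ : (V 5 → Set) → Set
    IsLineOfΣ∞ T = ∃ λ ℓ → All (λ g → dot h g ≡ 0#) (Data.Vec.toList (lgens ℓ))
      × (∀ X → (T X → Nonzero X × InSpan (lgens ℓ) X)
             × (Nonzero X × InSpan (lgens ℓ) X → T X))

{-# OPTIONS --safe #-}

-- Call C-planes blocks: by (A2) and counting they form an affine plane of order q on 𝒞. By (A3) the affine points of a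
-- block π off 𝒞 each lie on one further block. Only q - 1 blocks are parallel to π, so most of these points are covered
-- by blocks meeting π in a line; these lines have at most one point in 𝒞 and concur at a point R of Σ∞. It follows that
-- the blocks through R form two parallel classes, and projecting from R turns them into the two reguli of a hyperbolic
-- paraboloid: in suitable coordinates 𝒞 is the set of points (x, y, xy, f(x,y)), the blocks through R being x = const and
-- y = const. Every other block τ lies in a hyperplane through R, so on τ the coordinate y is a fractional-linear function
-- of x without pole, hence linear, and f is quadratic in x. A function that is quadratic along all these lines is a
-- quadratic polynomial. Hence the blocks through A are the parabolas over the lines through A, and their tangents at A
-- fill the tangent plane of the surface at A, which meets Σ∞ in a line.

module Submission where

open import Defs
open import Level using (0ℓ)
open import Algebra.Bundles using (CommutativeRing; RawRing)
import Algebra.Properties.Ring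
import Algebra.Properties.Semiring.Mult.TCOptimised
import Algebra.Solver.Ring
open import Algebra.Solver.Ring.AlmostCommutativeRing
  using (fromCommutativeRing; _-Raw-AlmostCommutative⟶_)
open import Data.Nat as ℕ using (ℕ; zero; suc; z≤n; s≤s; _≤_)
import Data.Nat.Properties as ℕₚ
open import Data.Integer as ℤ using (ℤ)
import Data.Integer.Properties as ℤₚ
open import Data.Fin as Fin using (Fin; zero; suc)
import Data.Fin.Properties as Finₚ
open import Data.Vec as Vec using (Vec; []; _∷_; map; lookup; tabulate)
import Data.Vec.Properties as Vecₚ
open import Data.Vec.Relation.Unary.All as VAll using ([]; _∷_) renaming (All to VAll)
open import Data.List as List using (List; []; _∷_; _++_; length; filter; allFin)
import Data.List.Properties as Listₚ
open import Data.List.Membership.Propositional using (_∈_; _∉_; find; lose)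
open import Data.List.Membership.Propositional.Properties
  using (∈-lookup; ∈-filter⁺; ∈-filter⁻; ∈-allFin; ∈-map⁻; ∈-++⁺ˡ; ∈-++⁺ʳ; ∈-++⁻; ∈-cartesianProductWith⁻)
import Data.List.Membership.DecPropositional as DecMembership
open import Data.List.Relation.Unary.Any as Any using (Any; here; there)
import Data.List.Relation.Unary.Any.Properties as Anyₚ
open import Data.List.Relation.Unary.All as All using (All; []; _∷_)
open import Data.List.Relation.Unary.AllPairs using (AllPairs; []; _∷_)
open import Data.List.Relation.Unary.Unique.Propositional using (Unique)
import Data.List.Relation.Unary.Unique.Propositional.Properties as Uniqueₚ
open import Data.Maybe using (Maybe; just; nothing)
open import Data.Product using (∃; ∃₂; _×_; _,_; proj₁; proj₂)
open import Data.Sum using (_⊎_; inj₁; inj₂)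
open import Data.Empty using (⊥; ⊥-elim)
open import Function using (_∘_; id)
open import Relation.Nullary using (¬_; Dec; yes; no)
open import Relation.Nullary.Decidable using (¬?; decidable-stable)
open import Relation.Binary.Definitions using (DecidableEquality)
open import Relation.Binary.PropositionalEquality
  using (_≡_; _≢_; refl; sym; trans; cong; cong₂; subst; module ≡-Reasoning)

-- Condition (A3) serves as a prohibition: an affine point off 𝒞 never lies on three distinct
-- blocks. So two lines in which `π` meets other blocks can cross only in 𝒞, and once two parallel
-- ones are known, a third in another direction would cross both in 𝒞 and give two blocks a second
-- common point. The delicate half is that every point of `π` in 𝒞 lies on a second block through
-- `R`. Counting gives this for one of any two points not aligned with `R`; a remaining failure on
-- `π` is carried along parallels of `π` to a neighbouring block, where three failures would have to
-- be collinear. Planes of a four-dimensional space may meet in a single point, so blocks disjoint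
-- on 𝒞 may still share an affine point; this is controlled by showing that no four-dimensional
-- linear space contains three blocks. Seven field elements leave room for every finite list of
-- exceptions and determine polynomials of degree four by their values. Oddness supplies the
-- division by two used in interpolation and in polarising a conic.

module Counting where

  -- Pigeonhole arguments on lists.

  private variable
    X Y Z : Set

  lookup-distinct : {xs : List X} → Unique xs → ∀ i j → i Fin.< j → List.lookup xs i ≢ List.lookup xs j
  lookup-distinct (x∉ ∷ u) zero (suc j) _ = All.lookup x∉ (∈-lookup j)
  lookup-distinct (x∉ ∷ u) (suc i) (suc j) (s≤s i<j) = lookup-distinct u i j i<j

  -- Opaque, here and below, keeps `with` from normalising the lemma where it is used; so do the abstract copies
  -- of primed lemmas.
  opaque
    collide : {xs : List X} {ys : List Y} → Unique xs → length ys ℕ.< length xs →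
      (R : X → Y → Set) → (∀ x → x ∈ xs → ∃ λ y → y ∈ ys × R x y) →
      ∃₂ λ x x′ → ∃ λ y → x ∈ xs × x′ ∈ xs × x ≢ x′ × R x y × R x′ y
    collide {xs = xs} {ys} u lt R f =
      let i , j , i<j , eq = Finₚ.pigeonhole lt idx
          y∈ = proj₁ (proj₂ (val i)) ; y′∈ = proj₁ (proj₂ (val j))
          y≡ : proj₁ (val i) ≡ proj₁ (val j)
          y≡ = trans (Anyₚ.lookup-index y∈) (trans (cong (List.lookup ys) eq) (sym (Anyₚ.lookup-index y′∈)))
      in List.lookup xs i , List.lookup xs j , proj₁ (val j) , ∈-lookup i , ∈-lookup j
         , lookup-distinct u i j i<j
         , subst (R _) y≡ (proj₂ (proj₂ (val i))) , proj₂ (proj₂ (val j))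
      where
      val : ∀ i → ∃ λ y → y ∈ ys × R (List.lookup xs i) y
      val i = f (List.lookup xs i) (∈-lookup i)
      idx : Fin (length xs) → Fin (length ys)
      idx i = Any.index (proj₁ (proj₂ (val i)))

  length≤ : {xs ys : List X} → Unique xs → (∀ {x} → x ∈ xs → x ∈ ys) → length xs ℕ.≤ length ys
  length≤ u sub = ℕₚ.≮⇒≥ λ lt →
    let _ , _ , _ , _ , _ , ne , p , p′ = collide u lt _≡_ (λ x x∈ → x , sub x∈ , refl)
    in ne (trans p (sym p′))

  partition≤ : {P : X → Set} (P? : ∀ x → Dec (P x)) (xs : List X) →
    length xs ℕ.≤ length (filter P? xs) ℕ.+ length (filter (¬? ∘ P?) xs)
  partition≤ P? [] = z≤n
  partition≤ P? (x ∷ xs) with P? x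
  ... | yes _ = s≤s (partition≤ P? xs)
  ... | no  _ rewrite ℕₚ.+-suc (length (filter P? xs)) (length (filter (¬? ∘ P?) xs)) = s≤s (partition≤ P? xs)

  module _ (_≟_ : DecidableEquality X) where
    open DecMembership _≟_ using (_∈?_)

    _∖_ : List X → List X → List X
    xs ∖ ys = filter (¬? ∘ (_∈? ys)) xs

    ∖-unique : ∀ {xs} → Unique xs → ∀ ys → Unique (xs ∖ ys)
    ∖-unique u ys = Uniqueₚ.filter⁺ (¬? ∘ (_∈? ys)) u

    ∈-∖⁻ : ∀ {v} xs ys → v ∈ (xs ∖ ys) → v ∈ xs × v ∉ ys
    ∈-∖⁻ xs ys = ∈-filter⁻ (¬? ∘ (_∈? ys))

    ∈-∖⁺ : ∀ {v xs ys} → v ∈ xs → v ∉ ys → v ∈ (xs ∖ ys)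
    ∈-∖⁺ {ys = ys} = ∈-filter⁺ (¬? ∘ (_∈? ys))

    length-∖ : ∀ {xs} → Unique xs → ∀ ys → length xs ℕ.≤ length ys ℕ.+ length (xs ∖ ys)
    length-∖ {xs} u ys = ℕₚ.≤-trans (partition≤ (_∈? ys) xs) (ℕₚ.+-monoˡ-≤ _
      (length≤ (Uniqueₚ.filter⁺ (_∈? ys) u) (λ v∈ → proj₂ (∈-filter⁻ (_∈? ys) {xs = xs} v∈))))

    ∖-member< : ∀ {v} ys → v ∈ ys → length (ys ∖ (v ∷ [])) ℕ.< length ys
    ∖-member< {v} ys v∈ = Listₚ.filter-notAll (¬? ∘ (_∈? (v ∷ []))) ys
      (Any.map (λ v≡x ne → ne (here (sym v≡x))) v∈)

    opaque
      outside : ∀ {xs : List X} → Unique xs → ∀ ys → length ys ℕ.< length xs → ∃ λ x → x ∈ xs × x ∉ ys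
      outside {xs} u ys lt with xs ∖ ys in eq | length-∖ u ys
      ... | []    | le = ⊥-elim (ℕₚ.<⇒≱ lt (subst (length xs ℕ.≤_) (ℕₚ.+-identityʳ _) le))
      ... | x ∷ _ | _  = x , ∈-∖⁻ xs ys (subst (x ∈_) (sym eq) (here refl))

  any-or-all : {A B : X → Set} (xs : List X) → (∀ x → x ∈ xs → A x ⊎ B x) →
    (∃ λ x → x ∈ xs × A x) ⊎ (∀ x → x ∈ xs → B x)
  any-or-all [] _ = inj₂ λ _ ()
  any-or-all (x ∷ xs) dich with dich x (here refl) | any-or-all xs (λ z → dich z ∘ there)
  ... | inj₁ a | _ = inj₁ (x , here refl , a)
  ... | inj₂ b | inj₁ (z , z∈ , a) = inj₁ (z , there z∈ , a)
  ... | inj₂ b | inj₂ bs = inj₂ λ { _ (here refl) → b ; z (there z∈) → bs z z∈ }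

  opaque
    -- Each of the `n` kinds of defect spoils at most one element, so more than `n` candidates
    -- cannot all be spoiled.
    choose : ∀ {n} {xs : List X} → Unique xs → n ℕ.< length xs →
      (Good : X → Set) (Bad : Fin n → X → Set) →
      (∀ i x y → x ∈ xs → y ∈ xs → Bad i x → Bad i y → x ≡ y) →
      (∀ x → x ∈ xs → Good x ⊎ ∃ λ i → Bad i x) → ∃ λ x → x ∈ xs × Good x
    choose {n = n} {xs} u lt Good Bad amo dich with any-or-all xs dich
    ... | inj₁ r = r
    ... | inj₂ bad =
      let x , y , i , x∈ , y∈ , ne , p , p′ =
            collide u (subst (ℕ._< length xs) (sym (Listₚ.length-tabulate {n = n} id)) lt) (λ x i → Bad i x)
              (λ x x∈ → proj₁ (bad x x∈) , ∈-allFin (proj₁ (bad x x∈)) , proj₂ (bad x x∈))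
      in ⊥-elim (ne (amo i x y x∈ y∈ p p′))

  opaque
    -- A missed `y` could be deleted from `ys`, and `collide` would then contradict injectivity.
    -- This is how a count of points becomes the existence of a point with a prescribed coordinate.
    surjective : {xs : List X} {ys : List Y} → DecidableEquality Y → Unique xs → length ys ℕ.≤ length xs →
      (R : X → Y → Set) → (∀ x y → Dec (R x y)) → (∀ x → x ∈ xs → ∃ λ y → y ∈ ys × R x y) →
      (∀ {x x′ y} → x ∈ xs → x′ ∈ xs → R x y → R x′ y → x ≡ x′) →
      ∀ y → y ∈ ys → ∃ λ x → x ∈ xs × R x y
    surjective {xs = xs} {ys} _≟_ u le R R? total inj y y∈ with Any.any? (λ x → R? x y) xs
    ... | yes hit = find hit
    ... | no miss =
      let x , x′ , _ , x∈ , x′∈ , ne , p , p′ =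
            collide u (ℕₚ.<-≤-trans (∖-member< _≟_ ys y∈) le) R
              (λ x x∈ → let z , z∈ , r = total x x∈ in z , ∈-∖⁺ _≟_ z∈
                 (λ { (here refl) → miss (lose x∈ r) }) , r)
      in ⊥-elim (ne (inj x∈ x′∈ p p′))

  map-unique : (f : X → Y) {xs : List X} → Unique xs →
    (∀ {x x′} → x ∈ xs → x′ ∈ xs → f x ≡ f x′ → x ≡ x′) → Unique (List.map f xs)
  map-unique f {[]} [] inj = []
  map-unique f {x ∷ xs} (x∉ ∷ u) inj = All.tabulate fresh ∷ map-unique f u (λ a b → inj (there a) (there b))
    where
    fresh : ∀ {y} → y ∈ List.map f xs → f x ≢ y
    fresh y∈ e with ∈-map⁻ f y∈
    ... | x′ , x′∈ , refl = All.lookup x∉ x′∈ (inj (here refl) (there x′∈) e)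

  allFin-unique : ∀ n → Unique (allFin n)
  allFin-unique n = Uniqueₚ.allFin⁺ n

  allFin-length : ∀ n → length (allFin n) ≡ n
  allFin-length n = Listₚ.length-tabulate {n = n} id

  grid : (X → Y → Z) → List X → List Y → List Z
  grid = List.cartesianProductWith

  grid-length : (f : X → Y → Z) (xs : List X) (ys : List Y) → length (grid f xs ys) ≡ length xs ℕ.* length ys
  grid-length f [] ys = refl
  grid-length f (x ∷ xs) ys = trans (Listₚ.length-++ (List.map (f x) ys))
    (cong₂ ℕ._+_ (Listₚ.length-map (f x) ys) (grid-length f xs ys))

  grid-unique : (f : X → Y → Z) {xs : List X} {ys : List Y} → Unique xs → Unique ys →
    (∀ {x x′ y y′} → x ∈ xs → x′ ∈ xs → y ∈ ys → y′ ∈ ys → f x y ≡ f x′ y′ → x ≡ x′ × y ≡ y′) →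
    Unique (grid f xs ys)
  grid-unique f {[]} [] v inj = []
  grid-unique f {x ∷ xs} {ys} (x∉ ∷ u) v inj = Uniqueₚ.++⁺
    (map-unique (f x) v (λ a b e → proj₂ (inj (here refl) (here refl) a b e)))
    (grid-unique f u v (λ a b → inj (there a) (there b)))
    disj
    where
    disj : ∀ {z} → (z ∈ List.map (f x) ys) × (z ∈ grid f xs ys) → ⊥
    disj (z∈ , z∈′) with ∈-map⁻ (f x) z∈ | ∈-cartesianProductWith⁻ f xs ys z∈′
    ... | y , y∈ , refl | x′ , y′ , x′∈ , y′∈ , e = All.lookup x∉ x′∈ (proj₁ (inj (here refl) (there x′∈) y∈ y′∈ e))

  ∈-grid⁻ : (f : X → Y → Z) (xs : List X) (ys : List Y) {z : Z} → z ∈ grid f xs ys →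
    ∃₂ λ x y → x ∈ xs × y ∈ ys × z ≡ f x y
  ∈-grid⁻ = ∈-cartesianProductWith⁻

  -- Delete the pairs `x`, `ι x` one after another; `n` bounds the length and drives the recursion,
  -- since the shortened list is not a structural part of the input.
  involution-even : {X : Set} → DecidableEquality X → (ι : X → X) → (∀ x → ι (ι x) ≡ x) → (∀ x → ι x ≢ x) →
    (n : ℕ) (xs : List X) → length xs ℕ.≤ n → Unique xs → (∀ {x} → x ∈ xs → ι x ∈ xs) →
    ∃ λ k → length xs ≡ 2 ℕ.* k
  involution-even _≟_ ι ιι ι≢ n [] _ _ _ = 0 , refl
  involution-even _≟_ ι ιι ι≢ (suc n) (x ∷ xs) (s≤s le) (x∉ ∷ u) closed =
    let k , e = involution-even _≟_ ι ιι ι≢ n zs (ℕₚ.≤-trans zs≤ le) (∖-unique _≟_ u _) closed′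
    in suc k , trans (cong suc (trans len (cong suc e))) (cong suc (sym (ℕₚ.+-suc k (k ℕ.+ 0))))
    where
    zs = _∖_ _≟_ xs (ι x ∷ [])
    ιx∈ : ι x ∈ xs
    ιx∈ with closed (here refl)
    ... | here e = ⊥-elim (ι≢ x e)
    ... | there m = m
    len : length xs ≡ suc (length zs)
    len = ℕₚ.≤-antisym (length-∖ _≟_ u (ι x ∷ [])) (∖-member< _≟_ xs ιx∈)
    zs≤ : length zs ℕ.≤ length xs
    zs≤ = ℕₚ.<⇒≤ (∖-member< _≟_ xs ιx∈)
    closed′ : ∀ {y} → y ∈ zs → ι y ∈ zs
    closed′ {y} y∈ with ∈-∖⁻ _≟_ xs (ι x ∷ []) y∈
    ... | y∈xs , y≢ with closed (there y∈xs)
    ... | here ιy≡x = ⊥-elim (y≢ (here (trans (sym (ιι y)) (cong ι ιy≡x))))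
    ... | there m = ∈-∖⁺ _≟_ m λ { (here e) → All.lookup x∉ y∈xs (trans (sym (ιι x)) (trans (cong ι (sym e)) (ιι y))) }

-- With coefficients in an abstract ring the solver cannot compute that x - x vanishes, hence integers.
module IntegerSolver (R : CommutativeRing 0ℓ 0ℓ) where
  open CommutativeRing R
    hiding (trans) renaming (refl to ≈-refl; sym to ≈-sym; _+_ to _⊹_; _*_ to _✶_; -_ to ⊟_)
  open import Data.Integer using (+_; -[1+_])
  open import Relation.Binary.Reasoning.Setoid setoid
  open Algebra.Properties.Semiring.Mult.TCOptimised semiring renaming (_×_ to _⋆_)
  open Algebra.Properties.Ring ring using (-‿distribˡ-*; -‿distribʳ-*; -‿involutive; -‿anti-homo-+; -0#≈0#)

  ⟦_⟧ℤ : ℤ → Carrier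
  ⟦ + n ⟧ℤ = n ⋆ 1#
  ⟦ -[1+ n ] ⟧ℤ = ⊟ (suc n ⋆ 1#)

  cancel-1 : ∀ x y → (1# ⊹ x) ⊹ ⊟ (1# ⊹ y) ≈ x ⊹ ⊟ y
  cancel-1 x y = begin
    (1# ⊹ x) ⊹ ⊟ (1# ⊹ y)      ≈⟨ +-cong (+-comm 1# x) (-‿anti-homo-+ 1# y) ⟩
    (x ⊹ 1#) ⊹ (⊟ y ⊹ ⊟ 1#)    ≈⟨ +-cong ≈-refl (+-comm (⊟ y) (⊟ 1#)) ⟩
    (x ⊹ 1#) ⊹ (⊟ 1# ⊹ ⊟ y)    ≈⟨ +-assoc x 1# _ ⟩
    x ⊹ (1# ⊹ (⊟ 1# ⊹ ⊟ y))    ≈⟨ +-cong ≈-refl (≈-sym (+-assoc 1# _ _)) ⟩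
    x ⊹ ((1# ⊹ ⊟ 1#) ⊹ ⊟ y)    ≈⟨ +-cong ≈-refl (+-cong (-‿inverseʳ 1#) ≈-refl) ⟩
    x ⊹ (0# ⊹ ⊟ y)             ≈⟨ +-cong ≈-refl (+-identityˡ _) ⟩
    x ⊹ ⊟ y                    ∎

  ⊖-homo : ∀ m n → ⟦ m ℤ.⊖ n ⟧ℤ ≈ (m ⋆ 1#) ⊹ ⊟ (n ⋆ 1#)
  ⊖-homo m zero = ≈-sym (begin
    (m ⋆ 1#) ⊹ ⊟ 0#  ≈⟨ +-cong ≈-refl -0#≈0# ⟩
    (m ⋆ 1#) ⊹ 0#    ≈⟨ +-identityʳ _ ⟩
    m ⋆ 1#           ∎)
  ⊖-homo zero (suc n) = ≈-sym (+-identityˡ _)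
  ⊖-homo (suc m) (suc n) = begin
    ⟦ suc m ℤ.⊖ suc n ⟧ℤ                    ≡⟨ cong ⟦_⟧ℤ (ℤₚ.[1+m]⊖[1+n]≡m⊖n m n) ⟩
    ⟦ m ℤ.⊖ n ⟧ℤ                            ≈⟨ ⊖-homo m n ⟩
    (m ⋆ 1#) ⊹ ⊟ (n ⋆ 1#)                   ≈⟨ ≈-sym (cancel-1 _ _) ⟩
    (1# ⊹ (m ⋆ 1#)) ⊹ ⊟ (1# ⊹ (n ⋆ 1#))     ≈⟨ +-cong (≈-sym (1+× m 1#)) (-‿cong (≈-sym (1+× n 1#))) ⟩
    (suc m ⋆ 1#) ⊹ ⊟ (suc n ⋆ 1#)           ∎

  ℤ-+-homo : ∀ i j → ⟦ i ℤ.+ j ⟧ℤ ≈ ⟦ i ⟧ℤ ⊹ ⟦ j ⟧ℤ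
  ℤ-+-homo (+ m) (+ n) = ×-homo-+ 1# m n
  ℤ-+-homo (+ m) -[1+ n ] = ⊖-homo m (suc n)
  ℤ-+-homo -[1+ m ] (+ n) = begin
    ⟦ n ℤ.⊖ suc m ⟧ℤ                  ≈⟨ ⊖-homo n (suc m) ⟩
    (n ⋆ 1#) ⊹ ⊟ (suc m ⋆ 1#)         ≈⟨ +-comm _ _ ⟩
    ⊟ (suc m ⋆ 1#) ⊹ (n ⋆ 1#)         ∎
  ℤ-+-homo -[1+ m ] -[1+ n ] = begin
    ⊟ (suc (suc (m ℕ.+ n)) ⋆ 1#)          ≡⟨ cong (λ k → ⊟ (suc k ⋆ 1#)) (sym (ℕₚ.+-suc m n)) ⟩
    ⊟ ((suc m ℕ.+ suc n) ⋆ 1#)            ≈⟨ -‿cong (×-homo-+ 1# (suc m) (suc n)) ⟩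
    ⊟ ((suc m ⋆ 1#) ⊹ (suc n ⋆ 1#))       ≈⟨ -‿anti-homo-+ _ _ ⟩
    ⊟ (suc n ⋆ 1#) ⊹ ⊟ (suc m ⋆ 1#)       ≈⟨ +-comm _ _ ⟩
    ⊟ (suc m ⋆ 1#) ⊹ ⊟ (suc n ⋆ 1#)       ∎

  ℤ--homo : ∀ i → ⟦ ℤ.- i ⟧ℤ ≈ ⊟ ⟦ i ⟧ℤ
  ℤ--homo (+ zero) = ≈-sym -0#≈0#
  ℤ--homo (+ suc n) = ≈-refl
  ℤ--homo -[1+ n ] = ≈-sym (-‿involutive _)

  ℤ-*-homo-ℕ : ∀ m n → ⟦ + m ℤ.* + n ⟧ℤ ≈ (m ⋆ 1#) ✶ (n ⋆ 1#)
  ℤ-*-homo-ℕ m n = begin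
    ⟦ + m ℤ.* + n ⟧ℤ     ≡⟨ cong ⟦_⟧ℤ (sym (ℤₚ.pos-* m n)) ⟩
    (m ℕ.* n) ⋆ 1#       ≈⟨ ×1-homo-* m n ⟩
    (m ⋆ 1#) ✶ (n ⋆ 1#)  ∎

  ℤ-*-homo : ∀ i j → ⟦ i ℤ.* j ⟧ℤ ≈ ⟦ i ⟧ℤ ✶ ⟦ j ⟧ℤ
  ℤ-*-homo (+ m) (+ n) = ℤ-*-homo-ℕ m n
  ℤ-*-homo (+ m) -[1+ n ] = begin
    ⟦ + m ℤ.* (ℤ.- (+ suc n)) ⟧ℤ     ≡⟨ cong ⟦_⟧ℤ (sym (ℤₚ.neg-distribʳ-* (+ m) (+ suc n))) ⟩
    ⟦ ℤ.- (+ m ℤ.* + suc n) ⟧ℤ       ≈⟨ ℤ--homo (+ m ℤ.* + suc n) ⟩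
    ⊟ ⟦ + m ℤ.* + suc n ⟧ℤ           ≈⟨ -‿cong (ℤ-*-homo-ℕ m (suc n)) ⟩
    ⊟ ((m ⋆ 1#) ✶ (suc n ⋆ 1#))      ≈⟨ -‿distribʳ-* _ _ ⟩
    (m ⋆ 1#) ✶ ⊟ (suc n ⋆ 1#)        ∎
  ℤ-*-homo -[1+ m ] (+ n) = begin
    ⟦ (ℤ.- (+ suc m)) ℤ.* + n ⟧ℤ     ≡⟨ cong ⟦_⟧ℤ (sym (ℤₚ.neg-distribˡ-* (+ suc m) (+ n))) ⟩
    ⟦ ℤ.- (+ suc m ℤ.* + n) ⟧ℤ       ≈⟨ ℤ--homo (+ suc m ℤ.* + n) ⟩
    ⊟ ⟦ + suc m ℤ.* + n ⟧ℤ           ≈⟨ -‿cong (ℤ-*-homo-ℕ (suc m) n) ⟩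
    ⊟ ((suc m ⋆ 1#) ✶ (n ⋆ 1#))      ≈⟨ -‿distribˡ-* _ _ ⟩
    ⊟ (suc m ⋆ 1#) ✶ (n ⋆ 1#)        ∎
  ℤ-*-homo -[1+ m ] -[1+ n ] = begin
    ⟦ + suc m ℤ.* + suc n ⟧ℤ               ≈⟨ ℤ-*-homo-ℕ (suc m) (suc n) ⟩
    (suc m ⋆ 1#) ✶ (suc n ⋆ 1#)            ≈⟨ ≈-sym (-‿involutive _) ⟩
    ⊟ ⊟ ((suc m ⋆ 1#) ✶ (suc n ⋆ 1#))      ≈⟨ -‿cong (-‿distribˡ-* _ _) ⟩
    ⊟ (⊟ (suc m ⋆ 1#) ✶ (suc n ⋆ 1#))      ≈⟨ -‿distribʳ-* _ _ ⟩
    ⊟ (suc m ⋆ 1#) ✶ ⊟ (suc n ⋆ 1#)        ∎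

  ℤ-rawRing : RawRing 0ℓ 0ℓ
  ℤ-rawRing = record { Carrier = ℤ ; _≈_ = _≡_ ; _+_ = ℤ._+_ ; _*_ = ℤ._*_ ; -_ = ℤ.-_ ; 0# = + 0 ; 1# = + 1 }

  morphism : ℤ-rawRing -Raw-AlmostCommutative⟶ fromCommutativeRing R
  morphism = record
    { ⟦_⟧ = ⟦_⟧ℤ ; +-homo = ℤ-+-homo ; *-homo = ℤ-*-homo ; -‿homo = ℤ--homo ; 0-homo = ≈-refl ; 1-homo = ≈-refl }

  _≟coeff_ : ∀ i j → Maybe (⟦ i ⟧ℤ ≈ ⟦ j ⟧ℤ)
  i ≟coeff j with i ℤ.≟ j
  ... | yes refl = just ≈-refl
  ... | no _ = nothing

  open Algebra.Solver.Ring ℤ-rawRing (fromCommutativeRing R) morphism _≟coeff_ public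
    using (solve; _:=_; _:+_; _:*_; :-_; _:-_; con; Polynomial)

  :0 :1 : ∀ {n} → Polynomial n
  :0 = con (+ 0)
  :1 = con (+ 1)

-- Arithmetic in the field, and its characteristic.

module FieldTheory {q : ℕ} (F : FField q) where
  open FField F public renaming (_+_ to infixl 6 _+_; _*_ to infixl 7 _*_; -_ to infix 8 -_)

  commutativeRing : CommutativeRing 0ℓ 0ℓ
  commutativeRing = record { isCommutativeRing = isCommutativeRing }

  open CommutativeRing commutativeRing public
    using (+-assoc; +-comm; +-identityˡ; +-identityʳ; *-assoc; *-comm; *-identityˡ; *-identityʳ;
           -‿inverseʳ; zeroˡ; zeroʳ; _-_)
  open IntegerSolver commutativeRing public using (solve; _:=_; _:+_; _:*_; :-_; _:-_; :0; :1)

  _≟ᶠ_ : DecidableEquality (Fin q)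
  _≟ᶠ_ = Finₚ._≟_

  diff⇒≡ : ∀ {x y} → x - y ≡ 0# → x ≡ y
  diff⇒≡ {x} {y} e = trans (solve 2 (λ x y → x := (x :- y) :+ y) refl x y)
    (trans (cong (_+ y) e) (+-identityˡ y))

  ≡⇒diff : ∀ {x y} → x ≡ y → x - y ≡ 0#
  ≡⇒diff {x} refl = -‿inverseʳ x

  cancelˡ : ∀ {x y} → x ≢ 0# → x * y ≡ 0# → y ≡ 0#
  cancelˡ {x} {y} x≢0 e = let i , xi = inverse x x≢0 in begin
    y            ≡⟨ *-identityˡ y ⟨
    1# * y       ≡⟨ cong (_* y) xi ⟨
    (x * i) * y  ≡⟨ solve 3 (λ x i y → (x :* i) :* y := i :* (x :* y)) refl x i y ⟩
    i * (x * y)  ≡⟨ cong (i *_) e ⟩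
    i * 0#       ≡⟨ zeroʳ i ⟩
    0#           ∎
    where open ≡-Reasoning

  *-≢0 : ∀ {x y} → x ≢ 0# → y ≢ 0# → x * y ≢ 0#
  *-≢0 x≢0 y≢0 e = y≢0 (cancelˡ x≢0 e)

  cancelˡ-≡ : ∀ {x y z} → x ≢ 0# → x * y ≡ x * z → y ≡ z
  cancelˡ-≡ {x} {y} {z} x≢0 e = diff⇒≡ (cancelˡ x≢0
    (trans (solve 3 (λ x y z → x :* (y :- z) := x :* y :- x :* z) refl x y z) (≡⇒diff e)))

  -≢0 : ∀ {x} → x ≢ 0# → - x ≢ 0#
  -≢0 {x} x≢0 e = x≢0 (trans (solve 1 (λ x → x := :- (:- x)) refl x)
    (trans (cong -_ e) (solve 0 (:- :0 := :0) refl)))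

  diff≢0 : ∀ {x y} → x ≢ y → x - y ≢ 0#
  diff≢0 ne e = ne (diff⇒≡ e)

  inverse≢0 : ∀ {x y} → x * y ≡ 1# → y ≢ 0#
  inverse≢0 {x} e refl = 0≢1 (trans (sym (zeroʳ x)) e)

  1≢0 : 1# ≢ 0#
  1≢0 = 0≢1 ∘ sym

  -- Otherwise adding `1#` would be an involution of the field without fixed points, and `q` would
  -- be even.
  odd⇒2≢0 : IsOdd q → 1# + 1# ≢ 0#
  odd⇒2≢0 (k , q≡) two≡0 =
    let m , e = Counting.involution-even _≟ᶠ_ (_+ 1#) twice moves q (allFin q)
                  (ℕₚ.≤-reflexive (Counting.allFin-length q)) (Counting.allFin-unique q) (λ {x} _ → ∈-allFin (x + 1#))
    in ℕₚ.even≢odd m k (trans (sym e) (trans (Counting.allFin-length q) q≡))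
    where
    twice : ∀ x → (x + 1#) + 1# ≡ x
    twice x = trans (+-assoc x 1# 1#) (trans (cong (_+_ x) two≡0) (+-identityʳ x))
    moves : ∀ x → x + 1# ≢ x
    moves x e = 0≢1 (sym (trans (solve 1 (λ x → :1 := (x :+ :1) :- x) refl x) (≡⇒diff e)))

-- Linear algebra over a finite field.

module LinearAlgebra {q : ℕ} (F : FField q) where
  open FieldTheory F public
  open Geo F public renaming (_⊕_ to infixl 5 _⊕_; _·_ to infixr 6 _·_)

  _≟ᵛ_ : ∀ {n} → DecidableEquality (V n)
  _≟ᵛ_ = Vecₚ.≡-dec _≟ᶠ_

  ext : ∀ {n} {v w : V n} → (∀ i → lookup v i ≡ lookup w i) → v ≡ w
  ext {v = []} {[]} _ = refl
  ext {v = x ∷ v} {y ∷ w} e = cong₂ _∷_ (e zero) (ext (e ∘ suc))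

  -- Formal linear combinations: an identity between them holds for vectors as soon as it holds for scalars.
  infixl 5 _⊞_
  infixr 6 _⊡_
  data Lin (k : ℕ) : Set where
    # : Fin k → Lin k
    _⊞_ : Lin k → Lin k → Lin k
    _⊡_ : Fin q → Lin k → Lin k
    ∅ : Lin k

  #0 : ∀ {k} → Lin (suc k)
  #0 = # zero
  #1 : ∀ {k} → Lin (2 ℕ.+ k)
  #1 = # (suc zero)
  #2 : ∀ {k} → Lin (3 ℕ.+ k)
  #2 = # (suc (suc zero))
  #3 : ∀ {k} → Lin (4 ℕ.+ k)
  #3 = # (suc (suc (suc zero)))
  #4 : ∀ {k} → Lin (5 ℕ.+ k)
  #4 = # (suc (suc (suc (suc zero))))

  vec : ∀ {k n} → Lin k → Vec (V n) k → V n
  vec (# j) us = lookup us j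
  vec (e ⊞ f) us = vec e us ⊕ vec f us
  vec (c ⊡ e) us = c · vec e us
  vec ∅ us = 𝟘

  scal : ∀ {k} → Lin k → V k → Fin q
  scal (# j) xs = lookup xs j
  scal (e ⊞ f) xs = scal e xs + scal f xs
  scal (c ⊡ e) xs = c * scal e xs
  scal ∅ xs = 0#

  record Linear {n : ℕ} (f : V n → Fin q) : Set where
    field
      add : ∀ v w → f (v ⊕ w) ≡ f v + f w
      scale : ∀ c v → f (c · v) ≡ c * f v
      nil : f 𝟘 ≡ 0#
  open Linear

  linear-vec : ∀ {n k} {f : V n → Fin q} → Linear f → (e : Lin k) (us : Vec (V n) k) →
    f (vec e us) ≡ scal e (map f us)
  linear-vec {f = f} lin (# j) us = sym (Vecₚ.lookup-map j f us)
  linear-vec lin (e ⊞ e′) us = trans (add lin _ _) (cong₂ _+_ (linear-vec lin e us) (linear-vec lin e′ us))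
  linear-vec lin (c ⊡ e) us = trans (scale lin c _) (cong (c *_) (linear-vec lin e us))
  linear-vec lin ∅ us = nil lin

  lookup-linear : ∀ {n} (i : Fin n) → Linear (λ (v : V n) → lookup v i)
  lookup-linear i = record
    { add = Vecₚ.lookup-zipWith _+_ i ; scale = λ c → Vecₚ.lookup-map i (c *_) ; nil = Vecₚ.lookup-replicate i 0# }

  vec-identity : ∀ {n k} (e f : Lin k) → (∀ xs → scal e xs ≡ scal f xs) →
    (us : Vec (V n) k) → vec e us ≡ vec f us
  vec-identity e f h us = ext λ i →
    trans (linear-vec (lookup-linear i) e us) (trans (h _) (sym (linear-vec (lookup-linear i) f us)))

  dot-⊕ : ∀ {n} (p v w : V n) → dot p (v ⊕ w) ≡ dot p v + dot p w
  dot-⊕ [] [] [] = sym (+-identityˡ 0#)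
  dot-⊕ (a ∷ p) (x ∷ v) (y ∷ w) rewrite dot-⊕ p v w =
    solve 5 (λ a x y s t → a :* (x :+ y) :+ (s :+ t) := a :* x :+ s :+ (a :* y :+ t)) refl a x y (dot p v) (dot p w)

  dot-· : ∀ {n} (p : V n) c v → dot p (c · v) ≡ c * dot p v
  dot-· [] c [] = sym (zeroʳ c)
  dot-· (a ∷ p) c (x ∷ v) rewrite dot-· p c v =
    solve 4 (λ a c x s → a :* (c :* x) :+ c :* s := c :* (a :* x :+ s)) refl a c x (dot p v)

  dot-𝟘 : ∀ {n} (p : V n) → dot p 𝟘 ≡ 0#
  dot-𝟘 [] = refl
  dot-𝟘 (a ∷ p) rewrite dot-𝟘 p = trans (+-identityʳ _) (zeroʳ a)

  dot-comm : ∀ {n} (p v : V n) → dot p v ≡ dot v p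
  dot-comm [] [] = refl
  dot-comm (a ∷ p) (x ∷ v) = cong₂ _+_ (*-comm a x) (dot-comm p v)

  dot-linear : ∀ {n} (p : V n) → Linear (dot p)
  dot-linear p = record { add = dot-⊕ p ; scale = dot-· p ; nil = dot-𝟘 p }

  comb-⊕ : ∀ {k n} (us : Vec (V n) k) cs ds → comb us (cs ⊕ ds) ≡ comb us cs ⊕ comb us ds
  comb-⊕ [] [] [] = vec-identity ∅ (∅ ⊞ ∅) (λ _ → sym (+-identityˡ 0#)) []
  comb-⊕ (u ∷ us) (c ∷ cs) (d ∷ ds) rewrite comb-⊕ us cs ds =
    vec-identity ((c + d) ⊡ # zero ⊞ (# (suc zero) ⊞ # (suc (suc zero))))
      (c ⊡ # zero ⊞ # (suc zero) ⊞ (d ⊡ # zero ⊞ # (suc (suc zero))))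
      (λ { (x ∷ y ∷ z ∷ []) → solve 5 (λ c d x y z → (c :+ d) :* x :+ (y :+ z) := c :* x :+ y :+ (d :* x :+ z)) refl c d x y z })
      (u ∷ comb us cs ∷ comb us ds ∷ [])

  comb-· : ∀ {k n} (us : Vec (V n) k) c ds → comb us (c · ds) ≡ c · comb us ds
  comb-· [] c [] = vec-identity ∅ (c ⊡ ∅) (λ _ → sym (zeroʳ c)) []
  comb-· (u ∷ us) c (d ∷ ds) rewrite comb-· us c ds =
    vec-identity (c * d ⊡ # zero ⊞ c ⊡ # (suc zero)) (c ⊡ (d ⊡ # zero ⊞ # (suc zero)))
      (λ { (x ∷ y ∷ []) → solve 4 (λ c d x y → c :* d :* x :+ c :* y := c :* (d :* x :+ y)) refl c d x y })
      (u ∷ comb us ds ∷ [])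

  comb-𝟘 : ∀ {k n} (us : Vec (V n) k) → comb us 𝟘 ≡ 𝟘
  comb-𝟘 [] = refl
  comb-𝟘 (u ∷ us) rewrite comb-𝟘 us =
    vec-identity (0# ⊡ # zero ⊞ ∅) ∅ (λ { (x ∷ []) → trans (+-identityʳ _) (zeroˡ x) }) (u ∷ [])

  comb-vec : ∀ {j k n} (us : Vec (V n) k) (e : Lin j) (cs : Vec (V k) j) →
    comb us (vec e cs) ≡ vec e (map (comb us) cs)
  comb-vec us (# j) cs = sym (Vecₚ.lookup-map j (comb us) cs)
  comb-vec us (e ⊞ f) cs = trans (comb-⊕ us (vec e cs) (vec f cs)) (cong₂ _⊕_ (comb-vec us e cs) (comb-vec us f cs))
  comb-vec us (c ⊡ e) cs = trans (comb-· us c (vec e cs)) (cong (c ·_) (comb-vec us e cs))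
  comb-vec us ∅ cs = comb-𝟘 us

  comb-comb : ∀ {j k n} (us : Vec (V n) k) (M : Vec (V k) j) cs → comb us (comb M cs) ≡ comb (map (comb us) M) cs
  comb-comb us [] [] = comb-𝟘 us
  comb-comb us (r ∷ M) (c ∷ cs) = trans (comb-⊕ us (c · r) (comb M cs)) (cong₂ _⊕_ (comb-· us c r) (comb-comb us M cs))

  dot-comb : ∀ {k n} (p : V n) (us : Vec (V n) k) cs → dot p (comb us cs) ≡ dot cs (map (dot p) us)
  dot-comb p [] [] = dot-𝟘 p
  dot-comb p (u ∷ us) (c ∷ cs) = trans (dot-⊕ p _ _) (cong₂ _+_ (dot-· p c u) (dot-comb p us cs))

  neg : ∀ {n} → V n → V n
  neg v = (- 1#) · v

  _⊝_ : ∀ {n} → V n → V n → V n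
  v ⊝ w = v ⊕ neg w
  infixl 5 _⊝_

  ⊝≡𝟘⇒≡ : ∀ {n} {v w : V n} → v ⊝ w ≡ 𝟘 → v ≡ w
  ⊝≡𝟘⇒≡ {v = v} {w} e = trans
    (vec-identity (# zero) (# zero ⊞ (- 1#) ⊡ # (suc zero) ⊞ # (suc zero))
      (λ { (x ∷ y ∷ []) → solve 2 (λ x y → x := x :+ (:- :1) :* y :+ y) refl x y }) (v ∷ w ∷ []))
    (trans (cong (_⊕ w) e) (vec-identity (∅ ⊞ # zero) (# zero) (λ { (x ∷ []) → +-identityˡ x }) (w ∷ [])))

  v⊝v : ∀ {n} (v : V n) → v ⊝ v ≡ 𝟘
  v⊝v v = vec-identity (# zero ⊞ (- 1#) ⊡ # zero) ∅
    (λ { (x ∷ []) → solve 1 (λ x → x :+ (:- :1) :* x := :0) refl x }) (v ∷ [])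

  ·-cancel : ∀ {n} {c} {v : V n} → c ≢ 0# → c · v ≡ 𝟘 → v ≡ 𝟘
  ·-cancel {c = c} {v} c≢0 e = let i , ci = inverse c c≢0 in trans
    (vec-identity (# zero) (1# ⊡ # zero) (λ { (x ∷ []) → sym (*-identityˡ x) }) (v ∷ []))
    (trans (cong (_· v) (trans (sym ci) (*-comm c i)))
    (trans (vec-identity ((i * c) ⊡ # zero) (i ⊡ c ⊡ # zero) (λ { (x ∷ []) → *-assoc i c x }) (v ∷ []))
    (trans (cong (i ·_) e) (vec-identity {k = 0} (i ⊡ ∅) ∅ (λ _ → zeroʳ i) []))))

  comb-injective : ∀ {k n} {us : Vec (V n) k} → Independent us → ∀ {cs ds} → comb us cs ≡ comb us ds → cs ≡ ds
  comb-injective {us = us} ind {cs} {ds} e = ⊝≡𝟘⇒≡ (ind _ (trans (comb-⊕ us cs (neg ds))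
    (trans (cong₂ _⊕_ e (comb-· us (- 1#) ds)) (v⊝v (comb us ds)))))

  -- Equality with `𝟘` is decidable, so independence can be recovered from its double negation,
  -- which is all that `¬ Collinear` offers.
  independent-stable : ∀ {k n} {us : Vec (V n) k} → ¬ ¬ Independent us → Independent us
  independent-stable nn cs e = decidable-stable (cs ≟ᵛ 𝟘) λ ne → nn λ ind → ne (ind cs e)

  span-⊕ : ∀ {k n} {us : Vec (V n) k} {v w} → InSpan us v → InSpan us w → InSpan us (v ⊕ w)
  span-⊕ {us = us} (c , refl) (d , refl) = c ⊕ d , sym (comb-⊕ us c d)

  span-· : ∀ {k n} {us : Vec (V n) k} c {v} → InSpan us v → InSpan us (c · v)
  span-· {us = us} c (d , refl) = c · d , sym (comb-· us c d)

  span-𝟘 : ∀ {k n} {us : Vec (V n) k} → InSpan us 𝟘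
  span-𝟘 {us = us} = 𝟘 , sym (comb-𝟘 us)

  span-there : ∀ {k n} {us : Vec (V n) k} u {v} → InSpan us v → InSpan (u ∷ us) v
  span-there {us = us} u (c , refl) = 0# ∷ c ,
    vec-identity (# zero) (0# ⊡ # (suc zero) ⊞ # zero)
      (λ { (x ∷ y ∷ []) → solve 2 (λ x y → x := :0 :* y :+ x) refl x y }) (comb us c ∷ u ∷ [])

  span-here : ∀ {k n} (us : Vec (V n) k) u → InSpan (u ∷ us) u
  span-here us u = 1# ∷ 𝟘 , trans
    (vec-identity (# zero) (1# ⊡ # zero ⊞ ∅) (λ { (x ∷ []) → solve 1 (λ x → x := :1 :* x :+ :0) refl x }) (u ∷ []))
    (cong (1# · u ⊕_) (sym (comb-𝟘 us)))

  span-comb : ∀ {j k n} {us : Vec (V n) k} {vs : Vec (V n) j} → VAll (InSpan us) vs → ∀ cs → InSpan us (comb vs cs)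
  span-comb [] [] = span-𝟘
  span-comb (p ∷ ps) (c ∷ cs) = span-⊕ (span-· c p) (span-comb ps cs)

  span-trans : ∀ {j k n} {us : Vec (V n) k} {vs : Vec (V n) j} → VAll (InSpan us) vs → ∀ {v} → InSpan vs v → InSpan us v
  span-trans ps (cs , refl) = span-comb ps cs

  span-⊝ : ∀ {k n} {us : Vec (V n) k} {v w} → InSpan us v → InSpan us w → InSpan us (v ⊝ w)
  span-⊝ p p′ = span-⊕ p (span-· (- 1#) p′)

  span-cancel : ∀ {k n} {us : Vec (V n) k} {v w} → InSpan us (v ⊕ w) → InSpan us v → InSpan us w
  span-cancel {us = us} {v} {w} p p′ = subst (InSpan us)
    (vec-identity (# zero ⊞ # (suc zero) ⊞ (- 1#) ⊡ # zero) (# (suc zero))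
      (λ { (x ∷ y ∷ []) → solve 2 (λ x y → x :+ y :+ (:- :1) :* x := y) refl x y }) (v ∷ w ∷ []))
    (span-⊝ p p′)

  span-·-cancel : ∀ {k n} {us : Vec (V n) k} {c v} → c ≢ 0# → InSpan us (c · v) → InSpan us v
  span-·-cancel {us = us} {c} {v} c≢0 p = let i , ci = inverse c c≢0 in subst (InSpan us)
    (trans (vec-identity (i ⊡ c ⊡ # zero) (c * i ⊡ # zero)
       (λ { (x ∷ []) → solve 3 (λ i c x → i :* (c :* x) := c :* i :* x) refl i c x }) (v ∷ []))
     (trans (cong (_· v) ci) (vec-identity (1# ⊡ # zero) (# zero) (λ { (x ∷ []) → *-identityˡ x }) (v ∷ []))))
    (span-· i p)

  Kills : ∀ {k n} → V n → Vec (V n) k → Set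
  Kills ψ us = VAll (λ u → dot ψ u ≡ 0#) us

  kills-comb : ∀ {k n} (ψ : V n) {us : Vec (V n) k} → Kills ψ us → ∀ cs → dot ψ (comb us cs) ≡ 0#
  kills-comb ψ [] [] = dot-𝟘 ψ
  kills-comb ψ {u ∷ us} (p ∷ ps) (c ∷ cs) = trans (dot-⊕ ψ _ _)
    (trans (cong₂ _+_ (trans (dot-· ψ c u) (trans (cong (c *_) p) (zeroʳ c))) (kills-comb ψ ps cs)) (+-identityˡ 0#))

  kills-span : ∀ {k n} (ψ : V n) {us : Vec (V n) k} → Kills ψ us → ∀ {v} → InSpan us v → dot ψ v ≡ 0#
  kills-span ψ ks (cs , refl) = kills-comb ψ ks cs

  nonzero-functional : ∀ {n} (v : V n) → v ≢ 𝟘 → ∃ λ ψ → dot ψ v ≢ 0#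
  nonzero-functional [] ne = ⊥-elim (ne refl)
  nonzero-functional (x ∷ v) ne with x ≟ᶠ 0#
  ... | no x≢0 = 1# ∷ 𝟘 , λ e → x≢0 (trans (sym (trans (cong (1# * x +_) (trans (dot-comm 𝟘 v) (dot-𝟘 v)))
                   (trans (+-identityʳ _) (*-identityˡ x)))) e)
  ... | yes refl with nonzero-functional v (λ e → ne (cong (0# ∷_) e))
  ... | ψ , p = 0# ∷ ψ , λ e → p (trans (sym (trans (cong (_+ dot ψ v) (zeroˡ 0#)) (+-identityˡ _))) e)

  -- Elimination by functionals: if `φ` kills `us` but not `u`, a multiple of `u` is subtracted from
  -- `r` and the smaller problem solved for the remainder. Decidable membership in spans and the
  -- existence of annihilators both come from here.
  separate′ : ∀ {k n} (us : Vec (V n) k) (r : V n) → InSpan us r ⊎ ∃ λ ψ → Kills ψ us × dot ψ r ≢ 0#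
  separate′ [] r with r ≟ᵛ 𝟘
  ... | yes refl = inj₁ span-𝟘
  ... | no ne = let ψ , p = nonzero-functional r ne in inj₂ (ψ , [] , p)
  separate′ {n = n} (u ∷ us) r with separate′ us u
  ... | inj₁ u∈ with separate′ us r
  ...   | inj₁ r∈ = inj₁ (span-there u r∈)
  ...   | inj₂ (ψ , ks , p) = inj₂ (ψ , kills-span ψ ks u∈ ∷ ks , p)
  separate′ {n = n} (u ∷ us) r | inj₂ (φ , ks , φu) =
    decide (separate′ us (r ⊝ (dot φ r * i) · u))
    where
    i = proj₁ (inverse (dot φ u) φu)
    φui : dot φ u * i ≡ 1#
    φui = proj₂ (inverse (dot φ u) φu)
    decide : InSpan us (r ⊝ (dot φ r * i) · u) ⊎ (∃ λ ψ → Kills ψ us × dot ψ (r ⊝ (dot φ r * i) · u) ≢ 0#) →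
      InSpan (u ∷ us) r ⊎ ∃ λ ψ → Kills ψ (u ∷ us) × dot ψ r ≢ 0#
    decide (inj₁ r′∈) = inj₁ (subst (InSpan (u ∷ us))
      (vec-identity (# zero ⊞ (- 1#) ⊡ # (suc zero) ⊞ # (suc zero)) (# zero)
        (λ { (x ∷ y ∷ []) → solve 2 (λ x y → x :+ (:- :1) :* y :+ y := x) refl x y }) (r ∷ (dot φ r * i) · u ∷ []))
      (span-⊕ (span-there u r′∈) (span-· (dot φ r * i) (span-here us u))))
    decide (inj₂ (ψ , ks′ , ψr′)) = inj₂ (χ , χu ∷ VAll.map (λ {v} → both v) (VAll.zip (ks , ks′)) , λ e → ψr′ (trans ψr′≡ e))
      where
      -- The multiple of `φ` makes `χ` vanish at `u`; its value at `r` is then that of `ψ` at the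
      -- reduced vector.
      χ = ψ ⊝ (dot ψ u * i) · φ
      dotχ : ∀ v → dot χ v ≡ dot ψ v + (- 1#) * (dot ψ u * i * dot φ v)
      dotχ v = trans (dot-comm χ v) (trans (linear-vec (dot-linear v)
          (# zero ⊞ (- 1#) ⊡ (dot ψ u * i) ⊡ # (suc zero)) (ψ ∷ φ ∷ []))
        (cong₂ (λ a b → a + (- 1#) * (dot ψ u * i * b)) (dot-comm v ψ) (dot-comm v φ)))
      χu : dot χ u ≡ 0#
      χu = trans (dotχ u) (trans
        (solve 3 (λ a b i → a :+ (:- :1) :* (a :* i :* b) := a :* (:1 :- b :* i)) refl (dot ψ u) (dot φ u) i)
        (trans (cong (dot ψ u *_) (≡⇒diff (sym φui))) (zeroʳ _)))
      both : ∀ v → (dot φ v ≡ 0#) × (dot ψ v ≡ 0#) → dot χ v ≡ 0#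
      both v (e , e′) = trans (dotχ v) (trans (cong₂ (λ a b → a + (- 1#) * (dot ψ u * i * b)) e′ e)
        (solve 2 (λ a i → :0 :+ (:- :1) :* (a :* i :* :0) := :0) refl (dot ψ u) i))
      ψr′≡ : dot ψ (r ⊝ (dot φ r * i) · u) ≡ dot χ r
      ψr′≡ = trans (linear-vec (dot-linear ψ) (# zero ⊞ (- 1#) ⊡ (dot φ r * i) ⊡ # (suc zero)) (r ∷ u ∷ []))
        (trans (solve 4 (λ a b i c → a :+ (:- :1) :* (b :* i :* c) := a :+ (:- :1) :* (c :* i :* b)) refl
          (dot ψ r) (dot φ r) i (dot ψ u)) (sym (dotχ r)))

  abstract
    separate : ∀ {k n} (us : Vec (V n) k) (r : V n) → InSpan us r ⊎ ∃ λ ψ → Kills ψ us × dot ψ r ≢ 0#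
    separate = separate′

  span? : ∀ {k n} (us : Vec (V n) k) v → Dec (InSpan us v)
  span? us v with separate us v
  ... | inj₁ p = yes p
  ... | inj₂ (ψ , ks , p) = no λ v∈ → p (kills-span ψ ks v∈)

  encode : ∀ {n} → V n → Fin (q ℕ.^ n)
  encode v = Fin.funToFin (lookup v)

  encode-injective : ∀ {n} {v w : V n} → encode v ≡ encode w → v ≡ w
  encode-injective {v = v} {w} e = ext λ i → trans (sym (Finₚ.finToFun-funToFin (lookup v) i))
    (trans (cong (λ k → Fin.finToFun k i) e) (Finₚ.finToFun-funToFin (lookup w) i))

  decode : ∀ {n} → Fin (q ℕ.^ n) → V n
  decode i = tabulate (Fin.finToFun i)

  funToFin-cong : ∀ {m n} {f g : Fin m → Fin n} → (∀ i → f i ≡ g i) → Fin.funToFin f ≡ Fin.funToFin g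
  funToFin-cong {zero} e = refl
  funToFin-cong {suc m} e = cong₂ Fin.combine (e zero) (funToFin-cong (e ∘ suc))

  decode-injective : ∀ {n} (i j : Fin (q ℕ.^ n)) → decode {n} i ≡ decode j → i ≡ j
  decode-injective {n} i j e = trans (sym (Finₚ.funToFin-finToFin {n} i))
    (trans (funToFin-cong (λ k → trans (sym (Vecₚ.lookup∘tabulate _ k))
       (trans (cong (λ v → lookup v k) e) (Vecₚ.lookup∘tabulate _ k)))) (Finₚ.funToFin-finToFin {n} j))

  q>1 : 1 ℕ.< q
  q>1 = two 0# 1# 0≢1
    where
    two : ∀ {n} (i j : Fin n) → i ≢ j → 1 ℕ.< n
    two {1} zero zero ne = ⊥-elim (ne refl)
    two {suc (suc n)} _ _ _ = s≤s (s≤s z≤n)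

  -- By counting: a linear map from q^(k+1) to q^k vectors is not injective.
  dependent′ : ∀ {k n} (gs : Vec (V n) k) (us : Vec (V n) (suc k)) → VAll (InSpan gs) us →
    ∃ λ cs → cs ≢ 𝟘 × comb us cs ≡ 𝟘
  dependent′ {k} {n} gs us us∈ =
    let i , j , i<j , e = Finₚ.pigeonhole (ℕₚ.^-monoʳ-< q q>1 (ℕₚ.n<1+n k))
                            (λ l → encode (comb M (decode l)))
    in decode i ⊝ decode j
     , (λ e0 → Finₚ.<⇒≢ i<j (decode-injective i j (⊝≡𝟘⇒≡ e0)))
     , vanish (decode i) (decode j) (encode-injective e)
    where
    rows : ∀ {j} {vs : Vec (V n) j} → VAll (InSpan gs) vs → ∃ λ (M : Vec (V k) j) → map (comb gs) M ≡ vs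
    rows [] = [] , refl
    rows ((c , refl) ∷ ps) = let M , e = rows ps in c ∷ M , cong (comb gs c ∷_) e
    M = proj₁ (rows us∈)
    Mus = proj₂ (rows us∈)
    vanish : ∀ c d → comb M c ≡ comb M d → comb us (c ⊝ d) ≡ 𝟘
    vanish c d e = begin
      comb us (c ⊝ d)                ≡⟨ cong (λ vs → comb vs (c ⊝ d)) Mus ⟨
      comb (map (comb gs) M) (c ⊝ d) ≡⟨ comb-comb gs M (c ⊝ d) ⟨
      comb gs (comb M (c ⊝ d))       ≡⟨ cong (comb gs) (comb-⊕ M c (neg d)) ⟩
      comb gs (comb M c ⊕ comb M (neg d)) ≡⟨ cong (comb gs) (cong₂ _⊕_ e (comb-· M (- 1#) d)) ⟩
      comb gs (comb M d ⊝ comb M d)  ≡⟨ cong (comb gs) (v⊝v (comb M d)) ⟩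
      comb gs 𝟘                      ≡⟨ comb-𝟘 gs ⟩
      𝟘                              ∎
      where open ≡-Reasoning

  abstract
    dependent : ∀ {k n} (gs : Vec (V n) k) (us : Vec (V n) (suc k)) → VAll (InSpan gs) us →
      ∃ λ cs → cs ≢ 𝟘 × comb us cs ≡ 𝟘
    dependent = dependent′

  independent-∷ : ∀ {k n} {us : Vec (V n) k} {v} → Independent us → ¬ InSpan us v → Independent (v ∷ us)
  independent-∷ {us = us} {v} ind v∉ (c ∷ cs) e with c ≟ᶠ 0#
  ... | no c≢0 = ⊥-elim (v∉ (span-·-cancel c≢0 (span-cancel {v = comb us cs} (subst (InSpan us)
          (trans (sym e) (vec-identity (# zero ⊞ # (suc zero)) (# (suc zero) ⊞ # zero)
            (λ { (x ∷ y ∷ []) → +-comm x y }) (c · v ∷ comb us cs ∷ []))) span-𝟘) (cs , refl))))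
  ... | yes refl = cong (0# ∷_) (ind cs (trans
          (vec-identity (# zero) (0# ⊡ # (suc zero) ⊞ # zero)
            (λ { (x ∷ y ∷ []) → solve 2 (λ x y → x := :0 :* y :+ x) refl x y }) (comb us cs ∷ v ∷ [])) e))

  -- A vector of the span of `gs` outside that of `us` would give `k + 1` independent vectors in a
  -- space with `k` generators.
  independent-spans : ∀ {k n} {gs us : Vec (V n) k} → Independent us → VAll (InSpan gs) us →
    ∀ {v} → InSpan gs v → InSpan us v
  independent-spans {gs = gs} {us} ind us∈ {v} v∈ with span? us v
  ... | yes p = p
  ... | no v∉ = let cs , ne , e = dependent gs (v ∷ us) (v∈ ∷ us∈)
                in ⊥-elim (ne (independent-∷ ind v∉ cs e))

  unit : ∀ {n} → Fin n → V n
  unit zero = 1# ∷ 𝟘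
  unit (suc i) = 0# ∷ unit i

  dot-unit : ∀ {n} (p : V n) i → dot p (unit i) ≡ lookup p i
  dot-unit (a ∷ p) zero = trans (cong (a * 1# +_) (dot-𝟘 p)) (trans (+-identityʳ _) (*-identityʳ a))
  dot-unit (a ∷ p) (suc i) = trans (cong₂ _+_ (zeroʳ a) (dot-unit p i)) (+-identityˡ _)

  dot-unit-zero : ∀ {n} (p : V n) → (∀ i → dot p (unit i) ≡ 0#) → p ≡ 𝟘
  dot-unit-zero p z = ext λ i → trans (sym (dot-unit p i)) (trans (z i) (sym (Vecₚ.lookup-replicate i 0#)))

  units : ∀ n → Vec (V n) n
  units zero = []
  units (suc n) = unit zero ∷ map (0# ∷_) (units n)

  units-span : ∀ {n} (v : V n) → comb (units n) v ≡ v
  units-span [] = refl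
  units-span {suc n} (x ∷ v) = trans (cong (x · unit zero ⊕_) (shift (units n) v))
    (cong₂ _∷_ (trans (+-identityʳ _) (*-identityʳ x))
      (trans (cong (x · 𝟘 ⊕_) (units-span v))
        (vec-identity (x ⊡ ∅ ⊞ # zero) (# zero) (λ { (y ∷ []) → solve 2 (λ x y → x :* :0 :+ y := y) refl x y }) (v ∷ []))))
    where
    shift : ∀ {k n} (us : Vec (V n) k) cs → comb (map (0# ∷_) us) cs ≡ 0# ∷ comb us cs
    shift [] [] = refl
    shift (u ∷ us) (c ∷ cs) rewrite shift us cs =
      cong (_∷ (c · u ⊕ comb us cs)) (solve 1 (λ c → c :* :0 :+ :0 := :0) refl c)

  basis-spans : ∀ {n} {us : Vec (V n) n} → Independent us → ∀ v → InSpan us v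
  basis-spans {n} {us} ind v = independent-spans {gs = units n} ind
    (VAll.universal (λ u → u , sym (units-span u)) us) (v , sym (units-span v))

  unit-independent : ∀ {n} → Independent (units n)
  unit-independent cs e = trans (sym (units-span cs)) e

  -- Some unit vector lies outside the span of `k` vectors, and a functional separating it is
  -- nonzero and kills them all.
  annihilator′ : ∀ {k} (us : Vec (V (suc k)) k) → ∃ λ ψ → ψ ≢ 𝟘 × Kills ψ us
  annihilator′ {k} us = decide (go (units (suc k)))
    where
    go : ∀ {j} (es : Vec (V (suc k)) j) → VAll (InSpan us) es ⊎ ∃ λ ψ → ψ ≢ 𝟘 × Kills ψ us
    go [] = inj₁ []
    go (e ∷ es) with separate us e | go es
    ... | inj₂ (ψ , ks , ψe) | _ = inj₂ (ψ , (λ { refl → ψe (trans (dot-comm 𝟘 e) (dot-𝟘 e)) }) , ks)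
    ... | inj₁ _ | inj₂ r = inj₂ r
    ... | inj₁ p | inj₁ ps = inj₁ (p ∷ ps)
    decide : VAll (InSpan us) (units (suc k)) ⊎ (∃ λ ψ → ψ ≢ 𝟘 × Kills ψ us) → ∃ λ ψ → ψ ≢ 𝟘 × Kills ψ us
    decide (inj₂ r) = r
    decide (inj₁ all) = let cs , ne , e = dependent us (units (suc k)) all in ⊥-elim (ne (unit-independent cs e))

  abstract
    annihilator : ∀ {k} (us : Vec (V (suc k)) k) → ∃ λ ψ → ψ ≢ 𝟘 × Kills ψ us
    annihilator = annihilator′

  basis-detects : ∀ {n} {us : Vec (V n) n} ψ → Independent us → Kills ψ us → ψ ≡ 𝟘
  basis-detects ψ ind ks = dot-unit-zero ψ λ i → kills-span ψ ks (basis-spans ind (unit i))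

  element-off : 7 ℕ.≤ q → (xs : List (Fin q)) → length xs ℕ.≤ 6 → ∃ λ x → x ∉ xs
  element-off 7≤q xs le =
    let x , _ , x∉ = Counting.outside _≟ᶠ_ (Counting.allFin-unique q) xs
                       (ℕₚ.≤-<-trans le (subst (6 ℕ.<_) (sym (Counting.allFin-length q)) 7≤q))
    in x , x∉

-- Blocks as the lines of an affine plane on 𝒞.

module Blocks {q : ℕ} (F : FField q) (7≤q : 7 ℕ.≤ q)
  (h : Vec (Fin q) 5) (C : List (Vec (Fin q) 5)) (CPlane : Geo.Plane F → Set)
  (hyp : Geo.Config.Hypotheses F h C CPlane) where
  open Counting
  open LinearAlgebra F public
  open Config h C CPlane public hiding (t)
  open Hypotheses hyp public

  record Block : Set where
    constructor block
    field
      plane : Plane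
      isC : CPlane plane
  open Block public

  infix 4 _on_ _≈_
  _on_ : V 5 → Block → Set
  v on ρ = OnPlane (plane ρ) v

  _≈_ : Block → Block → Set
  ρ ≈ ρ′ = SamePlane (plane ρ) (plane ρ′)

  ≈-sym : ∀ ρ ρ′ → ρ ≈ ρ′ → ρ′ ≈ ρ
  ≈-sym _ _ e v = proj₂ (e v) , proj₁ (e v)

  ≈-trans : ∀ ρ σ τ → ρ ≈ σ → σ ≈ τ → ρ ≈ τ
  ≈-trans _ _ _ e f v = (λ p → proj₁ (f v) (proj₁ (e v) p)) , λ p → proj₂ (e v) (proj₂ (f v) p)

  ≈-on : ∀ ρ ρ′ → ρ ≈ ρ′ → ∀ {v} → v on ρ → v on ρ′
  ≈-on _ _ e {v} = proj₁ (e v)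

  Affine Direction : V 5 → Set
  Affine P = dot h P ≡ 1#
  Direction d = dot h d ≡ 0#

  affine : ∀ {v} → v ∈ C → Affine v
  affine = All.lookup C-affine

  same-of-independent : ∀ ρ ρ′ {us : Vec (V 5) 3} → Independent us → VAll (_on ρ) us → VAll (_on ρ′) us → ρ ≈ ρ′
  same-of-independent ρ ρ′ ind us∈ us∈′ v =
    (λ v∈ → span-trans us∈′ (independent-spans ind us∈ v∈)) , (λ v∈ → span-trans us∈ (independent-spans ind us∈′ v∈))

  opaque
    same : ∀ ρ ρ′ {a b} → a ∈ C → b ∈ C → a ≢ b → a on ρ → b on ρ → a on ρ′ → b on ρ′ → ρ ≈ ρ′
    same ρ ρ′ {a} {b} a∈ b∈ a≢b aρ bρ aρ′ bρ′ = let π , _ , _ , _ , uniq = A2 a b a∈ b∈ a≢b in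
      λ v → (λ p → proj₁ (uniq (plane ρ′) (isC ρ′) aρ′ bρ′ v) (proj₂ (uniq (plane ρ) (isC ρ) aρ bρ v) p))
          , (λ p → proj₁ (uniq (plane ρ) (isC ρ) aρ bρ v) (proj₂ (uniq (plane ρ′) (isC ρ′) aρ′ bρ′ v) p))

  opaque
    join : ∀ {a b} → a ∈ C → b ∈ C → a ≢ b → ∃ λ ρ → a on ρ × b on ρ
    join {a} {b} a∈ b∈ a≢b = let π , c , aπ , bπ , _ = A2 a b a∈ b∈ a≢b in block π c , aπ , bπ

  pts : Block → List (V 5)
  pts ρ = proj₁ (proj₁ (A1-arc (plane ρ) (isC ρ)))

  pts-length : ∀ ρ → length (pts ρ) ≡ q
  pts-length ρ = proj₁ (proj₂ (proj₁ (A1-arc (plane ρ) (isC ρ))))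

  pts-unique : ∀ ρ → Unique (pts ρ)
  pts-unique ρ = proj₁ (proj₂ (proj₂ (proj₁ (A1-arc (plane ρ) (isC ρ)))))

  pts⁻ : ∀ ρ {v} → v ∈ pts ρ → v ∈ C × v on ρ
  pts⁻ ρ {v} = proj₁ (proj₂ (proj₂ (proj₂ (proj₁ (A1-arc (plane ρ) (isC ρ))))) v)

  pts⁺ : ∀ ρ {v} → v ∈ C → v on ρ → v ∈ pts ρ
  pts⁺ ρ {v} v∈ vρ = proj₂ (proj₂ (proj₂ (proj₂ (proj₁ (A1-arc (plane ρ) (isC ρ))))) v) (v∈ , vρ)

  opaque
    arc : ∀ ρ {a b c} → a ∈ C → b ∈ C → c ∈ C → a on ρ → b on ρ → c on ρ →
      a ≢ b → a ≢ c → b ≢ c → Independent (a ∷ b ∷ c ∷ [])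
    arc ρ {a} {b} {c} a∈ b∈ c∈ aρ bρ cρ a≢b a≢c b≢c =
      independent-stable (proj₂ (A1-arc (plane ρ) (isC ρ)) a b c (a∈ , aρ) (b∈ , bρ) (c∈ , cρ) a≢b a≢c b≢c)

  opaque
    pick : ∀ ρ (ys : List (V 5)) → length ys ℕ.≤ 6 → ∃ λ v → v ∈ C × v on ρ × v ∉ ys
    pick ρ ys le = let v , v∈ , v∉ = outside _≟ᵛ_ (pts-unique ρ) ys
                         (ℕₚ.≤-<-trans le (subst (6 ℕ.<_) (sym (pts-length ρ)) 7≤q))
                   in v , proj₁ (pts⁻ ρ v∈) , proj₂ (pts⁻ ρ v∈) , v∉

  infix 4 _on?_
  _on?_ : ∀ v ρ → Dec (v on ρ)
  v on? ρ = span? (gens (plane ρ)) v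

  opaque
    -- Two points of 𝒞 on `ρ` decide the question, by uniqueness in (A2).
    same? : ∀ ρ ρ′ → Dec (ρ ≈ ρ′)
    same? ρ ρ′ with pick ρ [] z≤n
    ... | a , a∈ , aρ , _ with pick ρ (a ∷ []) (s≤s z≤n)
    ... | b , b∈ , bρ , b∉ with a on? ρ′ | b on? ρ′
    ... | no a∉ | _ = no λ e → a∉ (≈-on ρ ρ′ e aρ)
    ... | yes _ | no b∉′ = no λ e → b∉′ (≈-on ρ ρ′ e bρ)
    ... | yes aρ′ | yes bρ′ = yes (same ρ ρ′ a∈ b∈ (λ e → b∉ (here (sym e))) aρ bρ aρ′ bρ′)

  Meet : Block → Block → Set
  Meet ρ σ = ∃ λ v → v ∈ C × v on ρ × v on σ

  meet-sym : ∀ {ρ σ} → Meet ρ σ → Meet σ ρ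
  meet-sym (v , v∈ , vρ , vσ) = v , v∈ , vσ , vρ

  opaque
    meet? : ∀ ρ σ → Dec (Meet ρ σ)
    meet? ρ σ with Any.any? (_on? σ) (pts ρ)
    ... | yes p = let v , v∈ , vσ = find p in yes (v , proj₁ (pts⁻ ρ v∈) , proj₂ (pts⁻ ρ v∈) , vσ)
    ... | no np = no λ { (v , v∈ , vρ , vσ) → np (lose (pts⁺ ρ v∈ vρ) vσ) }

  opaque
    meet-unique : ∀ ρ σ {v w} → ¬ ρ ≈ σ → v ∈ C → w ∈ C → v on ρ → w on ρ → v on σ → w on σ → v ≡ w
    meet-unique ρ σ {v} {w} ne v∈ w∈ vρ wρ vσ wσ with v ≟ᵛ w
    ... | yes e = e
    ... | no v≢w = ⊥-elim (ne (same ρ σ v∈ w∈ v≢w vρ wρ vσ wσ))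

  private
    p = ℕ.pred q
    sp≡q : suc p ≡ q
    sp≡q = ℕₚ.suc-pred q {{ℕ.>-nonZero (ℕₚ.≤-trans (s≤s z≤n) 7≤q)}}

  -- Distinct blocks through `E` share no other point of 𝒞, so each contributes `q - 1` new points.
  pencil-points : ∀ {E} → E ∈ C → (bs : List Block) → AllPairs (λ b b′ → ¬ b ≈ b′) bs → All (E on_) bs →
    ∃ λ zs → Unique zs × (∀ {z} → z ∈ zs → z ∈ C × z ≢ E × ∃ λ b → b ∈ bs × z on b) × length bs ℕ.* p ℕ.≤ length zs
  pencil-points E∈ [] _ _ = [] , [] , (λ ()) , z≤n
  pencil-points {E} E∈ (b ∷ bs) (b≉ ∷ bss) (Eb ∷ Ebs) =
    let zs , u , props , len = pencil-points E∈ bs bss Ebs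
        new : ∀ {z} → z ∈ own → z ∈ C × z on b × z ≢ E
        new z∈ = let z∈b , z∉ = ∈-∖⁻ _≟ᵛ_ (pts b) (E ∷ []) z∈
                 in proj₁ (pts⁻ b z∈b) , proj₂ (pts⁻ b z∈b) , λ e → z∉ (here e)
    in own ++ zs
     , Uniqueₚ.++⁺ (∖-unique _≟ᵛ_ (pts-unique b) _) u (λ (z∈ , z∈′) →
         let zC , zb , z≢E = new z∈ ; _ , _ , b′ , b′∈ , zb′ = props z∈′
         in All.lookup b≉ b′∈ (same b b′ zC E∈ z≢E zb Eb zb′ (All.lookup Ebs b′∈)))
     , (λ z∈ → split (∈-++⁻ own z∈) new props)
     , ℕₚ.≤-trans (ℕₚ.+-mono-≤ own-length len) (ℕₚ.≤-reflexive (sym (Listₚ.length-++ own)))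
    where
    own = _∖_ _≟ᵛ_ (pts b) (E ∷ [])
    own-length : p ℕ.≤ length own
    own-length = ℕ.s≤s⁻¹ (subst (ℕ._≤ suc (length own)) (trans (pts-length b) (sym sp≡q))
      (length-∖ _≟ᵛ_ (pts-unique b) (E ∷ [])))
    split : ∀ {z zs} → z ∈ own ⊎ z ∈ zs → (∀ {z} → z ∈ own → z ∈ C × z on b × z ≢ E) →
      (∀ {z} → z ∈ zs → z ∈ C × z ≢ E × ∃ λ b → b ∈ bs × z on b) → z ∈ C × z ≢ E × ∃ λ b′ → b′ ∈ b ∷ bs × z on b′
    split (inj₁ z∈) new _ = let c , o , n = new z∈ in c , n , b , here refl , o
    split (inj₂ z∈) _ props = let c , n , b , b∈ , o = props z∈ in c , n , b , there b∈ , o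

  pencil : ∀ {E} → E ∈ C → (bs : List Block) → AllPairs (λ b b′ → ¬ b ≈ b′) bs → All (E on_) bs →
    length bs ℕ.* p ℕ.< q ℕ.* q
  pencil {E} E∈ bs bss Ebs =
    let zs , u , props , len = pencil-points E∈ bs bss Ebs
    in ℕₚ.≤-trans (s≤s len) (subst (suc (length zs) ℕ.≤_) C-size
         (length≤ (All.tabulate (λ z∈ e → proj₁ (proj₂ (props z∈)) (sym e)) ∷ u)
           λ { (here refl) → E∈ ; (there z∈) → proj₁ (props z∈) }))

  -- Were the joins to two points of `γ` equal, that block would share two points with `γ` and
  -- coincide with it, putting `E` on `γ`.
  joins : ∀ {E} γ → E ∈ C → ¬ E on γ → (gs : List (V 5)) → Unique gs → All (λ g → g ∈ C × g on γ) gs →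
    ∃ λ bs → AllPairs (λ b b′ → ¬ b ≈ b′) bs × All (E on_) bs × All (λ b → ∃ λ g → g ∈ gs × g on b) bs × length bs ≡ length gs
  joins γ E∈ E∉ [] _ _ = [] , [] , [] , [] , refl
  joins {E} γ E∈ E∉ (g ∷ gs) (g∉ ∷ u) ((g∈ , gγ) ∷ gsγ) =
    let bs , bss , Ebs , gbs , len = joins γ E∈ E∉ gs u gsγ
        b , Eb , gb = join E∈ g∈ (λ { refl → E∉ gγ })
    in b ∷ bs
     , All.map (λ {b′} (g′ , g′∈ , g′b′) b≈b′ → E∉ (≈-on b γ
         (same b γ g∈ (proj₁ (All.lookup gsγ g′∈)) (All.lookup g∉ g′∈) gb (≈-on b′ b (≈-sym b b′ b≈b′) g′b′)
            gγ (proj₂ (All.lookup gsγ g′∈))) Eb)) gbs ∷ bss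
     , Eb ∷ Ebs , (g , here refl , gb) ∷ All.map (λ (g′ , g′∈ , o) → g′ , there g′∈ , o) gbs , cong suc len

  -- Otherwise τ₁, τ₂ and the q joins of E with γ would be q + 2 blocks through E, covering more than q² points.
  opaque
    playfair : ∀ {E} τ₁ τ₂ γ → E ∈ C → E on τ₁ → E on τ₂ → ¬ Meet τ₁ γ → ¬ Meet τ₂ γ → τ₁ ≈ τ₂
    playfair {E} τ₁ τ₂ γ E∈ Eτ₁ Eτ₂ m₁ m₂ with same? τ₁ τ₂
    ... | yes e = e
    ... | no τ₁≉τ₂ =
      let bs , bss , Ebs , gbs , len = joins γ E∈ (λ Eγ → m₁ (E , E∈ , Eτ₁ , Eγ)) (pts γ) (pts-unique γ) (All.tabulate (pts⁻ γ))
          away : ∀ τ → ¬ Meet τ γ → All (λ b → ¬ τ ≈ b) bs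
          away τ m = All.map (λ {b} (g , g∈ , gb) e →
            m (g , proj₁ (pts⁻ γ g∈) , ≈-on b τ (≈-sym τ b e) gb , proj₂ (pts⁻ γ g∈))) gbs
      in ⊥-elim (ℕₚ.<⇒≱ (subst (λ k → suc (suc k) ℕ.* p ℕ.< q ℕ.* q) (trans len (pts-length γ))
           (pencil E∈ (τ₁ ∷ τ₂ ∷ bs) ((τ₁≉τ₂ ∷ away τ₁ m₁) ∷ away τ₂ m₂ ∷ bss) (Eτ₁ ∷ Eτ₂ ∷ Ebs))) bound)
      where
      -- The `q + 2` blocks would yield `(q + 2) (q - 1) = q² + q - 2` points besides `E`.
      bound : q ℕ.* q ℕ.≤ suc (suc q) ℕ.* p
      bound = subst (λ k → k ℕ.* k ℕ.≤ suc (suc k) ℕ.* p) sp≡q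
        (ℕₚ.≤-trans (ℕₚ.≤-reflexive (ℕₚ.*-suc (suc p) p)) (ℕₚ.≤-trans
          (ℕₚ.+-monoˡ-≤ _ (ℕₚ.≤-trans (ℕₚ.≤-reflexive (ℕₚ.+-comm 1 p)) (ℕₚ.+-monoʳ-≤ p (ℕₚ.≤-trans (s≤s z≤n) 6≤p))))
          (ℕₚ.≤-reflexive (ℕₚ.+-assoc p p _))))
        where
        6≤p : 6 ℕ.≤ p
        6≤p = ℕ.s≤s⁻¹ (subst (7 ℕ.≤_) (sym sp≡q) 7≤q)

  opaque
    -- Playfair's axiom in contraposed form, from which points of intersection are obtained.
    meets-one : ∀ {E} τ₁ τ₂ γ → E ∈ C → E on τ₁ → E on τ₂ → ¬ τ₁ ≈ τ₂ → ¬ Meet τ₂ γ → Meet τ₁ γ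
    meets-one τ₁ τ₂ γ E∈ E₁ E₂ ne m₂ with meet? τ₁ γ
    ... | yes m = m
    ... | no m₁ = ⊥-elim (ne (playfair τ₁ τ₂ γ E∈ E₁ E₂ m₁ m₂))

  opaque
    at-most-two : ∀ {X} α β γ → Affine X → X ∉ C → X on α → X on β → X on γ → α ≈ β ⊎ α ≈ γ ⊎ β ≈ γ
    at-most-two {X} α β γ aff X∉ Xα Xβ Xγ with A3 X aff
    ... | inj₁ X∈ = ⊥-elim (X∉ X∈)
    ... | inj₂ (inj₁ none) = ⊥-elim (none (plane α) (isC α) Xα)
    ... | inj₂ (inj₂ (π₁ , π₂ , c₁ , c₂ , _ , _ , _ , two))
      with two (plane α) (isC α) Xα | two (plane β) (isC β) Xβ | two (plane γ) (isC γ) Xγ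
    ... | inj₁ a | inj₁ b | _ = inj₁ (≈-trans α (block π₁ c₁) β a (≈-sym β (block π₁ c₁) b))
    ... | inj₂ a | inj₂ b | _ = inj₁ (≈-trans α (block π₂ c₂) β a (≈-sym β (block π₂ c₂) b))
    ... | inj₁ a | inj₂ b | inj₁ c = inj₂ (inj₁ (≈-trans α (block π₁ c₁) γ a (≈-sym γ (block π₁ c₁) c)))
    ... | inj₁ a | inj₂ b | inj₂ c = inj₂ (inj₂ (≈-trans β (block π₂ c₂) γ b (≈-sym γ (block π₂ c₂) c)))
    ... | inj₂ a | inj₁ b | inj₁ c = inj₂ (inj₂ (≈-trans β (block π₁ c₁) γ b (≈-sym γ (block π₁ c₁) c)))
    ... | inj₂ a | inj₁ b | inj₂ c = inj₂ (inj₁ (≈-trans α (block π₂ c₂) γ a (≈-sym γ (block π₂ c₂) c)))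

  opaque
    second-block : ∀ {X} π → Affine X → X ∉ C → X on π → ∃ λ ρ → ¬ π ≈ ρ × X on ρ
    second-block {X} π aff X∉ Xπ with A3 X aff
    ... | inj₁ X∈ = ⊥-elim (X∉ X∈)
    ... | inj₂ (inj₁ none) = ⊥-elim (none (plane π) (isC π) Xπ)
    ... | inj₂ (inj₂ (π₁ , π₂ , c₁ , c₂ , X₁ , X₂ , π₁≉π₂ , _)) with same? π (block π₁ c₁)
    ... | no ne = block π₁ c₁ , ne , X₁
    ... | yes e = block π₂ c₂ , (λ e′ → π₁≉π₂ (≈-trans (block π₁ c₁) π (block π₂ c₂) (≈-sym π (block π₁ c₁) e) e′)) , X₂

  opaque
    off-blocks : (ρ σ : Block) → ∃ λ v → v ∈ C × ¬ v on ρ × ¬ v on σ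
    off-blocks ρ σ =
      let v , v∈ , v∉ = outside _≟ᵛ_ C-unique (pts ρ ++ pts σ) (subst (ℕ._< length C) (sym (Listₚ.length-++ (pts ρ)))
            (subst (length (pts ρ) ℕ.+ length (pts σ) ℕ.<_) (sym C-size) bound))
      in v , v∈ , (λ o → v∉ (∈-++⁺ˡ (pts⁺ ρ v∈ o))) , (λ o → v∉ (∈-++⁺ʳ (pts ρ) (pts⁺ σ v∈ o)))
      where
      bound : length (pts ρ) ℕ.+ length (pts σ) ℕ.< q ℕ.* q
      bound = subst (ℕ._< q ℕ.* q) (sym (cong₂ ℕ._+_ (pts-length ρ) (pts-length σ)))
        (ℕₚ.<-≤-trans (subst (ℕ._< 3 ℕ.* q) (cong (q ℕ.+_) (ℕₚ.+-identityʳ q))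
            (ℕₚ.*-monoˡ-< q {{ℕ.>-nonZero (ℕₚ.≤-trans (s≤s z≤n) 7≤q)}} {2} {3} ℕₚ.≤-refl))
          (ℕₚ.*-monoˡ-≤ q (ℕₚ.≤-trans (s≤s (s≤s (s≤s z≤n))) 7≤q)))

  opaque
    other-block : ∀ {A} π → A ∈ C → A on π → ∃ λ σ → ¬ π ≈ σ × A on σ
    other-block {A} π A∈ Aπ =
      let B , B∈ , B∉ , _ = off-blocks π π
          σ , Aσ , Bσ = join A∈ B∈ (λ { refl → B∉ Aπ })
      in σ , (λ e → B∉ (≈-on σ π (≈-sym π σ e) Bσ)) , Aσ

  -- The blocks through points of Ps that miss π on 𝒞 meet a second block σ through A ∈ π in q - 1 points at most.
  opaque
    cover : ∀ π (Ps : List (V 5)) → Unique Ps → q ℕ.≤ length Ps → (∀ {P} → P ∈ Ps → Affine P × P on π × P ∉ C) →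
      ∃₂ λ P P′ → ∃ λ ρ → P ∈ Ps × ¬ π ≈ ρ × P on ρ × P ≢ P′ × Affine P′ × P′ on π × P′ on ρ
    cover π Ps u le props with pick π [] z≤n
    ... | A , A∈ , Aπ , _ with other-block π A∈ Aπ
    ... | σ , π≉σ , Aσ with any-or-all Ps dich
      where
      Shared Missing : V 5 → Set
      Shared P = ∃ λ ρ → ¬ π ≈ ρ × P on ρ × Meet ρ π
      Missing P = ∃ λ D → (D ∈ (_∖_ _≟ᵛ_ (pts σ) (A ∷ []))) × ∃ λ ρ → ¬ π ≈ ρ × P on ρ × ¬ Meet ρ π × D ∈ C × D on ρ
      dich : ∀ P → P ∈ Ps → Shared P ⊎ Missing P
      dich P P∈ with second-block π (proj₁ (props P∈)) (proj₂ (proj₂ (props P∈))) (proj₁ (proj₂ (props P∈)))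
      ... | ρ , π≉ρ , Pρ with meet? ρ π
      ... | yes m = inj₁ (ρ , π≉ρ , Pρ , m)
      ... | no nm = let D , D∈ , Dσ , Dρ = meets-one σ π ρ A∈ Aσ Aπ (λ e → π≉σ (≈-sym σ π e)) (λ m → nm (meet-sym {π} {ρ} m))
                    in inj₂ (D , ∈-∖⁺ _≟ᵛ_ (pts⁺ σ D∈ Dσ) (λ { (here D≡A) → nm (A , A∈ , subst (_on ρ) D≡A Dρ , Aπ) })
                            , ρ , π≉ρ , Pρ , nm , D∈ , Dρ)
    -- A block sharing a point `X` of 𝒞 with `π` shares the whole line through `P` and `X`; the two
    -- differ because `P` is off 𝒞.
    ... | inj₁ (P , P∈ , ρ , π≉ρ , Pρ , X , X∈ , Xρ , Xπ) =
          P , X , ρ , P∈ , π≉ρ , Pρ , (λ { refl → proj₂ (proj₂ (props P∈)) X∈ }) , affine X∈ , Xπ , Xρ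
    ... | inj₂ all =
      -- Two of the points have their blocks pass through the same `D`; both blocks are parallel to
      -- `π`, so Playfair makes them one block through both points.
      let P , P′ , D , P∈ , P′∈ , P≢P′ , (ρ , π≉ρ , Pρ , nm , D∈ , Dρ) , (ρ′ , _ , P′ρ′ , nm′ , _ , Dρ′) =
            collide u (ℕₚ.<-≤-trans (subst (length (_∖_ _≟ᵛ_ (pts σ) (A ∷ [])) ℕ.<_) (pts-length σ)
                (∖-member< _≟ᵛ_ (pts σ) (pts⁺ σ A∈ Aσ))) le) _ all
      in P , P′ , ρ , P∈ , π≉ρ , Pρ , P≢P′ , proj₁ (props P′∈) , proj₁ (proj₂ (props P′∈))
       , ≈-on ρ′ ρ (playfair ρ′ ρ π D∈ Dρ′ Dρ nm′ nm) P′ρ′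

-- The point at infinity in which the lines shared with other blocks concur.

module Centers {q : ℕ} (F : FField q) (7≤q : 7 ℕ.≤ q)
  (h : Vec (Fin q) 5) (C : List (Vec (Fin q) 5)) (CPlane : Geo.Plane F → Set)
  (hyp : Geo.Config.Hypotheses F h C CPlane) where
  open Counting
  open Blocks F 7≤q h C CPlane hyp public
  open DecMembership (_≟ᵛ_ {5}) public using () renaming (_∈?_ to _∈ᶜ?_)

  _∥_ : V 5 → V 5 → Set
  e ∥ d = InSpan (d ∷ []) e
  infix 4 _∥_

  multiple : ∀ {d e} → e ∥ d → ∃ λ c → e ≡ c · d
  multiple {d} (c ∷ [] , eq) = c , trans eq (vec-identity (c ⊡ #0 ⊞ ∅) (c ⊡ #0) (λ { (x ∷ []) → +-identityʳ _ }) (d ∷ []))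

  ∥-multiple : ∀ c d → c · d ∥ d
  ∥-multiple c d = span-· c (span-here [] d)

  ∥-on : ∀ ρ {d e} → e ∥ d → d on ρ → e on ρ
  ∥-on ρ p dρ = span-trans (dρ ∷ []) p

  ∥-sym : ∀ {d e} → e ≢ 𝟘 → e ∥ d → d ∥ e
  ∥-sym {d} e≢0 p with multiple p
  ... | c , refl = span-·-cancel {c = c}
    (λ { refl → e≢0 (vec-identity (0# ⊡ #0) ∅ (λ { (x ∷ []) → zeroˡ x }) (d ∷ [])) })
    (span-here [] (c · d))

  ⊝-affine′ : ∀ {A B} → Affine A → Affine B → Direction (B ⊝ A)
  ⊝-affine′ {A} {B} a b = trans (linear-vec (dot-linear h) (#0 ⊞ (- 1#) ⊡ #1) (B ∷ A ∷ []))
    (trans (cong₂ (λ x y → x + (- 1#) * y) b a) (solve 0 (:1 :+ (:- :1) :* :1 := :0) refl))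

  abstract
    ⊝-affine : ∀ {A B} → Affine A → Affine B → Direction (B ⊝ A)
    ⊝-affine = ⊝-affine′

  shift-affine′ : ∀ {A d} t → Affine A → Direction d → Affine (A ⊕ t · d)
  shift-affine′ {A} {d} t a e = trans (linear-vec (dot-linear h) (#0 ⊞ t ⊡ #1) (A ∷ d ∷ []))
    (trans (cong₂ (λ x y → x + t * y) a e) (solve 1 (λ t → :1 :+ t :* :0 := :1) refl t))

  abstract
    shift-affine : ∀ {A d} t → Affine A → Direction d → Affine (A ⊕ t · d)
    shift-affine = shift-affine′

  ⊝≢𝟘 : ∀ {A B : V 5} → A ≢ B → B ⊝ A ≢ 𝟘
  ⊝≢𝟘 ne e = ne (sym (⊝≡𝟘⇒≡ e))

  ⊝-back′ : ∀ (A B : V 5) → A ⊕ (B ⊝ A) ≡ B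
  ⊝-back′ A B = vec-identity (#0 ⊞ (#1 ⊞ (- 1#) ⊡ #0)) #1
    (λ { (x ∷ y ∷ []) → solve 2 (λ x y → x :+ (y :+ (:- :1) :* x) := y) refl x y }) (A ∷ B ∷ [])

  abstract
    ⊝-back : ∀ (A B : V 5) → A ⊕ (B ⊝ A) ≡ B
    ⊝-back = ⊝-back′

  on-shift : ∀ ρ {A d} t → A on ρ → d on ρ → A ⊕ t · d on ρ
  on-shift ρ t Aρ dρ = span-⊕ Aρ (span-· t dρ)

  on-difference : ∀ ρ {A B} → A on ρ → B on ρ → B ⊝ A on ρ
  on-difference ρ Aρ Bρ = span-⊝ Bρ Aρ

  opaque
    on-endpoint : ∀ ρ {A B t} → t ≢ 0# → A on ρ → A ⊕ t · (B ⊝ A) on ρ → B on ρ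
    on-endpoint ρ {A} {B} t≢0 Aρ Pρ = subst (_on ρ) (⊝-back A B) (span-⊕ Aρ (span-·-cancel t≢0 (span-cancel Pρ Aρ)))

  on-unshift′ : ∀ ρ {A d} t → A ⊕ t · d on ρ → d on ρ → A on ρ
  on-unshift′ ρ {A} {d} t Pρ dρ = subst (_on ρ) (vec-identity (#0 ⊞ t ⊡ #1 ⊞ (- 1#) ⊡ t ⊡ #1) #0
    (λ { (x ∷ y ∷ []) → solve 3 (λ x y t → x :+ t :* y :+ (:- :1) :* (t :* y) := x) refl x y t }) (A ∷ d ∷ []))
    (span-⊝ Pρ (span-· t dρ))

  abstract
    on-unshift : ∀ ρ {A d} t → A ⊕ t · d on ρ → d on ρ → A on ρ
    on-unshift = on-unshift′

  shift-unshift′ : ∀ (A d : V 5) t → (A ⊕ t · d) ⊝ A ≡ t · d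
  shift-unshift′ A d t = vec-identity (#0 ⊞ t ⊡ #1 ⊞ (- 1#) ⊡ #0) (t ⊡ #1)
    (λ { (x ∷ y ∷ []) → solve 3 (λ x y t → x :+ t :* y :+ (:- :1) :* x := t :* y) refl x y t }) (A ∷ d ∷ [])

  abstract
    shift-unshift : ∀ (A d : V 5) t → (A ⊕ t · d) ⊝ A ≡ t · d
    shift-unshift = shift-unshift′

  frame-independent : ∀ {P d e} → Affine P → Direction d → Direction e → d ≢ 𝟘 → ¬ e ∥ d → Independent (P ∷ e ∷ d ∷ [])
  frame-independent {P} {d} {e} aff hd he d≢0 e∦d =
    independent-∷ (independent-∷ (independent-∷ (λ { [] _ → refl }) λ { ([] , refl) → d≢0 refl }) e∦d)
      λ P∈ → 1≢0 (trans (sym aff) (kills-span h (he ∷ hd ∷ []) P∈))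

  opaque
    same-frame : ∀ ρ σ {P d e} → Affine P → Direction d → Direction e → d ≢ 𝟘 → ¬ e ∥ d →
      P on ρ → d on ρ → e on ρ → P on σ → d on σ → e on σ → ρ ≈ σ
    same-frame ρ σ aff hd he d≢0 e∦d Pρ dρ eρ Pσ dσ eσ =
      same-of-independent ρ σ (frame-independent aff hd he d≢0 e∦d) (Pρ ∷ eρ ∷ dρ ∷ []) (Pσ ∷ eσ ∷ dσ ∷ [])

  in-frame′ : ∀ ρ {P d e Q} → Affine P → Direction d → Direction e → d ≢ 𝟘 → ¬ e ∥ d →
    P on ρ → d on ρ → e on ρ → Affine Q → Q on ρ → ∃₂ λ b c → Q ≡ P ⊕ (b · e ⊕ c · d)
  in-frame′ ρ {P} {d} {e} {Q} aff hd he d≢0 e∦d Pρ dρ eρ Qaff Qρ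
    with independent-spans (frame-independent aff hd he d≢0 e∦d) (Pρ ∷ eρ ∷ dρ ∷ []) Qρ
  ... | a ∷ b ∷ c ∷ [] , eq = b , c , trans eq (trans
    (vec-identity (a ⊡ #0 ⊞ (b ⊡ #1 ⊞ (c ⊡ #2 ⊞ ∅))) (a ⊡ #0 ⊞ (b ⊡ #1 ⊞ c ⊡ #2))
      (λ { (x ∷ y ∷ z ∷ []) → solve 6 (λ a b c x y z → a :* x :+ (b :* y :+ (c :* z :+ :0)) := a :* x :+ (b :* y :+ c :* z))
                                refl a b c x y z }) (P ∷ e ∷ d ∷ []))
    (cong (_⊕ (b · e ⊕ c · d)) (trans (cong (_· P) a≡1)
      (vec-identity (1# ⊡ #0) #0 (λ { (x ∷ []) → *-identityˡ x }) (P ∷ [])))))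
    where
    a≡1 : a ≡ 1#
    a≡1 = trans (solve 3 (λ a b c → a := a :* :1 :+ (b :* :0 :+ (c :* :0 :+ :0))) refl a b c)
      (trans (cong (λ ys → dot (a ∷ b ∷ c ∷ []) ys) (sym (cong₂ _∷_ aff (cong₂ _∷_ he (cong (_∷ []) hd)))))
      (trans (sym (dot-comb h (P ∷ e ∷ d ∷ []) (a ∷ b ∷ c ∷ []))) (trans (cong (dot h) (sym eq)) Qaff)))

  abstract
    in-frame : ∀ ρ {P d e Q} → Affine P → Direction d → Direction e → d ≢ 𝟘 → ¬ e ∥ d →
      P on ρ → d on ρ → e on ρ → Affine Q → Q on ρ → ∃₂ λ b c → Q ≡ P ⊕ (b · e ⊕ c · d)
    in-frame = in-frame′

  -- Since no three points of an arc are collinear, at most one of the others is seen from `a` in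
  -- direction `d`.
  arc-directions′ : ∀ ρ {a b c d} → a ∈ C → b ∈ C → c ∈ C → a on ρ → b on ρ → c on ρ →
    a ≢ b → a ≢ c → b ≢ c → b ⊝ a ∥ d → ¬ c ⊝ a ∥ d
  arc-directions′ ρ {a} {b} {c} {d} a∈ b∈ c∈ aρ bρ cρ a≢b a≢c b≢c p p′ with multiple p | multiple p′
  ... | s , eb | s′ , ec = ⊝≢𝟘 a≢c (trans ec (trans (cong (_· d) s′≡0)
      (vec-identity (0# ⊡ #0) ∅ (λ { (x ∷ []) → zeroˡ x }) (d ∷ []))))
    where
    -- Eliminating `d` from `b - a = s d` and `c - a = s′ d` leaves a linear relation among the
    -- three points.
    relation : comb (a ∷ b ∷ c ∷ []) ((s - s′) ∷ s′ ∷ (- s) ∷ []) ≡ 𝟘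
    relation = trans
      (vec-identity ((s - s′) ⊡ #0 ⊞ (s′ ⊡ #1 ⊞ ((- s) ⊡ #2 ⊞ ∅)))
        (s′ ⊡ (#1 ⊞ (- 1#) ⊡ #0) ⊞ (- s) ⊡ (#2 ⊞ (- 1#) ⊡ #0))
        (λ { (x ∷ y ∷ z ∷ []) → solve 5 (λ s s′ x y z →
            (s :- s′) :* x :+ (s′ :* y :+ ((:- s) :* z :+ :0))
            := s′ :* (y :+ (:- :1) :* x) :+ (:- s) :* (z :+ (:- :1) :* x)) refl s s′ x y z }) (a ∷ b ∷ c ∷ []))
      (trans (cong₂ (λ v w → s′ · v ⊕ (- s) · w) eb ec)
        (vec-identity (s′ ⊡ s ⊡ #0 ⊞ (- s) ⊡ s′ ⊡ #0) ∅
          (λ { (x ∷ []) → solve 3 (λ s s′ x → s′ :* (s :* x) :+ (:- s) :* (s′ :* x) := :0) refl s s′ x }) (d ∷ [])))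
    s′≡0 : s′ ≡ 0#
    s′≡0 = cong (λ v → Vec.head (Vec.tail v)) (arc ρ a∈ b∈ c∈ aρ bρ cρ a≢b a≢c b≢c ((s - s′) ∷ s′ ∷ (- s) ∷ []) relation)

  abstract
    arc-directions : ∀ ρ {a b c d} → a ∈ C → b ∈ C → c ∈ C → a on ρ → b on ρ → c on ρ →
      a ≢ b → a ≢ c → b ≢ c → b ⊝ a ∥ d → ¬ c ⊝ a ∥ d
    arc-directions = arc-directions′

  opaque
    off-direction : ∀ π d {A} → A ∈ C → A on π → ∃ λ B → B ∈ C × B on π × ¬ B ⊝ A ∥ d
    off-direction π d {A} A∈ Aπ with pick π (A ∷ []) (s≤s z≤n)
    ... | B , B∈ , Bπ , B∉ with pick π (A ∷ B ∷ []) (s≤s (s≤s z≤n))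
    ... | B′ , B′∈ , B′π , B′∉ with span? (d ∷ []) (B ⊝ A)
    ... | no B∦ = B , B∈ , Bπ , B∦
    ... | yes B∥ = B′ , B′∈ , B′π , arc-directions π A∈ B∈ B′∈ Aπ Bπ B′π (λ e → B∉ (here (sym e)))
                     (λ e → B′∉ (here (sym e))) (λ e → B′∉ (there (here (sym e)))) B∥

  -- The affine line P + ⟨d⟩ is common to π and ρ.
  record Shared (π : Block) (P d : V 5) (ρ : Block) : Set where
    field
      distinct : ¬ π ≈ ρ
      P-affine : Affine P
      Pπ : P on π
      Pρ : P on ρ
      d-direction : Direction d
      d≢𝟘 : d ≢ 𝟘
      dπ : d on π
      dρ : d on ρ
  open Shared

  shared-points : ∀ π ρ {P P′} → ¬ π ≈ ρ → Affine P → Affine P′ → P ≢ P′ → P on π → P′ on π → P on ρ → P′ on ρ →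
    Shared π P (P′ ⊝ P) ρ
  shared-points π ρ ne a a′ P≢P′ Pπ P′π Pρ P′ρ = record
    { distinct = ne ; P-affine = a ; Pπ = Pπ ; Pρ = Pρ ; d-direction = ⊝-affine a a′ ; d≢𝟘 = ⊝≢𝟘 P≢P′
    ; dπ = on-difference π Pπ P′π ; dρ = on-difference ρ Pρ P′ρ }

  -- Two lines of `π` with different directions meet in an affine point `X` on all three blocks. Off
  -- 𝒞 that would force two of the blocks to coincide by (A3); `ρ₁ ≈ ρ₂` is excluded because this
  -- block would contain `P₁` and both directions, hence be `π`.
  crossing′ : ∀ {π P₁ d₁ ρ₁ P₂ d₂ ρ₂} → Shared π P₁ d₁ ρ₁ → Shared π P₂ d₂ ρ₂ → ¬ d₂ ∥ d₁ →
    ∃ λ X → X ∈ C × X on π × X on ρ₁ × X on ρ₂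
  crossing′ {π} {P₁} {d₁} {ρ₁} {P₂} {d₂} {ρ₂} ℓ₁ ℓ₂ d₂∦d₁ = decide (X ∈ᶜ? C)
    where
    coordinates : ∃₂ λ b c → P₂ ≡ P₁ ⊕ (b · d₂ ⊕ c · d₁)
    coordinates = in-frame π (P-affine ℓ₁) (d-direction ℓ₁) (d-direction ℓ₂) (d≢𝟘 ℓ₁) d₂∦d₁
      (Pπ ℓ₁) (dπ ℓ₁) (dπ ℓ₂) (P-affine ℓ₂) (Pπ ℓ₂)
    b = proj₁ coordinates
    c = proj₁ (proj₂ coordinates)
    X : V 5
    X = P₁ ⊕ c · d₁
    Xπ : X on π
    Xπ = on-shift π c (Pπ ℓ₁) (dπ ℓ₁)
    Xρ₁ : X on ρ₁
    Xρ₁ = on-shift ρ₁ c (Pρ ℓ₁) (dρ ℓ₁)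
    Xρ₂ : X on ρ₂
    Xρ₂ = on-unshift ρ₂ b (subst (_on ρ₂) (trans (proj₂ (proj₂ coordinates))
      (vec-identity (#0 ⊞ (b ⊡ #1 ⊞ c ⊡ #2)) (#0 ⊞ c ⊡ #2 ⊞ b ⊡ #1)
        (λ { (x ∷ y ∷ z ∷ []) → solve 5 (λ b c x y z → x :+ (b :* y :+ c :* z) := x :+ c :* z :+ b :* y) refl b c x y z })
        (P₁ ∷ d₂ ∷ d₁ ∷ []))) (Pρ ℓ₂)) (dρ ℓ₂)
    absurd : π ≈ ρ₁ ⊎ π ≈ ρ₂ ⊎ ρ₁ ≈ ρ₂ → ⊥
    absurd (inj₁ e) = distinct ℓ₁ e
    absurd (inj₂ (inj₁ e)) = distinct ℓ₂ e
    absurd (inj₂ (inj₂ e)) = distinct ℓ₁ (same-frame π ρ₁ (P-affine ℓ₁) (d-direction ℓ₁) (d-direction ℓ₂) (d≢𝟘 ℓ₁) d₂∦d₁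
      (Pπ ℓ₁) (dπ ℓ₁) (dπ ℓ₂) (Pρ ℓ₁) (dρ ℓ₁) (≈-on ρ₂ ρ₁ (≈-sym ρ₁ ρ₂ e) (dρ ℓ₂)))
    decide : Dec (X ∈ C) → ∃ λ X → X ∈ C × X on π × X on ρ₁ × X on ρ₂
    decide (yes X∈) = X , X∈ , Xπ , Xρ₁ , Xρ₂
    decide (no X∉) = ⊥-elim (absurd (at-most-two π ρ₁ ρ₂ (shift-affine c (P-affine ℓ₁) (d-direction ℓ₁)) X∉ Xπ Xρ₁ Xρ₂))

  abstract
    crossing : ∀ {π P₁ d₁ ρ₁ P₂ d₂ ρ₂} → Shared π P₁ d₁ ρ₁ → Shared π P₂ d₂ ρ₂ → ¬ d₂ ∥ d₁ →
      ∃ λ X → X ∈ C × X on π × X on ρ₁ × X on ρ₂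
    crossing = crossing′

  -- At most `q` of the points belong to the arc, so `q` of them are off 𝒞 and `cover` applies.
  cover-lines : ∀ π (Ps : List (V 5)) → Unique Ps → q ℕ.+ q ℕ.≤ length Ps → (∀ {P} → P ∈ Ps → Affine P × P on π) →
    ∃₂ λ P d → ∃ λ ρ → P ∈ Ps × Shared π P d ρ
  cover-lines π Ps u le props =
    let P , P′ , ρ , P∈ , ne , Pρ , P≢P′ , aff′ , P′π , P′ρ =
          cover π (_∖_ _≟ᵛ_ Ps (pts π)) (∖-unique _≟ᵛ_ u (pts π)) long (λ P∈ → keep (∈-∖⁻ _≟ᵛ_ Ps (pts π) P∈))
        P∈Ps = proj₁ (∈-∖⁻ _≟ᵛ_ Ps (pts π) P∈)
    in P , P′ ⊝ P , ρ , P∈Ps , shared-points π ρ ne (proj₁ (props P∈Ps)) aff′ P≢P′ (proj₂ (props P∈Ps)) P′π Pρ P′ρ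
    where
    keep : ∀ {P} → P ∈ Ps × P ∉ pts π → Affine P × P on π × P ∉ C
    keep (P∈ , P∉) = proj₁ (props P∈) , proj₂ (props P∈) , λ P∈C → P∉ (pts⁺ π P∈C (proj₂ (props P∈)))
    long : q ℕ.≤ length (_∖_ _≟ᵛ_ Ps (pts π))
    long = ℕₚ.+-cancelˡ-≤ q _ _ (ℕₚ.≤-trans le (subst (λ k → length Ps ℕ.≤ k ℕ.+ length (_∖_ _≟ᵛ_ Ps (pts π)))
      (pts-length π) (length-∖ _≟ᵛ_ u (pts π))))

  -- The lines through `A` and `B` in direction `d` are parallel and distinct, so together they have
  -- the `2q` points that `cover-lines` asks for.
  cover-parallel′ : ∀ π {A B d} → A ∈ C → B ∈ C → A on π → B on π → Direction d → d ≢ 𝟘 → d on π → ¬ B ⊝ A ∥ d →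
    ∃₂ λ P e → ∃ λ ρ → Shared π P e ρ × ∃₂ λ X t → (X ≡ A ⊎ X ≡ B) × P ≡ X ⊕ t · d
  cover-parallel′ π {A} {B} {d} A∈ B∈ Aπ Bπ hd d≢0 dπ B∦ =
    let P , e , ρ , P∈ , sh = cover-lines π line line-unique long line-on
        X , t , X∈ , _ , eq = ∈-grid⁻ f (A ∷ B ∷ []) (allFin q) P∈
    in P , e , ρ , sh , X , t , ends X∈ , eq
    where
    f : V 5 → Fin q → V 5
    f X t = X ⊕ t · d
    line = grid f (A ∷ B ∷ []) (allFin q)
    ends : ∀ {X} → X ∈ A ∷ B ∷ [] → X ≡ A ⊎ X ≡ B
    ends (here e) = inj₁ e
    ends (there (here e)) = inj₂ e
    on-end : ∀ {X} → X ∈ A ∷ B ∷ [] → X on π × Affine X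
    on-end (here refl) = Aπ , affine A∈
    on-end (there (here refl)) = Bπ , affine B∈
    line-on : ∀ {P} → P ∈ line → Affine P × P on π
    line-on P∈ with ∈-grid⁻ f (A ∷ B ∷ []) (allFin q) P∈
    ... | X , t , X∈ , _ , refl = shift-affine t (proj₂ (on-end X∈)) hd , on-shift π t (proj₁ (on-end X∈)) dπ
    long : q ℕ.+ q ℕ.≤ length line
    long = ℕₚ.≤-reflexive (sym (trans (grid-length f (A ∷ B ∷ []) (allFin q))
      (trans (cong (2 ℕ.*_) (allFin-length q)) (cong (q ℕ.+_) (ℕₚ.+-identityʳ q)))))
    transfer : ∀ X Y t s → f X t ≡ f Y s → Y ⊝ X ≡ (t - s) · d
    transfer X Y t s e = trans
      (vec-identity (#0 ⊞ (- 1#) ⊡ #1) (#0 ⊞ s ⊡ #2 ⊞ (- s) ⊡ #2 ⊞ (- 1#) ⊡ #1)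
        (λ { (y ∷ x ∷ d ∷ []) → solve 4 (λ y x d s → y :+ (:- :1) :* x := y :+ s :* d :+ (:- s) :* d :+ (:- :1) :* x) refl y x d s })
        (Y ∷ X ∷ d ∷ []))
      (trans (cong (λ v → v ⊕ (- s) · d ⊝ X) (sym e))
        (vec-identity (#1 ⊞ t ⊡ #2 ⊞ (- s) ⊡ #2 ⊞ (- 1#) ⊡ #1) ((t - s) ⊡ #2)
          (λ { (y ∷ x ∷ d ∷ []) → solve 4 (λ x d t s → x :+ t :* d :+ (:- s) :* d :+ (:- :1) :* x := (t :- s) :* d) refl x d t s })
          (Y ∷ X ∷ d ∷ [])))
    level : ∀ X t s → f X t ≡ f X s → t ≡ s
    level X t s e with (t - s) ≟ᶠ 0#
    ... | yes z = diff⇒≡ z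
    ... | no nz = ⊥-elim (d≢0 (·-cancel nz (trans (sym (transfer X X t s e)) (v⊝v X))))
    A≢B : A ≢ B
    A≢B refl = B∦ (subst (_∥ d) (sym (v⊝v A)) span-𝟘)
    line-unique : Unique line
    line-unique = grid-unique f ((A≢B ∷ []) ∷ [] ∷ []) (allFin-unique q) λ X∈ Y∈ _ _ → inj X∈ Y∈
      where
      inj : ∀ {X Y t s} → X ∈ A ∷ B ∷ [] → Y ∈ A ∷ B ∷ [] → f X t ≡ f Y s → X ≡ Y × t ≡ s
      inj {t = t} {s} (here refl) (here refl) e = refl , level A t s e
      inj {t = t} {s} (here refl) (there (here refl)) e = ⊥-elim (B∦ (subst (_∥ d) (sym (transfer A B t s e)) (∥-multiple _ d)))
      inj {t = t} {s} (there (here refl)) (here refl) e = ⊥-elim (B∦ (subst (_∥ d) (sym (transfer A B s t (sym e))) (∥-multiple _ d)))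
      inj {t = t} {s} (there (here refl)) (there (here refl)) e = refl , level B t s e

  abstract
    cover-parallel : ∀ π {A B d} → A ∈ C → B ∈ C → A on π → B on π → Direction d → d ≢ 𝟘 → d on π → ¬ B ⊝ A ∥ d →
      ∃₂ λ P e → ∃ λ ρ → Shared π P e ρ × ∃₂ λ X t → (X ≡ A ⊎ X ≡ B) × P ≡ X ⊕ t · d
    cover-parallel = cover-parallel′

  -- P lies on a secant through A, and distinct blocks share at most one point of 𝒞.
  cover-secant′ : ∀ π {A} → A ∈ C → A on π →
    ∃₂ λ P d → ∃ λ ρ → Shared π P d ρ × ∀ σ → ¬ π ≈ σ → A on σ → ¬ P on σ
  cover-secant′ π {A} A∈ Aπ =
    let P , d , ρ , P∈ , sh = cover-lines π fan fan-unique long fan-on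
        B , t , B∈ , t∈ , eq = ∈-grid⁻ f Bs ts P∈
        B∈C , Bπ , B≢A = B-props B∈
    in P , d , ρ , sh , λ σ ne Aσ Pσ → ne (same π σ A∈ B∈C (B≢A ∘ sym) Aπ Bπ Aσ
         (on-endpoint σ {t = t} (t-props t∈) Aσ (subst (_on σ) eq Pσ)))
    where
    Bs = _∖_ _≟ᵛ_ (pts π) (A ∷ [])
    ts = _∖_ _≟ᶠ_ (allFin q) (0# ∷ [])
    f : V 5 → Fin q → V 5
    f B t = A ⊕ t · (B ⊝ A)
    fan = grid f Bs ts
    B-props : ∀ {B} → B ∈ Bs → B ∈ C × B on π × B ≢ A
    B-props B∈ = let p , n = ∈-∖⁻ _≟ᵛ_ (pts π) (A ∷ []) B∈
                 in proj₁ (pts⁻ π p) , proj₂ (pts⁻ π p) , λ e → n (here e)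
    t-props : ∀ {t} → t ∈ ts → t ≢ 0#
    t-props t∈ e = proj₂ (∈-∖⁻ _≟ᶠ_ (allFin q) (0# ∷ []) t∈) (here e)
    fan-on : ∀ {P} → P ∈ fan → Affine P × P on π
    fan-on P∈ with ∈-grid⁻ f Bs ts P∈
    ... | B , t , B∈ , _ , refl = let B∈C , Bπ , _ = B-props B∈ in
      shift-affine t (affine A∈) (⊝-affine (affine A∈) (affine B∈C)) , on-shift π t Aπ (on-difference π Aπ Bπ)
    long : q ℕ.+ q ℕ.≤ length fan
    long = subst (q ℕ.+ q ℕ.≤_) (sym (grid-length f Bs ts)) (bound (length Bs) (length ts)
      (subst (ℕ._≤ suc (length Bs)) (pts-length π) (length-∖ _≟ᵛ_ (pts-unique π) (A ∷ [])))
      (subst (ℕ._≤ suc (length ts)) (allFin-length q) (length-∖ _≟ᶠ_ (allFin-unique q) (0# ∷ []))))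
      where
      -- For `q ≥ 7` the `(q - 1)²` points of the fan are at least `2q`.
      bound : ∀ b c → q ℕ.≤ suc b → q ℕ.≤ suc c → q ℕ.+ q ℕ.≤ b ℕ.* c
      bound b c qb qc = ℕₚ.≤-trans (ℕₚ.+-mono-≤ (ℕₚ.≤-trans qc (step c 6≤c)) (ℕₚ.≤-trans qc (step c 6≤c)))
        (ℕₚ.≤-trans (ℕₚ.≤-reflexive (sym (ℕₚ.*-distribʳ-+ c 2 2)))
          (ℕₚ.*-monoˡ-≤ c (ℕₚ.≤-trans (s≤s (s≤s (s≤s (s≤s z≤n)))) 6≤b)))
        where
        6≤b : 6 ℕ.≤ b
        6≤b = ℕ.s≤s⁻¹ (ℕₚ.≤-trans 7≤q qb)
        6≤c : 6 ℕ.≤ c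
        6≤c = ℕ.s≤s⁻¹ (ℕₚ.≤-trans 7≤q qc)
        step : ∀ c → 6 ℕ.≤ c → suc c ℕ.≤ 2 ℕ.* c
        step c le = ℕₚ.≤-trans (ℕₚ.+-monoˡ-≤ c (ℕₚ.≤-trans (s≤s z≤n) le)) (ℕₚ.≤-reflexive (cong (c ℕ.+_) (sym (ℕₚ.+-identityʳ c))))
    fan-unique : Unique fan
    fan-unique = grid-unique f (∖-unique _≟ᵛ_ (pts-unique π) _) (∖-unique _≟ᶠ_ (allFin-unique q) _)
      λ {B} {B′} {t} {s} B∈ B′∈ t∈ s∈ e → inj B B′ t s B∈ B′∈ t∈ s∈ (trans (sym (shift-unshift A (B ⊝ A) t))
        (trans (cong (_⊝ A) e) (shift-unshift A (B′ ⊝ A) s)))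
      where
      inj : ∀ B B′ t s → B ∈ Bs → B′ ∈ Bs → t ∈ ts → s ∈ ts → t · (B ⊝ A) ≡ s · (B′ ⊝ A) → B ≡ B′ × t ≡ s
      inj B B′ t s B∈ B′∈ t∈ s∈ e with B-props B∈ | B-props B′∈ | B ≟ᵛ B′
      ... | B∈C , Bπ , B≢A | B′∈C , B′π , B′≢A | no B≢B′ = ⊥-elim (arc-directions π A∈ B∈C B′∈C Aπ Bπ B′π
              (B≢A ∘ sym) (B′≢A ∘ sym) B≢B′ (span-here [] (B ⊝ A))
              (span-·-cancel {c = s} (t-props s∈) (subst (_∥ (B ⊝ A)) e (∥-multiple t (B ⊝ A)))))
      ... | B∈C , Bπ , B≢A | _ | yes refl with (t - s) ≟ᶠ 0#
      ...   | yes z = refl , diff⇒≡ z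
      ...   | no nz = ⊥-elim (⊝≢𝟘 (B≢A ∘ sym) (·-cancel nz (trans
                (vec-identity ((t - s) ⊡ #0) (t ⊡ #0 ⊞ (- 1#) ⊡ s ⊡ #0)
                  (λ { (x ∷ []) → solve 3 (λ t s x → (t :- s) :* x := t :* x :+ (:- :1) :* (s :* x)) refl t s x }) ((B ⊝ A) ∷ []))
                (trans (cong (_⊝ s · (B ⊝ A)) e) (v⊝v _)))))

  abstract
    cover-secant : ∀ π {A} → A ∈ C → A on π →
      ∃₂ λ P d → ∃ λ ρ → Shared π P d ρ × ∀ σ → ¬ π ≈ σ → A on σ → ¬ P on σ
    cover-secant = cover-secant′

  -- R is the point π_∞ of the paper, and a partner of π at A is the other block through the line A π_∞.
  Partner : Block → V 5 → V 5 → Set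
  Partner π R A = ∃ λ ρ → ¬ π ≈ ρ × A on ρ × R on ρ

  -- `one-of` records what counting alone yields; `partner` later removes the alternative. It and
  -- `shared` pass to any proportional `R`, which `partner-center` relies on.
  record Center (π : Block) (R : V 5) : Set where
    field
      R≢𝟘 : R ≢ 𝟘
      R-direction : Direction R
      Rπ : R on π
      shared : ∀ ρ {P P′} → ¬ π ≈ ρ → Affine P → Affine P′ → P ≢ P′ → P on π → P′ on π → P on ρ → P′ on ρ → R on ρ
      one-of : ∀ {A B} → A ∈ C → B ∈ C → A on π → B on π → ¬ B ⊝ A ∥ R → Partner π R A ⊎ Partner π R B

  -- `R` is the direction of one shared line. A second shared line, parallel to the first and
  -- distinct from it, then fixes the direction of all the others.
  center′ : ∀ π → ∃ (Center π)
  center′ π with pick π [] z≤n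
  ... | A , A∈ , Aπ , _ with cover-secant π A∈ Aπ
  ... | P₁ , d₁ , ρ₁ , ℓ₁ , _ = d₁ , record
      { R≢𝟘 = d≢𝟘 ℓ₁ ; R-direction = d-direction ℓ₁ ; Rπ = dπ ℓ₁
      ; shared = λ ρ ne a a′ P≢P′ Pπ P′π Pρ P′ρ → parallel-on second (shared-points π ρ ne a a′ P≢P′ Pπ P′π Pρ P′ρ)
      ; one-of = λ A∈ B∈ Aπ Bπ B∦ → split (cover-parallel π A∈ B∈ Aπ Bπ (d-direction ℓ₁) (d≢𝟘 ℓ₁) (dπ ℓ₁) B∦) }
    where
    Second : Set
    Second = ∃₂ λ P₂ d₂ → ∃ λ ρ₂ → Shared π P₂ d₂ ρ₂ × d₂ ∥ d₁ × ¬ P₂ on ρ₁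
    -- If `ρ₁` meets `π` in `A₁` on 𝒞, a line from `cover-secant` in another direction would cross
    -- the first in `A₁`, which the choice of `P₂` forbids. If `ρ₁` misses `π` on 𝒞, no shared line
    -- can cross the first at all.
    second : Second
    second with meet? ρ₁ π
    ... | yes (A₁ , A₁∈ , A₁ρ₁ , A₁π) with cover-secant π A₁∈ A₁π
    ...   | P₂ , d₂ , ρ₂ , ℓ₂ , avoid with span? (d₁ ∷ []) d₂
    ...     | yes p = P₂ , d₂ , ρ₂ , ℓ₂ , p , avoid ρ₁ (distinct ℓ₁) A₁ρ₁
    ...     | no np = let X , X∈ , Xπ , Xρ₁ , Xρ₂ = crossing ℓ₁ ℓ₂ np
                          X≡A₁ = meet-unique π ρ₁ (distinct ℓ₁) X∈ A₁∈ Xπ A₁π Xρ₁ A₁ρ₁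
                      in ⊥-elim (avoid ρ₂ (distinct ℓ₂) (subst (_on ρ₂) X≡A₁ Xρ₂) (Pρ ℓ₂))
    second | no none with off-direction π d₁ A∈ Aπ
    ... | B , B∈ , Bπ , B∦ with cover-parallel π A∈ B∈ Aπ Bπ (d-direction ℓ₁) (d≢𝟘 ℓ₁) (dπ ℓ₁) B∦
    ... | P₂ , d₂ , ρ₂ , ℓ₂ , X , t , X≡ , eq with span? (d₁ ∷ []) d₂
    ...     | yes p = P₂ , d₂ , ρ₂ , ℓ₂ , p , λ o → none (X , proj₁ (X-props X≡) , on-unshift ρ₁ t (subst (_on ρ₁) eq o) (dρ ℓ₁) , proj₂ (X-props X≡))
      where
      X-props : X ≡ A ⊎ X ≡ B → X ∈ C × X on π
      X-props (inj₁ refl) = A∈ , Aπ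
      X-props (inj₂ refl) = B∈ , Bπ
    ...     | no np = let X , X∈ , Xπ , Xρ₁ , _ = crossing ℓ₁ ℓ₂ np in ⊥-elim (none (X , X∈ , Xρ₁ , Xπ))
    -- A line crossing both parallel lines would carry two points of 𝒞.
    parallel-on : Second → ∀ {P d ρ} → Shared π P d ρ → d₁ on ρ
    parallel-on (P₂ , d₂ , ρ₂ , ℓ₂ , d₂∥d₁ , P₂∉) {P} {d} {ρ} ℓ with span? (d₁ ∷ []) d
    ... | yes d∥ = ∥-on ρ (∥-sym (d≢𝟘 ℓ) d∥) (dρ ℓ)
    ... | no d∦ =
      let X₁ , X₁∈ , X₁π , X₁ρ₁ , X₁ρ = crossing ℓ₁ ℓ d∦
          X₂ , X₂∈ , X₂π , X₂ρ₂ , X₂ρ = crossing ℓ₂ ℓ (λ d∥d₂ → d∦ (span-trans (d₂∥d₁ ∷ []) d∥d₂))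
          X₁≡X₂ = meet-unique π ρ (distinct ℓ) X₁∈ X₂∈ X₁π X₂π X₁ρ X₂ρ
          X₁ρ₂ = subst (_on ρ₂) (sym X₁≡X₂) X₂ρ₂
      in ⊥-elim (absurd X₁ X₁∈ X₁π X₁ρ₁ X₁ρ₂)
      where
      -- Either `X` lies on the second line, and moving along it inside `ρ₁` reaches `P₂`, or `X`
      -- together with that line spans `π` and `ρ₂` alike.
      absurd : ∀ X → X ∈ C → X on π → X on ρ₁ → X on ρ₂ → ⊥
      absurd X X∈ Xπ Xρ₁ Xρ₂ with span? (d₂ ∷ []) (X ⊝ P₂)
      ... | yes p = P₂∉ (subst (_on ρ₁) (vec-identity (#0 ⊞ (- 1#) ⊡ (#0 ⊞ (- 1#) ⊡ #1)) #1
              (λ { (x ∷ y ∷ []) → solve 2 (λ x y → x :+ (:- :1) :* (x :+ (:- :1) :* y) := y) refl x y }) (X ∷ P₂ ∷ []))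
              (span-⊝ Xρ₁ (∥-on ρ₁ (span-trans (d₂∥d₁ ∷ []) p) (dρ ℓ₁))))
      ... | no np = distinct ℓ₂ (same-frame π ρ₂ (P-affine ℓ₂) (d-direction ℓ₂) (⊝-affine (P-affine ℓ₂) (affine X∈)) (d≢𝟘 ℓ₂) np
              (Pπ ℓ₂) (dπ ℓ₂) (on-difference π (Pπ ℓ₂) Xπ) (Pρ ℓ₂) (dρ ℓ₂) (on-difference ρ₂ (Pρ ℓ₂) Xρ₂))
    split : ∀ {A B} → (∃₂ λ P e → ∃ λ ρ → Shared π P e ρ × ∃₂ λ X t → (X ≡ A ⊎ X ≡ B) × P ≡ X ⊕ t · d₁) →
      Partner π d₁ A ⊎ Partner π d₁ B
    split (P , e , ρ , sh , X , t , inj₁ refl , eq) = inj₁ (ρ , distinct sh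
      , on-unshift ρ t (subst (_on ρ) eq (Pρ sh)) (parallel-on second sh) , parallel-on second sh)
    split (P , e , ρ , sh , X , t , inj₂ refl , eq) = inj₂ (ρ , distinct sh
      , on-unshift ρ t (subst (_on ρ) eq (Pρ sh)) (parallel-on second sh) , parallel-on second sh)

  abstract
    center : ∀ π → ∃ (Center π)
    center = center′

-- Every point of 𝒞 on a block has a partner.

module Parallels {q : ℕ} (F : FField q) (7≤q : 7 ℕ.≤ q)
  (h : Vec (Fin q) 5) (C : List (Vec (Fin q) 5)) (CPlane : Geo.Plane F → Set)
  (hyp : Geo.Config.Hypotheses F h C CPlane) where
  open Counting
  open Centers F 7≤q h C CPlane hyp public
  open Center

  opaque
    shift-distinct : ∀ {A d : V 5} {t} → t ≢ 0# → d ≢ 𝟘 → A ≢ A ⊕ t · d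
    shift-distinct {A} {d} {t} t≢0 d≢0 e =
      d≢0 (·-cancel t≢0 (trans (sym (shift-unshift A d t)) (trans (cong (_⊝ A) (sym e)) (v⊝v A))))

  shift-injective′ : ∀ {A d : V 5} {t s} → d ≢ 𝟘 → t ≢ s → A ⊕ t · d ≢ A ⊕ s · d
  shift-injective′ {A} {d} {t} {s} d≢0 t≢s e = d≢0 (·-cancel (diff≢0 t≢s) (trans
    (vec-identity ((t - s) ⊡ #1) ((#0 ⊞ t ⊡ #1) ⊞ (- 1#) ⊡ (#0 ⊞ s ⊡ #1))
      (λ { (x ∷ y ∷ []) → solve 4 (λ t s x y → (t :- s) :* y := x :+ t :* y :+ (:- :1) :* (x :+ s :* y)) refl t s x y })
      (A ∷ d ∷ []))
    (trans (cong (_⊝ (A ⊕ s · d)) e) (v⊝v _))))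

  abstract
    shift-injective : ∀ {A d : V 5} {t s} → d ≢ 𝟘 → t ≢ s → A ⊕ t · d ≢ A ⊕ s · d
    shift-injective = shift-injective′

  distinct-sym : ∀ ρ σ → ¬ ρ ≈ σ → ¬ σ ≈ ρ
  distinct-sym ρ σ ne e = ne (≈-sym σ ρ e)

  opaque
    -- The line of `A` and `R` lies in both blocks, so it passes through the center `R′` of `ρ` as
    -- well; were `R′` not proportional to `R`, then `A`, `R` and `R′` would span both blocks.
    partner-center : ∀ {π R A} → Center π R → ∀ ρ → ¬ π ≈ ρ → A ∈ C → A on π → A on ρ → R on ρ → Center ρ R
    partner-center {π} {R} {A} c ρ ne A∈ Aπ Aρ Rρ with center ρ
    ... | R′ , c′ = record
      { R≢𝟘 = R≢𝟘 c ; R-direction = R-direction c ; Rπ = Rρ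
      ; shared = λ σ n a a′ p 1π 2π 1σ 2σ → ∥-on σ R∥R′ (shared c′ σ n a a′ p 1π 2π 1σ 2σ)
      ; one-of = λ A∈ B∈ Aρ Bρ n → weaken (one-of c′ A∈ B∈ Aρ Bρ (λ p → n (span-trans (R′∥R ∷ []) p))) }
      where
      R′∥R : R′ ∥ R
      R′∥R with span? (R ∷ []) R′
      ... | yes p = p
      ... | no np = ⊥-elim (ne (same-frame π ρ (affine A∈) (R-direction c) (R-direction c′) (R≢𝟘 c) np
        Aπ (Rπ c) (shared c′ π (distinct-sym π ρ ne) (affine A∈) (shift-affine 1# (affine A∈) (R-direction c))
          (shift-distinct 1≢0 (R≢𝟘 c)) Aρ (on-shift ρ 1# Aρ Rρ) Aπ (on-shift π 1# Aπ (Rπ c))) Aρ Rρ (Rπ c′)))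
      R∥R′ : R ∥ R′
      R∥R′ = ∥-sym (R≢𝟘 c′) R′∥R
      weaken : ∀ {A B} → Partner ρ R′ A ⊎ Partner ρ R′ B → Partner ρ R A ⊎ Partner ρ R B
      weaken (inj₁ (σ , n , o , R′σ)) = inj₁ (σ , n , o , ∥-on σ R∥R′ R′σ)
      weaken (inj₂ (σ , n , o , R′σ)) = inj₂ (σ , n , o , ∥-on σ R∥R′ R′σ)

  module Hyperplane (gs : Vec (V 5) 4) where

    Inside : Block → Set
    Inside ρ = ∀ {v} → v on ρ → InSpan gs v

    inside : ∀ ρ {us : Vec (V 5) 3} → Independent us → VAll (_on ρ) us → VAll (InSpan gs) us → Inside ρ
    inside ρ ind usρ us∈ vρ = span-trans us∈ (independent-spans ind usρ vρ)

    inside-frame : ∀ ρ {P d e} → Affine P → Direction d → Direction e → d ≢ 𝟘 → ¬ e ∥ d →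
      P on ρ → d on ρ → e on ρ → InSpan gs P → InSpan gs d → InSpan gs e → Inside ρ
    inside-frame ρ a hd he d≢0 e∦d Pρ dρ eρ P∈ d∈ e∈ =
      inside ρ (frame-independent a hd he d≢0 e∦d) (Pρ ∷ eρ ∷ dρ ∷ []) (P∈ ∷ e∈ ∷ d∈ ∷ [])

    -- A block through D that meets α, β and γ in three distinct points lies inside; at most five points of α
    -- fail to yield such a block.
    opaque
      all-inside : ∀ α β γ → ¬ α ≈ β → ¬ α ≈ γ → ¬ β ≈ γ → Inside α → Inside β → Inside γ → ∀ {D} → D ∈ C → InSpan gs D
      all-inside α β γ α≉β α≉γ β≉γ αin βin γin {D} D∈ with D on? α | D on? β | D on? γ
      ... | yes Dα | _ | _ = αin Dα
      ... | no _ | yes Dβ | _ = βin Dβ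
      ... | no _ | no _ | yes Dγ = γin Dγ
      ... | no D∉α | no D∉β | no D∉γ = proj₂ (proj₂ (choose {n = 5} (pts-unique α)
              (subst (5 ℕ.<_) (sym (pts-length α)) (ℕₚ.≤-trans (ℕₚ.n≤1+n 6) 7≤q)) (λ _ → InSpan gs D) Bad amo dich))
        where
        -- The last three defects determine the block `τ` through `D`, by Playfair or as the join
        -- with the common point of `β` and `γ`; since `D` is off `α`, this block meets `α` at most
        -- once.
        Bad : Fin 5 → V 5 → Set
        Bad zero P = P on β
        Bad (suc zero) P = P on γ
        Bad (suc (suc zero)) P = ∃ λ τ → D on τ × P on τ × ¬ Meet τ β
        Bad (suc (suc (suc zero))) P = ∃ λ τ → D on τ × P on τ × ¬ Meet τ γ
        Bad (suc (suc (suc (suc zero)))) P = ∃ λ τ → D on τ × P on τ × ∃ λ v → v ∈ C × v on τ × v on β × v on γ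
        through-D : ∀ τ τ′ P P′ → P ∈ pts α → P′ ∈ pts α → τ ≈ τ′ → D on τ → P on τ → P′ on τ′ → P ≡ P′
        through-D τ τ′ P P′ P∈ P′∈ e Dτ Pτ P′τ′ = meet-unique α τ (λ e′ → D∉α (≈-on τ α (≈-sym α τ e′) Dτ))
          (proj₁ (pts⁻ α P∈)) (proj₁ (pts⁻ α P′∈)) (proj₂ (pts⁻ α P∈)) (proj₂ (pts⁻ α P′∈)) Pτ (≈-on τ′ τ (≈-sym τ τ′ e) P′τ′)
        amo : ∀ i x y → x ∈ pts α → y ∈ pts α → Bad i x → Bad i y → x ≡ y
        amo zero x y x∈ y∈ xβ yβ = meet-unique α β α≉β
          (proj₁ (pts⁻ α x∈)) (proj₁ (pts⁻ α y∈)) (proj₂ (pts⁻ α x∈)) (proj₂ (pts⁻ α y∈)) xβ yβ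
        amo (suc zero) x y x∈ y∈ xγ yγ = meet-unique α γ α≉γ
          (proj₁ (pts⁻ α x∈)) (proj₁ (pts⁻ α y∈)) (proj₂ (pts⁻ α x∈)) (proj₂ (pts⁻ α y∈)) xγ yγ
        amo (suc (suc zero)) x y x∈ y∈ (τ , Dτ , xτ , m) (τ′ , Dτ′ , yτ′ , m′) =
          through-D τ τ′ x y x∈ y∈ (playfair τ τ′ β D∈ Dτ Dτ′ m m′) Dτ xτ yτ′
        amo (suc (suc (suc zero))) x y x∈ y∈ (τ , Dτ , xτ , m) (τ′ , Dτ′ , yτ′ , m′) =
          through-D τ τ′ x y x∈ y∈ (playfair τ τ′ γ D∈ Dτ Dτ′ m m′) Dτ xτ yτ′
        amo (suc (suc (suc (suc zero)))) x y x∈ y∈ (τ , Dτ , xτ , v , v∈ , vτ , vβ , vγ) (τ′ , Dτ′ , yτ′ , w , w∈ , wτ′ , wβ , wγ) =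
          let v≡w = meet-unique β γ β≉γ v∈ w∈ vβ wβ vγ wγ
          in through-D τ τ′ x y x∈ y∈ (same τ τ′ D∈ v∈ (λ D≡v → D∉β (subst (_on β) (sym D≡v) vβ)) Dτ vτ Dτ′
               (subst (_on τ′) (sym v≡w) wτ′)) Dτ xτ yτ′
        dich : ∀ P → P ∈ pts α → InSpan gs D ⊎ ∃ λ i → Bad i P
        dich P P∈ with pts⁻ α P∈
        ... | P∈C , Pα with join D∈ P∈C (λ D≡P → D∉α (subst (_on α) (sym D≡P) Pα))
        ... | τ , Dτ , Pτ with P on? β | P on? γ | meet? τ β | meet? τ γ
        ... | yes Pβ | _ | _ | _ = inj₂ (zero , Pβ)
        ... | no _ | yes Pγ | _ | _ = inj₂ (suc zero , Pγ)
        ... | no _ | no _ | no m | _ = inj₂ (suc (suc zero) , τ , Dτ , Pτ , m)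
        ... | no _ | no _ | yes _ | no m = inj₂ (suc (suc (suc zero)) , τ , Dτ , Pτ , m)
        ... | no P∉β | no P∉γ | yes (v , v∈ , vτ , vβ) | yes (w , w∈ , wτ , wγ) with v ≟ᵛ w
        ... | yes v≡w = inj₂ (suc (suc (suc (suc zero))) , τ , Dτ , Pτ , v , v∈ , vτ , vβ , subst (_on γ) (sym v≡w) wγ)
        ... | no v≢w = inj₁ (inside τ
                (arc τ P∈C v∈ w∈ Pτ vτ wτ (λ e → P∉β (subst (_on β) (sym e) vβ)) (λ e → P∉γ (subst (_on γ) (sym e) wγ)) v≢w)
                (Pτ ∷ vτ ∷ wτ ∷ []) (αin Pα ∷ βin vβ ∷ γin wγ ∷ []) Dτ)

    -- Two three-dimensional subspaces of a four-dimensional space share a second direction.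
    common-direction′ : (∀ {D} → D ∈ C → InSpan gs D) → ∀ π σ {A} → A ∈ C → A on π → A on σ →
      ∃ λ d → d ≢ 𝟘 × Direction d × d on π × d on σ
    common-direction′ all π σ {A} A∈ Aπ Aσ with pick π (A ∷ []) (s≤s z≤n) | pick σ (A ∷ []) (s≤s z≤n)
    ... | B , B∈ , Bπ , B∉ | E , E∈ , Eσ , E∉
      with pick π (A ∷ B ∷ []) (s≤s (s≤s z≤n)) | pick σ (A ∷ E ∷ []) (s≤s (s≤s z≤n))
    ... | B′ , B′∈ , B′π , B′∉ | E′ , E′∈ , E′σ , E′∉
      with dependent gs (A ∷ B ∷ B′ ∷ E ∷ E′ ∷ []) (all A∈ ∷ all B∈ ∷ all B′∈ ∷ all E∈ ∷ all E′∈ ∷ [])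
    ... | a ∷ b ∷ b′ ∷ e ∷ e′ ∷ [] , cs≢0 , rel =
        d , d≢0 , d-dir , d-on π Bπ B′π Aπ , subst (_on σ) (sym d≡d′) (d′-on σ Eσ E′σ Aσ)
      where
      -- The relation is separated into its part from `π` and, with opposite sign, its part from
      -- `σ`, both written in differences from `A`.
      d d′ : V 5
      d = b · (B ⊝ A) ⊕ b′ · (B′ ⊝ A)
      d′ = (- e) · (E ⊝ A) ⊕ (- e′) · (E′ ⊝ A)
      d-on : ∀ ρ → B on ρ → B′ on ρ → A on ρ → d on ρ
      d-on ρ p p′ pA = span-⊕ (span-· b (on-difference ρ pA p)) (span-· b′ (on-difference ρ pA p′))
      d′-on : ∀ ρ → E on ρ → E′ on ρ → A on ρ → d′ on ρ
      d′-on ρ p p′ pA = span-⊕ (span-· (- e) (on-difference ρ pA p)) (span-· (- e′) (on-difference ρ pA p′))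
      d-dir : Direction d
      d-dir = trans (linear-vec (dot-linear h) (b ⊡ #0 ⊞ b′ ⊡ #1) ((B ⊝ A) ∷ (B′ ⊝ A) ∷ []))
        (trans (cong₂ (λ x y → b * x + b′ * y) (⊝-affine (affine A∈) (affine B∈)) (⊝-affine (affine A∈) (affine B′∈)))
          (solve 2 (λ b b′ → b :* :0 :+ b′ :* :0 := :0) refl b b′))
      -- Applying `h` to the relation shows that the coefficients add up to zero, which is what lets
      -- `A` be subtracted from every point.
      total : a + (b + (b′ + (e + e′))) ≡ 0#
      total = trans (solve 5 (λ a b b′ e e′ → a :+ (b :+ (b′ :+ (e :+ e′)))
            := a :* :1 :+ (b :* :1 :+ (b′ :* :1 :+ (e :* :1 :+ (e′ :* :1 :+ :0))))) refl a b b′ e e′)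
        (trans (cong (dot cs) (cong₂ _∷_ (sym (affine A∈)) (cong₂ _∷_ (sym (affine B∈)) (cong₂ _∷_ (sym (affine B′∈))
            (cong₂ _∷_ (sym (affine E∈)) (cong (_∷ []) (sym (affine E′∈))))))))
        (trans (sym (dot-comb h us cs)) (trans (cong (dot h) rel) (dot-𝟘 h))))
        where
        us : Vec (V 5) 5
        us = A ∷ B ∷ B′ ∷ E ∷ E′ ∷ []
        cs : V 5
        cs = a ∷ b ∷ b′ ∷ e ∷ e′ ∷ []
      d≡d′ : d ≡ d′
      d≡d′ = trans
        (vec-identity (b ⊡ (#1 ⊞ (- 1#) ⊡ #0) ⊞ b′ ⊡ (#2 ⊞ (- 1#) ⊡ #0))
          ((a ⊡ #0 ⊞ (b ⊡ #1 ⊞ (b′ ⊡ #2 ⊞ (e ⊡ #3 ⊞ (e′ ⊡ #4 ⊞ ∅)))))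
            ⊞ (- (a + (b + (b′ + (e + e′))))) ⊡ #0
            ⊞ ((- e) ⊡ (#3 ⊞ (- 1#) ⊡ #0) ⊞ (- e′) ⊡ (#4 ⊞ (- 1#) ⊡ #0)))
          (λ { (A ∷ B ∷ B′ ∷ E ∷ E′ ∷ []) → solve 10 (λ a b b′ e e′ A B B′ E E′ →
              b :* (B :+ (:- :1) :* A) :+ b′ :* (B′ :+ (:- :1) :* A)
              := (a :* A :+ (b :* B :+ (b′ :* B′ :+ (e :* E :+ (e′ :* E′ :+ :0)))))
                 :+ (:- (a :+ (b :+ (b′ :+ (e :+ e′))))) :* A
                 :+ ((:- e) :* (E :+ (:- :1) :* A) :+ (:- e′) :* (E′ :+ (:- :1) :* A)))
              refl a b b′ e e′ A B B′ E E′ })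
          (A ∷ B ∷ B′ ∷ E ∷ E′ ∷ []))
        (trans (cong₂ (λ v s → v ⊕ (- s) · A ⊕ d′) rel total)
          (vec-identity (∅ ⊞ (- 0#) ⊡ #0 ⊞ #1) #1
            (λ { (x ∷ y ∷ []) → solve 2 (λ x y → :0 :+ (:- :0) :* x :+ y := y) refl x y }) (A ∷ d′ ∷ [])))
      spread : ∀ s s′ B B′ → comb (A ∷ B ∷ B′ ∷ []) ((- (s + s′)) ∷ s ∷ s′ ∷ []) ≡ s · (B ⊝ A) ⊕ s′ · (B′ ⊝ A)
      spread s s′ B B′ = vec-identity ((- (s + s′)) ⊡ #0 ⊞ (s ⊡ #1 ⊞ (s′ ⊡ #2 ⊞ ∅)))
        (s ⊡ (#1 ⊞ (- 1#) ⊡ #0) ⊞ s′ ⊡ (#2 ⊞ (- 1#) ⊡ #0))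
        (λ { (A ∷ B ∷ B′ ∷ []) → solve 5 (λ s s′ A B B′ → (:- (s :+ s′)) :* A :+ (s :* B :+ (s′ :* B′ :+ :0))
            := s :* (B :+ (:- :1) :* A) :+ s′ :* (B′ :+ (:- :1) :* A)) refl s s′ A B B′ }) (A ∷ B ∷ B′ ∷ [])
      -- Each block contributes three independent points, so a vanishing `d` would make the whole
      -- relation trivial.
      d≢0 : d ≢ 𝟘
      d≢0 d≡0 = cs≢0 (cong₂ _∷_ a≡0 (cong₂ _∷_ b≡0 (cong₂ _∷_ b′≡0 (cong₂ _∷_ e≡0 (cong (_∷ []) e′≡0)))))
        where
        left : (- (b + b′)) ∷ b ∷ b′ ∷ [] ≡ 𝟘
        left = arc π A∈ B∈ B′∈ Aπ Bπ B′π (λ p → B∉ (here (sym p))) (λ p → B′∉ (here (sym p))) (λ p → B′∉ (there (here (sym p))))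
          ((- (b + b′)) ∷ b ∷ b′ ∷ []) (trans (spread b b′ B B′) d≡0)
        right : (- ((- e) + (- e′))) ∷ (- e) ∷ (- e′) ∷ [] ≡ 𝟘
        right = arc σ A∈ E∈ E′∈ Aσ Eσ E′σ (λ p → E∉ (here (sym p))) (λ p → E′∉ (here (sym p))) (λ p → E′∉ (there (here (sym p))))
          ((- ((- e) + (- e′))) ∷ (- e) ∷ (- e′) ∷ []) (trans (spread (- e) (- e′) E E′) (trans (sym d≡d′) d≡0))
        unneg : ∀ {x} → - x ≡ 0# → x ≡ 0#
        unneg {x} p = trans (solve 1 (λ x → x := :- (:- x)) refl x) (trans (cong -_ p) (solve 0 (:- :0 := :0) refl))
        b≡0 : b ≡ 0#
        b≡0 = cong (λ v → Vec.head (Vec.tail v)) left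
        b′≡0 : b′ ≡ 0#
        b′≡0 = cong (λ v → Vec.head (Vec.tail (Vec.tail v))) left
        e≡0 : e ≡ 0#
        e≡0 = unneg (cong (λ v → Vec.head (Vec.tail v)) right)
        e′≡0 : e′ ≡ 0#
        e′≡0 = unneg (cong (λ v → Vec.head (Vec.tail (Vec.tail v))) right)
        a≡0 : a ≡ 0#
        a≡0 = trans (solve 5 (λ a b b′ e e′ → a := a :+ (b :+ (b′ :+ (e :+ e′))) :- (b :+ (b′ :+ (e :+ e′)))) refl a b b′ e e′)
          (trans (cong₂ _-_ total (cong₂ _+_ b≡0 (cong₂ _+_ b′≡0 (cong₂ _+_ e≡0 e′≡0))))
            (solve 0 (:0 :- (:0 :+ (:0 :+ (:0 :+ :0))) := :0) refl))

    abstract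
      common-direction : (∀ {D} → D ∈ C → InSpan gs D) → ∀ π σ {A} → A ∈ C → A on π → A on σ →
        ∃ λ d → d ≢ 𝟘 × Direction d × d on π × d on σ
      common-direction = common-direction′

    opaque
      -- Otherwise `all-inside` puts 𝒞 into the span of `gs`, and then any two blocks through a
      -- point share a line. Three blocks through `A`, one of them with center `R`, would all
      -- contain the line of `A` and `R`, too many for the point `A + R`.
      no-three : ∀ α β γ → ¬ α ≈ β → ¬ α ≈ γ → ¬ β ≈ γ → Inside α → Inside β → Inside γ → ⊥
      no-three α β γ α≉β α≉γ β≉γ αin βin γin with pick α [] z≤n
      ... | A , A∈ , Aα , _ with other-block α A∈ Aα
      ... | σ , α≉σ , Aσ with off-blocks α σ
      ... | D , D∈ , D∉α , D∉σ with join A∈ D∈ (λ A≡D → D∉α (subst (_on α) A≡D Aα)) | center α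
      ... | ρ , Aρ , Dρ | R , c = absurd ((A ⊕ 1# · R) ∈ᶜ? C)
        where
        all : ∀ {D} → D ∈ C → InSpan gs D
        all = all-inside α β γ α≉β α≉γ β≉γ αin βin γin
        α≉ρ : ¬ α ≈ ρ
        α≉ρ e = D∉α (≈-on ρ α (≈-sym α ρ e) Dρ)
        σ≉ρ : ¬ σ ≈ ρ
        σ≉ρ e = D∉σ (≈-on ρ σ (≈-sym σ ρ e) Dρ)
        R-on : ∀ τ → ¬ α ≈ τ → A on τ → R on τ
        R-on τ ne Aτ = let d , d≢0 , hd , dα , dτ = common-direction all α τ A∈ Aα Aτ in
          shared c τ ne (affine A∈) (shift-affine 1# (affine A∈) hd) (shift-distinct 1≢0 d≢0)
            Aα (on-shift α 1# Aα dα) Aτ (on-shift τ 1# Aτ dτ)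
        Xα : A ⊕ 1# · R on α
        Xα = on-shift α 1# Aα (Rπ c)
        Xσ : A ⊕ 1# · R on σ
        Xσ = on-shift σ 1# Aσ (R-on σ α≉σ Aσ)
        Xρ : A ⊕ 1# · R on ρ
        Xρ = on-shift ρ 1# Aρ (R-on ρ α≉ρ Aρ)
        absurd : Dec ((A ⊕ 1# · R) ∈ C) → ⊥
        absurd (yes X∈) = shift-distinct 1≢0 (R≢𝟘 c) (meet-unique α σ α≉σ A∈ X∈ Aα Xα Aσ Xσ)
        absurd (no X∉) with at-most-two α σ ρ (shift-affine 1# (affine A∈) (R-direction c)) X∉ Xα Xσ Xρ
        ... | inj₁ e = α≉σ e
        ... | inj₂ (inj₁ e) = α≉ρ e
        ... | inj₂ (inj₂ e) = σ≉ρ e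

  opaque
    -- `π` and `ρ` each meet `σ` in a line through `R`; a further common point `D` would put all
    -- three blocks into the span of `A`, `E`, `R`, `D`. This is disjointness in the whole affine
    -- space, stronger than being parallel on 𝒞.
    no-common-point : ∀ π σ ρ {A E R D} → ¬ π ≈ σ → ¬ σ ≈ ρ → A ∈ C → A on π → A on σ → E ∈ C → E on σ → E on ρ →
      A ≢ E → R ≢ 𝟘 → Direction R → R on π → R on σ → R on ρ → Affine D → D on π → D on ρ → ⊥
    no-common-point π σ ρ {A} {E} {R} {D} π≉σ σ≉ρ A∈ Aπ Aσ E∈ Eσ Eρ A≢E R≢0 hR Rπ Rσ Rρ aD Dπ Dρ =
      no-three π σ ρ π≉σ π≉ρ σ≉ρ
        (inside-frame π (affine A∈) hR (⊝-affine (affine A∈) aD) R≢0 (λ p → D∉σ (back σ Aσ Rσ p))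
          Aπ Rπ (on-difference π Aπ Dπ) A∈gs R∈gs (span-⊝ D∈gs A∈gs))
        (inside-frame σ (affine A∈) hR (⊝-affine (affine A∈) (affine E∈)) R≢0
          (λ p → A≢E (meet-unique π σ π≉σ A∈ E∈ Aπ (back π Aπ Rπ p) Aσ Eσ))
          Aσ Rσ (on-difference σ Aσ Eσ) A∈gs R∈gs (span-⊝ E∈gs A∈gs))
        (inside-frame ρ (affine E∈) hR (⊝-affine (affine E∈) aD) R≢0 (λ p → D∉σ (back σ Eσ Rσ p))
          Eρ Rρ (on-difference ρ Eρ Dρ) E∈gs R∈gs (span-⊝ D∈gs E∈gs))
      where
      gs : Vec (V 5) 4
      gs = A ∷ E ∷ R ∷ D ∷ []
      open Hyperplane gs
      A∈gs : InSpan gs A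
      A∈gs = span-here _ A
      E∈gs : InSpan gs E
      E∈gs = span-there A (span-here _ E)
      R∈gs : InSpan gs R
      R∈gs = span-there A (span-there E (span-here _ R))
      D∈gs : InSpan gs D
      D∈gs = span-there A (span-there E (span-there R (span-here _ D)))
      back : ∀ τ {P Q} → P on τ → R on τ → Q ⊝ P ∥ R → Q on τ
      back τ {P} {Q} Pτ Rτ p = subst (_on τ) (⊝-back P Q) (span-⊕ Pτ (∥-on τ p Rτ))
      π≉ρ : ¬ π ≈ ρ
      π≉ρ e = A≢E (meet-unique π σ π≉σ A∈ E∈ Aπ (≈-on ρ π (≈-sym π ρ e) Eρ) Aσ Eσ)
      D∉σ : ¬ D on σ
      D∉σ Dσ with D ∈ᶜ? C
      ... | yes D∈ = A≢E (trans (meet-unique π σ π≉σ A∈ D∈ Aπ Dπ Aσ Dσ) (meet-unique σ ρ σ≉ρ D∈ E∈ Dσ Eσ Dρ Eρ))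
      ... | no D∉ with at-most-two π σ ρ aD D∉ Dπ Dσ Dρ
      ...   | inj₁ e = π≉σ e
      ...   | inj₂ (inj₁ e) = π≉ρ e
      ...   | inj₂ (inj₂ e) = σ≉ρ e

  -- Without a partner at A₀, the points of A₀ + ⟨R⟩ lie on parallels of π; these meet σ in points without partners.
  module _ {π R} (c : Center π R) {A₀} (A₀∈ : A₀ ∈ C) (A₀π : A₀ on π) where

    point : Fin q → V 5
    point t = A₀ ⊕ t · R

    point-affine : ∀ t → Affine (point t)
    point-affine t = shift-affine t (affine A₀∈) (R-direction c)

    point-π : ∀ t → point t on π
    point-π t = on-shift π t A₀π (Rπ c)

    -- A nonzero `t` with `point t` in 𝒞 occurs at most once, since two such points would be
    -- collinear with `A₀`; with `0#` and two values chosen before, this makes four exclusions.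
    parameter : ∀ e₁ e₂ → ∃ λ t → t ≢ 0# × point t ∉ C × t ≢ e₁ × t ≢ e₂
    parameter e₁ e₂ = let t , _ , g = choose {n = 4} (allFin-unique q)
                            (subst (4 ℕ.<_) (sym (allFin-length q)) (ℕₚ.≤-trans (ℕₚ.m≤n+m 5 2) 7≤q)) Good Bad amo dich in t , g
      where
      Good : Fin q → Set
      Good t = t ≢ 0# × point t ∉ C × t ≢ e₁ × t ≢ e₂
      Bad : Fin 4 → Fin q → Set
      Bad zero t = t ≡ 0#
      Bad (suc zero) t = t ≢ 0# × point t ∈ C
      Bad (suc (suc zero)) t = t ≡ e₁
      Bad (suc (suc (suc zero))) t = t ≡ e₂
      ∥R : ∀ t → point t ⊝ A₀ ∥ R
      ∥R t = subst (_∥ R) (sym (shift-unshift A₀ R t)) (∥-multiple t R)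
      amo : ∀ i x y → x ∈ allFin q → y ∈ allFin q → Bad i x → Bad i y → x ≡ y
      amo zero x y _ _ p p′ = trans p (sym p′)
      amo (suc zero) x y _ _ (x≢0 , X∈) (y≢0 , Y∈) with x ≟ᶠ y
      ... | yes e = e
      ... | no x≢y = ⊥-elim (arc-directions π A₀∈ X∈ Y∈ A₀π (point-π x) (point-π y)
              (shift-distinct x≢0 (R≢𝟘 c)) (shift-distinct y≢0 (R≢𝟘 c)) (shift-injective (R≢𝟘 c) x≢y) (∥R x) (∥R y))
      amo (suc (suc zero)) x y _ _ p p′ = trans p (sym p′)
      amo (suc (suc (suc zero))) x y _ _ p p′ = trans p (sym p′)
      dich : ∀ t → t ∈ allFin q → Good t ⊎ ∃ λ i → Bad i t
      dich t _ with t ≟ᶠ 0# | point t ∈ᶜ? C | t ≟ᶠ e₁ | t ≟ᶠ e₂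
      ... | yes e | _ | _ | _ = inj₂ (zero , e)
      ... | no n | yes X∈ | _ | _ = inj₂ (suc zero , n , X∈)
      ... | no _ | no _ | yes e | _ = inj₂ (suc (suc zero) , e)
      ... | no _ | no _ | no _ | yes e = inj₂ (suc (suc (suc zero)) , e)
      ... | no n | no X∉ | no n₁ | no n₂ = inj₁ (n , X∉ , n₁ , n₂)

    Unpaired : Fin q → Set
    Unpaired t = ∃ λ ρ → ¬ π ≈ ρ × point t on ρ × ¬ A₀ on ρ × point t ∉ C

    pairing : ∀ t → t ≢ 0# → point t ∉ C → Partner π R A₀ ⊎ Unpaired t
    pairing t t≢0 X∉ with second-block π (point-affine t) X∉ (point-π t)
    ... | ρ , ne , Xρ with A₀ on? ρ
    ... | yes A₀ρ = inj₁ (ρ , ne , A₀ρ , shared c ρ ne (affine A₀∈) (point-affine t) (shift-distinct t≢0 (R≢𝟘 c))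
                            A₀π (point-π t) A₀ρ Xρ)
    ... | no A₀∉ = inj₂ (ρ , ne , Xρ , A₀∉ , X∉)

    module _ {B} (B∈ : B ∈ C) (Bπ : B on π) (σ : Block) (π≉σ : ¬ π ≈ σ) (Bσ : B on σ) (Rσ : R on σ) where

      -- A common point on 𝒞 would give `π` and the block a common line through `point t`, hence
      -- `R`, and with `R` also `A₀`.
      unpaired-parallel : ∀ {t} (u : Unpaired t) → ¬ Meet (proj₁ u) π
      unpaired-parallel {t} (ρ , ne , Xρ , A₀∉ , X∉) (v , v∈ , vρ , vπ) = A₀∉ (on-unshift ρ t Xρ
        (shared c ρ ne (affine v∈) (point-affine t) (λ v≡X → X∉ (subst (_∈ C) v≡X v∈)) vπ (point-π t) vρ Xρ))

      trace : ∀ {t} (u : Unpaired t) → Meet σ (proj₁ u)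
      trace u = meets-one σ π (proj₁ u) B∈ Bσ Bπ (distinct-sym π σ π≉σ)
        (λ m → unpaired-parallel u (meet-sym {π} {proj₁ u} m))

      -- Two parallels of `π` through the same point coincide; such a block would contain two points
      -- of the line of `A₀` and `R`, hence `A₀`.
      trace-distinct : ∀ {t s} (u : Unpaired t) (w : Unpaired s) → t ≢ s → proj₁ (trace u) ≢ proj₁ (trace w)
      trace-distinct {t} {s} u@(ρ , ne , Xρ , A₀∉ , X∉) w@(ρ′ , _ , Yρ′ , _) t≢s e =
        let D , D∈ , Dσ , Dρ = trace u
            D′ , _ , _ , D′ρ′ = trace w
            ρ≈ρ′ = playfair ρ ρ′ π D∈ Dρ (subst (_on ρ′) (sym e) D′ρ′) (unpaired-parallel u) (unpaired-parallel w)
        in A₀∉ (on-unshift ρ t Xρ (shared c ρ ne (point-affine t) (point-affine s) (shift-injective (R≢𝟘 c) t≢s)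
             (point-π t) (point-π s) Xρ (≈-on ρ′ ρ (≈-sym ρ ρ′ ρ≈ρ′) Yρ′)))

      -- A partner `τ` of `σ` at the trace has no affine point in common with `π`, so by Playfair it
      -- is the parallel `ρ` itself; but `ρ` meets `π` in `point t`.
      trace-unpaired : ∀ {t} (u : Unpaired t) → ¬ Partner σ R (proj₁ (trace u))
      trace-unpaired {t} u@(ρ , ne , Xρ , A₀∉ , X∉) (τ , σ≉τ , Dτ , Rτ) =
        let D , D∈ , Dσ , Dρ = trace u
            none : ∀ {Q} → Affine Q → Q on π → Q on τ → ⊥
            none = no-common-point π σ τ π≉σ σ≉τ B∈ Bπ Bσ D∈ Dσ Dτ
              (λ B≡D → unpaired-parallel u (B , B∈ , subst (_on ρ) (sym B≡D) Dρ , Bπ)) (R≢𝟘 c) (R-direction c) (Rπ c) Rσ Rτ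
            τ≈ρ = playfair τ ρ π D∈ Dτ Dρ (λ (v , v∈ , vτ , vπ) → none (affine v∈) vπ vτ) (unpaired-parallel u)
        in none (point-affine t) (point-π t) (≈-on ρ τ (≈-sym τ ρ τ≈ρ) Xρ)

      -- `σ` too has center `R`, so any two of its points without a partner are aligned with `R`; an
      -- arc cannot contain three points on one line.
      not-three : ∀ {t s r} → Unpaired t → Unpaired s → Unpaired r → t ≢ s → t ≢ r → s ≢ r → ⊥
      not-three u v w t≢s t≢r s≢r =
        let D₁ , D₁∈ , D₁σ , _ = trace u
            D₂ , D₂∈ , D₂σ , _ = trace v
            D₃ , D₃∈ , D₃σ , _ = trace w
            cσ = partner-center c σ π≉σ B∈ Bπ Bσ Rσ
            aligned : D₂ ⊝ D₁ ∥ R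
            aligned = case (span? (R ∷ []) (D₂ ⊝ D₁)) λ n → one-of cσ D₁∈ D₂∈ D₁σ D₂σ n
        in neither (trace-unpaired u) (trace-unpaired w) (one-of cσ D₁∈ D₃∈ D₁σ D₃σ
             (arc-directions σ D₁∈ D₂∈ D₃∈ D₁σ D₂σ D₃σ (trace-distinct u v t≢s) (trace-distinct u w t≢r) (trace-distinct v w s≢r) aligned))
        where
        neither : ∀ {X Y : Set} → ¬ X → ¬ Y → X ⊎ Y → ⊥
        neither nx ny (inj₁ x) = nx x
        neither nx ny (inj₂ y) = ny y
        case : Dec (proj₁ (trace v) ⊝ proj₁ (trace u) ∥ R) →
          (¬ proj₁ (trace v) ⊝ proj₁ (trace u) ∥ R → Partner σ R (proj₁ (trace u)) ⊎ Partner σ R (proj₁ (trace v))) →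
          proj₁ (trace v) ⊝ proj₁ (trace u) ∥ R
        case (yes p) _ = p
        case (no n) f = ⊥-elim (neither (trace-unpaired u) (trace-unpaired v) (f n))

    partner′ : Partner π R A₀
    partner′ with off-direction π R A₀∈ A₀π
    ... | B , B∈ , Bπ , B∦ with one-of c A₀∈ B∈ A₀π Bπ B∦
    ... | inj₁ p = p
    -- The exclusions given to `parameter` are padded: `0#` is ruled out anyway, and `t` is repeated
    -- in the next call.
    ... | inj₂ (σ , π≉σ , Bσ , Rσ) with parameter 0# 0#
    ... | t , t≢0 , t∉ , _ with parameter t t
    ... | s , s≢0 , s∉ , s≢t , _ with parameter t s
    ... | r , r≢0 , r∉ , r≢t , r≢s with pairing t t≢0 t∉ | pairing s s≢0 s∉ | pairing r r≢0 r∉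
    ... | inj₁ p | _ | _ = p
    ... | inj₂ _ | inj₁ p | _ = p
    ... | inj₂ _ | inj₂ _ | inj₁ p = p
    ... | inj₂ u | inj₂ v | inj₂ w = ⊥-elim (not-three B∈ Bπ σ π≉σ Bσ Rσ u v w (s≢t ∘ sym) (r≢t ∘ sym) (r≢s ∘ sym))

  abstract
    partner : ∀ {π R} → Center π R → ∀ {A} → A ∈ C → A on π → Partner π R A
    partner = partner′

-- Coordinates adapted to the two classes of blocks through `R`.

module Coordinates {q : ℕ} (F : FField q) (7≤q : 7 ℕ.≤ q)
  (h : Vec (Fin q) 5) (C : List (Vec (Fin q) 5)) (CPlane : Geo.Plane F → Set)
  (hyp : Geo.Config.Hypotheses F h C CPlane) where
  open Counting
  open Parallels F 7≤q h C CPlane hyp public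
  open Center

  1≤q : 1 ℕ.≤ q
  1≤q = ℕₚ.≤-trans (s≤s z≤n) 7≤q

  elements : List (Fin q)
  elements = allFin q

  opaque
    -- A partner at `A` contains the line of `A` and `R`, so `B` on that line would be a second
    -- point of 𝒞 common to it and `π`.
    not-aligned : ∀ {π R A B} → Center π R → A ∈ C → B ∈ C → A on π → B on π → A ≢ B → ¬ B ⊝ A ∥ R
    not-aligned {π} {R} {A} {B} c A∈ B∈ Aπ Bπ A≢B p with partner c A∈ Aπ
    ... | ρ , π≉ρ , Aρ , Rρ = A≢B (meet-unique π ρ π≉ρ A∈ B∈ Aπ Bπ Aρ
            (subst (_on ρ) (⊝-back A B) (span-⊕ Aρ (∥-on ρ p Rρ))))

  -- Modulo `R` the arc of `π` becomes the affine line of the points `A + x u`, each attained once;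
  -- `height` is the coordinate that is lost, and `ruler x` the partner at `base x`.
  record Ruling (π : Block) (A u R : V 5) : Set where
    field
      base : Fin q → V 5
      base∈ : ∀ x → base x ∈ C
      baseπ : ∀ x → base x on π
      height : Fin q → Fin q
      base≡ : ∀ x → base x ≡ A ⊕ (x · u ⊕ height x · R)
      ruler : Fin q → Block
      distinct : ∀ x → ¬ π ≈ ruler x
      base-ruler : ∀ x → base x on ruler x
      R-ruler : ∀ x → R on ruler x

  ruling′ : ∀ {π R A B} → Center π R → A ∈ C → A on π → B ∈ C → B on π → A ≢ B → Ruling π A (B ⊝ A) R
  ruling′ {π} {R} {A} {B} c A∈ Aπ B∈ Bπ A≢B = record
    { base = λ x → proj₁ (at x) ; base∈ = λ x → proj₁ (proj₂ (at x)) ; baseπ = λ x → proj₁ (proj₂ (proj₂ (at x)))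
    ; height = λ x → proj₁ (proj₂ (proj₂ (proj₂ (at x)))) ; base≡ = λ x → proj₂ (proj₂ (proj₂ (proj₂ (at x))))
    ; ruler = λ x → proj₁ (part x) ; distinct = λ x → proj₁ (proj₂ (part x))
    ; base-ruler = λ x → proj₁ (proj₂ (proj₂ (part x))) ; R-ruler = λ x → proj₂ (proj₂ (proj₂ (part x))) }
    where
    u = B ⊝ A
    At : V 5 → Fin q → Set
    At P x = P ⊝ (A ⊕ x · u) ∥ R
    at-eq : ∀ {P x} → At P x → ∃ λ s → P ≡ A ⊕ (x · u ⊕ s · R)
    at-eq {P} {x} p with multiple p
    ... | s , e = s , trans (sym (⊝-back (A ⊕ x · u) P)) (trans (cong (A ⊕ x · u ⊕_) e)
      (vec-identity (#0 ⊞ x ⊡ #1 ⊞ s ⊡ #2) (#0 ⊞ (x ⊡ #1 ⊞ s ⊡ #2))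
        (λ { (a ∷ b ∷ c ∷ []) → solve 5 (λ a b c x s → a :+ x :* b :+ s :* c := a :+ (x :* b :+ s :* c)) refl a b c x s })
        (A ∷ u ∷ R ∷ [])))
    total : ∀ P → P ∈ pts π → ∃ λ x → x ∈ elements × At P x
    total P P∈ with in-frame π (affine A∈) (R-direction c) (⊝-affine (affine A∈) (affine B∈)) (R≢𝟘 c)
                      (not-aligned c A∈ B∈ Aπ Bπ A≢B) Aπ (Rπ c) (on-difference π Aπ Bπ)
                      (affine (proj₁ (pts⁻ π P∈))) (proj₂ (pts⁻ π P∈))
    ... | x , s , e = x , ∈-allFin x , subst (_∥ R) (sym (trans (cong (_⊝ (A ⊕ x · u)) e)
      (vec-identity (#0 ⊞ (x ⊡ #1 ⊞ s ⊡ #2) ⊞ (- 1#) ⊡ (#0 ⊞ x ⊡ #1)) (s ⊡ #2)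
        (λ { (a ∷ b ∷ c ∷ []) → solve 5 (λ a b c x s → a :+ (x :* b :+ s :* c) :+ (:- :1) :* (a :+ x :* b) := s :* c) refl a b c x s })
        (A ∷ u ∷ R ∷ [])))) (∥-multiple s R)
    inj : ∀ {P Q x} → P ∈ pts π → Q ∈ pts π → At P x → At Q x → P ≡ Q
    inj {P} {Q} {x} P∈ Q∈ p p′ with P ≟ᵛ Q
    ... | yes e = e
    ... | no ne = ⊥-elim (not-aligned c (proj₁ (pts⁻ π P∈)) (proj₁ (pts⁻ π Q∈)) (proj₂ (pts⁻ π P∈)) (proj₂ (pts⁻ π Q∈)) ne
      (subst (_∥ R) (vec-identity ((#1 ⊞ (- 1#) ⊡ #2) ⊞ (- 1#) ⊡ (#0 ⊞ (- 1#) ⊡ #2)) (#1 ⊞ (- 1#) ⊡ #0)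
        (λ { (a ∷ b ∷ c ∷ []) → solve 3 (λ a b c → b :+ (:- :1) :* c :+ (:- :1) :* (a :+ (:- :1) :* c) := b :+ (:- :1) :* a) refl a b c })
        (P ∷ Q ∷ (A ⊕ x · u) ∷ [])) (span-⊝ p′ p)))
    at : ∀ x → ∃ λ P → P ∈ C × P on π × ∃ λ s → P ≡ A ⊕ (x · u ⊕ s · R)
    at x =
      let P , P∈ , p = surjective _≟ᶠ_ (pts-unique π) (ℕₚ.≤-reflexive (trans (allFin-length q) (sym (pts-length π)))) At
                         (λ P x → span? (R ∷ []) _) total inj x (∈-allFin x)
      in P , proj₁ (pts⁻ π P∈) , proj₂ (pts⁻ π P∈) , at-eq {P} {x} p
    part : ∀ x → Partner π R (proj₁ (at x))
    part x = partner c (proj₁ (proj₂ (at x))) (proj₁ (proj₂ (proj₂ (at x))))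

  abstract
    ruling : ∀ {π R A B} → Center π R → A ∈ C → A on π → B ∈ C → B on π → A ≢ B → Ruling π A (B ⊝ A) R
    ruling = ruling′

  -- Projecting from R maps 𝒞 onto the hyperbolic paraboloid of the points (x , y , x y); f is the remaining coordinate.
  record StandardForm (A : V 5) : Set where
    field
      w v u R : V 5
    basis : Vec (V 5) 5
    basis = w ∷ A ∷ v ∷ u ∷ R ∷ []
    field
      independent : Independent basis
      w-direction : Direction w
      v-direction : Direction v
      u-direction : Direction u
      R-direction′ : Direction R
      f : Fin q → Fin q → Fin q
    N : Fin q → Fin q → V 5
    N x y = comb basis (x * y ∷ 1# ∷ y ∷ x ∷ f x y ∷ [])
    field
      N∈ : ∀ x y → N x y ∈ C
      N-all : ∀ {D} → D ∈ C → ∃₂ λ x y → D ≡ N x y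
      column row : Fin q → Block
      R-column : ∀ x → R on column x
      R-row : ∀ y → R on row y
      N-column : ∀ x y → N x y on column x
      N-row : ∀ x y → N x y on row y
      column-only : ∀ {x x′ y} → N x′ y on column x → x′ ≡ x
      row-only : ∀ {x y y′} → N x y′ on row y → y′ ≡ y

  -- The blocks through R form two parallel classes, hence a regulus with its opposite in the quotient by R.
  module Net {A : V 5} (A∈ : A ∈ C) {π σ : Block} {R : V 5} (cπ : Center π R) (cσ : Center σ R) (π≉σ : ¬ π ≈ σ)
    (Aπ : A on π) (Aσ : A on σ) {B₁ E₁ : V 5} (B₁∈ : B₁ ∈ C) (E₁∈ : E₁ ∈ C) (B₁π : B₁ on π) (E₁σ : E₁ on σ)
    (A≢B₁ : A ≢ B₁) (A≢E₁ : A ≢ E₁) where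

    open Ruling (ruling cπ A∈ Aπ B₁∈ B₁π A≢B₁) renaming
      (base to B; base∈ to B∈; baseπ to Bπ; height to Bh; base≡ to B≡; ruler to σ₍_₎; distinct to π≉σ₍_₎; base-ruler to Bσ; R-ruler to Rσ₍_₎)
    open Ruling (ruling cσ A∈ Aσ E₁∈ E₁σ A≢E₁) renaming
      (base to E; base∈ to E∈; baseπ to Eσ; height to Eh; base≡ to E≡; ruler to π₍_₎; distinct to σ≉π₍_₎; base-ruler to Eπ; R-ruler to Rπ₍_₎)

    u v : V 5
    u = B₁ ⊝ A
    v = E₁ ⊝ A

    u∦R : ¬ u ∥ R
    u∦R = not-aligned cπ A∈ B₁∈ Aπ B₁π A≢B₁

    v∦R : ¬ v ∥ R
    v∦R = not-aligned cσ A∈ E₁∈ Aσ E₁σ A≢E₁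

    level : ∀ {d x x′ s s′} → ¬ d ∥ R → A ⊕ (x · d ⊕ s · R) ≡ A ⊕ (x′ · d ⊕ s′ · R) → x ≡ x′
    level {d} {x} {x′} {s} {s′} d∦R e with (x - x′) ≟ᶠ 0#
    ... | yes z = diff⇒≡ z
    ... | no nz = ⊥-elim (d∦R (span-·-cancel nz (subst (_∥ R) (sym eq) (∥-multiple (s′ - s) R))))
      where
      eq : (x - x′) · d ≡ (s′ - s) · R
      eq = trans
        (vec-identity ((x - x′) ⊡ #1) ((#0 ⊞ (x ⊡ #1 ⊞ s ⊡ #2)) ⊞ (- 1#) ⊡ (#0 ⊞ (x′ ⊡ #1 ⊞ s ⊡ #2)))
          (λ { (a ∷ d ∷ r ∷ []) → solve 6 (λ a d r x x′ s → (x :- x′) :* d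
              := (a :+ (x :* d :+ s :* r)) :+ (:- :1) :* (a :+ (x′ :* d :+ s :* r))) refl a d r x x′ s }) (A ∷ d ∷ R ∷ []))
        (trans (cong (_⊝ (A ⊕ (x′ · d ⊕ s · R))) e)
          (vec-identity ((#0 ⊞ (x′ ⊡ #1 ⊞ s′ ⊡ #2)) ⊞ (- 1#) ⊡ (#0 ⊞ (x′ ⊡ #1 ⊞ s ⊡ #2))) ((s′ - s) ⊡ #2)
            (λ { (a ∷ d ∷ r ∷ []) → solve 6 (λ a d r x′ s s′ → (a :+ (x′ :* d :+ s′ :* r)) :+ (:- :1) :* (a :+ (x′ :* d :+ s :* r))
                := (s′ :- s) :* r) refl a d r x′ s s′ }) (A ∷ d ∷ R ∷ [])))

    A≡ : ∀ d → A ≡ A ⊕ (0# · d ⊕ 0# · R)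
    A≡ d = vec-identity #0 (#0 ⊞ (0# ⊡ #1 ⊞ 0# ⊡ #2))
      (λ { (a ∷ d ∷ r ∷ []) → solve 3 (λ a d r → a := a :+ (:0 :* d :+ :0 :* r)) refl a d r }) (A ∷ d ∷ R ∷ [])

    A≢B : ∀ {x} → x ≢ 0# → A ≢ B x
    A≢B {x} x≢0 e = x≢0 (sym (level {s = 0#} {s′ = Bh x} u∦R (trans (sym (A≡ u)) (trans e (B≡ x)))))

    A≢E : ∀ {y} → y ≢ 0# → A ≢ E y
    A≢E {y} y≢0 e = y≢0 (sym (level {s = 0#} {s′ = Eh y} v∦R (trans (sym (A≡ v)) (trans e (E≡ y)))))

    B-injective : ∀ {x x′} → x ≢ x′ → B x ≢ B x′
    B-injective {x} {x′} ne e = ne (level {s = Bh x} {s′ = Bh x′} u∦R (trans (sym (B≡ x)) (trans e (B≡ x′))))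

    E-injective : ∀ {y y′} → y ≢ y′ → E y ≢ E y′
    E-injective {y} {y′} ne e = ne (level {s = Eh y} {s′ = Eh y′} v∦R (trans (sym (E≡ y)) (trans e (E≡ y′))))

    σ-parallel : ∀ {x} → x ≢ 0# → ∀ {Q} → Affine Q → Q on σ → Q on σ₍ x ₎ → ⊥
    σ-parallel {x} x≢0 = no-common-point σ π σ₍ x ₎ (distinct-sym π σ π≉σ) π≉σ₍ x ₎ A∈ Aσ Aπ (B∈ x) (Bπ x) (Bσ x)
      (A≢B x≢0) (R≢𝟘 cπ) (R-direction cπ) (Rπ cσ) (Rπ cπ) Rσ₍ x ₎

    σ-parallel₂ : ∀ {x x′} → x ≢ x′ → ∀ {Q} → Affine Q → Q on σ₍ x ₎ → Q on σ₍ x′ ₎ → ⊥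
    σ-parallel₂ {x} {x′} ne = no-common-point σ₍ x ₎ π σ₍ x′ ₎ (distinct-sym π σ₍ x ₎ π≉σ₍ x ₎) π≉σ₍ x′ ₎ (B∈ x) (Bσ x) (Bπ x)
      (B∈ x′) (Bπ x′) (Bσ x′) (B-injective ne) (R≢𝟘 cπ) (R-direction cπ) Rσ₍ x ₎ (Rπ cπ) Rσ₍ x′ ₎

    π-parallel₂ : ∀ {y y′} → y ≢ y′ → ∀ {Q} → Affine Q → Q on π₍ y ₎ → Q on π₍ y′ ₎ → ⊥
    π-parallel₂ {y} {y′} ne = no-common-point π₍ y ₎ σ π₍ y′ ₎ (distinct-sym σ π₍ y ₎ σ≉π₍ y ₎) σ≉π₍ y′ ₎ (E∈ y) (Eπ y) (Eσ y)
      (E∈ y′) (Eσ y′) (Eπ y′) (E-injective ne) (R≢𝟘 cπ) (R-direction cπ) Rπ₍ y ₎ (Rπ cσ) Rπ₍ y′ ₎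

    π-parallel : ∀ {y} → A ≢ E y → ∀ {Q} → Affine Q → Q on π → Q on π₍ y ₎ → ⊥
    π-parallel {y} ne = no-common-point π σ π₍ y ₎ π≉σ σ≉π₍ y ₎ A∈ Aπ Aσ (E∈ y) (Eσ y) (Eπ y)
      ne (R≢𝟘 cπ) (R-direction cπ) (Rπ cπ) (Rπ cσ) Rπ₍ y ₎

    opaque
      crossing-point : ∀ x y → Meet σ₍ x ₎ π₍ y ₎
      crossing-point x y with A ≟ᵛ E y
      ... | no A≢Ey = meets-one σ₍ x ₎ π π₍ y ₎ (B∈ x) (Bσ x) (Bπ x) (distinct-sym π σ₍ x ₎ π≉σ₍ x ₎)
              (λ (Q , Q∈ , Qπ , Qπy) → π-parallel {y} A≢Ey (affine Q∈) Qπ Qπy)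
      -- This is the row through `A`: (A3) at a point of the line of `A` and `R` identifies its
      -- block with `π`.
      ... | yes A≡Ey = B x , B∈ x , Bσ x , ≈-on π π₍ y ₎ π≈ (Bπ x)
        where
        X : V 5
        X = A ⊕ 1# · R
        Aπy : A on π₍ y ₎
        Aπy = subst (_on π₍ y ₎) (sym A≡Ey) (Eπ y)
        X∉ : X ∉ C
        X∉ X∈ = shift-distinct 1≢0 (R≢𝟘 cπ) (meet-unique π σ π≉σ A∈ X∈ Aπ (on-shift π 1# Aπ (Rπ cπ)) Aσ (on-shift σ 1# Aσ (Rπ cσ)))
        π≈ : π ≈ π₍ y ₎
        π≈ with at-most-two π σ π₍ y ₎ (shift-affine 1# (affine A∈) (R-direction cπ)) X∉ (on-shift π 1# Aπ (Rπ cπ))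
                  (on-shift σ 1# Aσ (Rπ cσ)) (on-shift π₍ y ₎ 1# Aπy Rπ₍ y ₎)
        ... | inj₁ e = ⊥-elim (π≉σ e)
        ... | inj₂ (inj₁ e) = e
        ... | inj₂ (inj₂ e) = ⊥-elim (σ≉π₍ y ₎ e)

    D : Fin q → Fin q → V 5
    D x y = proj₁ (crossing-point x y)

    D∈ : ∀ x y → D x y ∈ C
    D∈ x y = proj₁ (proj₂ (crossing-point x y))

    Dσ : ∀ x y → D x y on σ₍ x ₎
    Dσ x y = proj₁ (proj₂ (proj₂ (crossing-point x y)))

    Dπ : ∀ x y → D x y on π₍ y ₎
    Dπ x y = proj₂ (proj₂ (proj₂ (crossing-point x y)))

    -- Chosen to give `D 1# 1#` the coordinates `(1, 1, 1, 1, 0)`, which normalises the first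
    -- coordinate to the product of the others.
    w : V 5
    w = D 1# 1# ⊝ (A ⊕ (u ⊕ v))

    b : Vec (V 5) 5
    b = w ∷ A ∷ v ∷ u ∷ R ∷ []

    u-direction : Direction u
    u-direction = ⊝-affine (affine A∈) (affine B₁∈)

    v-direction : Direction v
    v-direction = ⊝-affine (affine A∈) (affine E₁∈)

    A+u+v-affine : Affine (A ⊕ (u ⊕ v))
    A+u+v-affine = trans (dot-⊕ h A (u ⊕ v)) (trans (cong₂ _+_ (affine A∈)
      (trans (dot-⊕ h u v) (cong₂ _+_ u-direction v-direction))) (solve 0 (:1 :+ (:0 :+ :0) := :1) refl))

    w-direction : Direction w
    w-direction = ⊝-affine A+u+v-affine (affine (D∈ 1# 1#))

    B-coordinates : ∀ x → B x ≡ comb b (0# ∷ 1# ∷ 0# ∷ x ∷ Bh x ∷ [])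
    B-coordinates x = trans (B≡ x) (vec-identity (#1 ⊞ (x ⊡ #3 ⊞ Bh x ⊡ #4))
      (0# ⊡ #0 ⊞ (1# ⊡ #1 ⊞ (0# ⊡ #2 ⊞ (x ⊡ #3 ⊞ (Bh x ⊡ #4 ⊞ ∅)))))
      (λ { (w ∷ a ∷ v ∷ u ∷ r ∷ []) → solve 7 (λ w a v u r x s → a :+ (x :* u :+ s :* r)
          := :0 :* w :+ (:1 :* a :+ (:0 :* v :+ (x :* u :+ (s :* r :+ :0))))) refl w a v u r x (Bh x) }) b)

    E-coordinates : ∀ y → E y ≡ comb b (0# ∷ 1# ∷ y ∷ 0# ∷ Eh y ∷ [])
    E-coordinates y = trans (E≡ y) (vec-identity (#1 ⊞ (y ⊡ #2 ⊞ Eh y ⊡ #4))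
      (0# ⊡ #0 ⊞ (1# ⊡ #1 ⊞ (y ⊡ #2 ⊞ (0# ⊡ #3 ⊞ (Eh y ⊡ #4 ⊞ ∅)))))
      (λ { (w ∷ a ∷ v ∷ u ∷ r ∷ []) → solve 7 (λ w a v u r y s → a :+ (y :* v :+ s :* r)
          := :0 :* w :+ (:1 :* a :+ (y :* v :+ (:0 :* u :+ (s :* r :+ :0))))) refl w a v u r y (Eh y) }) b)

    D₁₁-coordinates : D 1# 1# ≡ comb b (1# ∷ 1# ∷ 1# ∷ 1# ∷ 0# ∷ [])
    D₁₁-coordinates = trans (sym (⊝-back (A ⊕ (u ⊕ v)) (D 1# 1#)))
      (vec-identity ((#1 ⊞ (#3 ⊞ #2)) ⊞ #0) (1# ⊡ #0 ⊞ (1# ⊡ #1 ⊞ (1# ⊡ #2 ⊞ (1# ⊡ #3 ⊞ (0# ⊡ #4 ⊞ ∅)))))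
        (λ { (w ∷ a ∷ v ∷ u ∷ r ∷ []) → solve 5 (λ w a v u r → (a :+ (u :+ v)) :+ w
            := :1 :* w :+ (:1 :* a :+ (:1 :* v :+ (:1 :* u :+ (:0 :* r :+ :0))))) refl w a v u r }) b)

    R-coordinates : R ≡ comb b (0# ∷ 0# ∷ 0# ∷ 0# ∷ 1# ∷ [])
    R-coordinates = vec-identity #4 (0# ⊡ #0 ⊞ (0# ⊡ #1 ⊞ (0# ⊡ #2 ⊞ (0# ⊡ #3 ⊞ (1# ⊡ #4 ⊞ ∅)))))
      (λ { (w ∷ a ∷ v ∷ u ∷ r ∷ []) → solve 5 (λ w a v u r → r
          := :0 :* w :+ (:0 :* a :+ (:0 :* v :+ (:0 :* u :+ (:1 :* r :+ :0))))) refl w a v u r }) b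

    back : ∀ τ {P Q} → P on τ → R on τ → Q ⊝ P ∥ R → Q on τ
    back τ {P} {Q} Pτ Rτ p = subst (_on τ) (⊝-back P Q) (span-⊕ Pτ (∥-on τ p Rτ))

    D∦B : ∀ x → ¬ D x 1# ⊝ B x ∥ R
    D∦B x p = π-parallel {1#} (A≢E 1≢0) (affine (D∈ x 1#)) (back π (Bπ x) (Rπ cπ) p) (Dπ x 1#)

    D∦E : ∀ y → ¬ D 1# y ⊝ E y ∥ R
    D∦E y p = σ-parallel 1≢0 (affine (D∈ 1# y)) (back σ (Eσ y) (Rπ cσ) p) (Dσ 1# y)

    four : Vec (V 5) 4
    four = A ∷ v ∷ u ∷ R ∷ []

    four-independent : Independent four
    four-independent = independent-∷ (independent-∷ (independent-∷ (independent-∷ (λ { [] _ → refl })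
        (λ { ([] , e) → R≢𝟘 cπ e })) u∦R) v∉) (λ A∈′ → 1≢0 (trans (sym (affine A∈))
          (kills-span h (v-direction ∷ u-direction ∷ R-direction cπ ∷ []) A∈′)))
      where
      v∉ : ¬ InSpan (u ∷ R ∷ []) v
      v∉ p = A≢E₁ (meet-unique π σ π≉σ A∈ E₁∈ Aπ (subst (_on π) (⊝-back A E₁)
        (span-⊕ Aπ (span-trans (on-difference π Aπ B₁π ∷ Rπ cπ ∷ []) p))) Aσ E₁σ)

    -- The regulus is not flat: otherwise `π`, `σ` and the column at `1#` would all lie in the span
    -- of `A`, `v`, `u`, `R`.
    w∉four : ¬ InSpan four w
    w∉four w∈ = no-three π σ σ₍ 1# ₎ π≉σ π≉σ₍ 1# ₎
        (λ e → A≢B 1≢0 (meet-unique π σ π≉σ A∈ (B∈ 1#) Aπ (Bπ 1#) Aσ (≈-on σ₍ 1# ₎ σ (≈-sym σ σ₍ 1# ₎ e) (Bσ 1#))))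
        (inside-frame π (affine A∈) (R-direction cπ) u-direction (R≢𝟘 cπ) u∦R Aπ (Rπ cπ) (on-difference π Aπ B₁π) A∈g R∈g u∈g)
        (inside-frame σ (affine A∈) (R-direction cπ) v-direction (R≢𝟘 cπ) v∦R Aσ (Rπ cσ) (on-difference σ Aσ E₁σ) A∈g R∈g v∈g)
        (inside-frame σ₍ 1# ₎ (affine (B∈ 1#)) (R-direction cπ) (⊝-affine (affine (B∈ 1#)) (affine (D∈ 1# 1#))) (R≢𝟘 cπ) (D∦B 1#)
          (Bσ 1#) Rσ₍ 1# ₎ (on-difference σ₍ 1# ₎ (Bσ 1#) (Dσ 1# 1#)) B∈g R∈g (span-⊝ D∈g B∈g))
      where
      open Hyperplane four
      A∈g : InSpan four A
      A∈g = span-here _ A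
      v∈g : InSpan four v
      v∈g = span-there A (span-here _ v)
      u∈g : InSpan four u
      u∈g = span-there A (span-there v (span-here _ u))
      R∈g : InSpan four R
      R∈g = span-there A (span-there v (span-there u (span-here _ R)))
      B∈g : InSpan four (B 1#)
      B∈g = subst (InSpan four) (sym (B≡ 1#)) (span-⊕ A∈g (span-⊕ (span-· 1# u∈g) (span-· (Bh 1#) R∈g)))
      D∈g : InSpan four (D 1# 1#)
      D∈g = subst (InSpan four) (⊝-back (A ⊕ (u ⊕ v)) (D 1# 1#)) (span-⊕ (span-⊕ A∈g (span-⊕ u∈g v∈g)) w∈)

    independent : Independent b
    independent = independent-∷ four-independent w∉four

    in-coordinates : ∀ {P Q k c} (ps qs : V 5) → P ≡ comb b ps → Q ≡ comb b qs → ∀ {X} → X ≡ P ⊕ (k · (Q ⊝ P) ⊕ c · R) →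
      X ≡ comb b (ps ⊕ (k · (qs ⊝ ps) ⊕ c · (0# ∷ 0# ∷ 0# ∷ 0# ∷ 1# ∷ [])))
    in-coordinates {k = k} {c} ps qs refl refl e = trans e (trans (cong (λ r → comb b ps ⊕ (k · (comb b qs ⊝ comb b ps) ⊕ c · r)) R-coordinates)
      (sym (comb-vec b (#0 ⊞ (k ⊡ (#1 ⊞ (- 1#) ⊡ #0) ⊞ c ⊡ #2)) (ps ∷ qs ∷ (0# ∷ 0# ∷ 0# ∷ 0# ∷ 1# ∷ []) ∷ []))))

    simplify : ∀ {c₀ c₁ c₂ c₃ c₄ d₀ d₁ d₂ d₃} → c₀ ≡ d₀ → c₁ ≡ d₁ → c₂ ≡ d₂ → c₃ ≡ d₃ →
      comb b (c₀ ∷ c₁ ∷ c₂ ∷ c₃ ∷ c₄ ∷ []) ≡ comb b (d₀ ∷ d₁ ∷ d₂ ∷ d₃ ∷ c₄ ∷ [])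
    simplify refl refl refl refl = refl

    expand : ∀ p₀ p₁ p₂ p₃ p₄ q₀ q₁ q₂ q₃ q₄ {P Q k c X} → P ≡ comb b (p₀ ∷ p₁ ∷ p₂ ∷ p₃ ∷ p₄ ∷ []) →
      Q ≡ comb b (q₀ ∷ q₁ ∷ q₂ ∷ q₃ ∷ q₄ ∷ []) → X ≡ P ⊕ (k · (Q ⊝ P) ⊕ c · R) → ∃ λ r →
      X ≡ comb b ((p₀ + k * (q₀ - p₀)) ∷ (p₁ + k * (q₁ - p₁)) ∷ (p₂ + k * (q₂ - p₂)) ∷ (p₃ + k * (q₃ - p₃)) ∷ r ∷ [])
    expand p₀ p₁ p₂ p₃ p₄ q₀ q₁ q₂ q₃ q₄ {k = k} {c} eP eQ eX = _ ,
      trans (in-coordinates {k = k} {c} (p₀ ∷ p₁ ∷ p₂ ∷ p₃ ∷ p₄ ∷ []) (q₀ ∷ q₁ ∷ q₂ ∷ q₃ ∷ q₄ ∷ []) eP eQ eX)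
        (simplify (tidy p₀ q₀) (tidy p₁ q₁) (tidy p₂ q₂) (tidy p₃ q₃))
      where
      tidy : ∀ p q → p + (k * (q + (- 1#) * p) + c * 0#) ≡ p + k * (q - p)
      tidy p q = solve 4 (λ p q k c → p :+ (k :* (q :+ (:- :1) :* p) :+ c :* :0) := p :+ k :* (q :- p)) refl p q k c

    -- The coordinates along `w` and `u` agree at `E 1#` and at `D 1# 1#`, hence on the whole row;
    -- their common value `μ x` describes how the columns carry the row through `A` to the row at
    -- `1#`.
    row′ : ∀ x → ∃₂ λ μ r → D x 1# ≡ comb b (μ ∷ 1# ∷ 1# ∷ μ ∷ r ∷ [])
    row′ x =
      let μ , c , e = in-frame π₍ 1# ₎ (affine (E∈ 1#)) (R-direction cπ) (⊝-affine (affine (E∈ 1#)) (affine (D∈ 1# 1#))) (R≢𝟘 cπ) (D∦E 1#)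
                 (Eπ 1#) Rπ₍ 1# ₎ (on-difference π₍ 1# ₎ (Eπ 1#) (Dπ 1# 1#)) (affine (D∈ x 1#)) (Dπ x 1#)
          r , e′ = expand _ _ _ _ _ _ _ _ _ _ (E-coordinates 1#) D₁₁-coordinates e
      in μ , r , trans e′ (simplify
        (solve 1 (λ m → :0 :+ m :* (:1 :- :0) := m) refl μ) (solve 1 (λ m → :1 :+ m :* (:1 :- :1) := :1) refl μ)
        (solve 1 (λ m → :1 :+ m :* (:1 :- :1) := :1) refl μ) (solve 1 (λ m → :0 :+ m :* (:1 :- :0) := m) refl μ))

    abstract
      row : ∀ x → ∃₂ λ μ r → D x 1# ≡ comb b (μ ∷ 1# ∷ 1# ∷ μ ∷ r ∷ [])
      row = row′

    column′ : ∀ y → ∃₂ λ ν r → D 1# y ≡ comb b (ν ∷ 1# ∷ ν ∷ 1# ∷ r ∷ [])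
    column′ y =
      let ν , c , e = in-frame σ₍ 1# ₎ (affine (B∈ 1#)) (R-direction cπ) (⊝-affine (affine (B∈ 1#)) (affine (D∈ 1# 1#))) (R≢𝟘 cπ) (D∦B 1#)
                    (Bσ 1#) Rσ₍ 1# ₎ (on-difference σ₍ 1# ₎ (Bσ 1#) (Dσ 1# 1#)) (affine (D∈ 1# y)) (Dσ 1# y)
          r , e′ = expand _ _ _ _ _ _ _ _ _ _ (B-coordinates 1#) D₁₁-coordinates e
      in ν , r , trans e′ (simplify
        (solve 1 (λ m → :0 :+ m :* (:1 :- :0) := m) refl ν) (solve 1 (λ m → :1 :+ m :* (:1 :- :1) := :1) refl ν)
        (solve 1 (λ m → :0 :+ m :* (:1 :- :0) := m) refl ν) (solve 1 (λ m → :1 :+ m :* (:1 :- :1) := :1) refl ν))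

    abstract
      column : ∀ y → ∃₂ λ ν r → D 1# y ≡ comb b (ν ∷ 1# ∷ ν ∷ 1# ∷ r ∷ [])
      column = column′

    μ ν : Fin q → Fin q
    μ x = proj₁ (row x)
    ν y = proj₁ (column y)

    D-row : ∀ x → ∃ λ r → D x 1# ≡ comb b (μ x ∷ 1# ∷ 1# ∷ μ x ∷ r ∷ [])
    D-row x = proj₂ (row x)

    D-column : ∀ y → ∃ λ r → D 1# y ≡ comb b (ν y ∷ 1# ∷ ν y ∷ 1# ∷ r ∷ [])
    D-column y = proj₂ (column y)

    -- The point is written once along its column, from `B x` towards `D x 1#` with parameter `s`,
    -- and once along its row, from `E y` towards `D 1# y` with parameter `t`; comparing coordinates
    -- gives the three equations.
    entry′ : ∀ x y → ∃₂ λ s t → ∃ λ r → D x y ≡ comb b (s * μ x ∷ 1# ∷ s ∷ (x + s * (μ x - x)) ∷ r ∷ [])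
      × s * μ x ≡ t * ν y × s ≡ y + t * (ν y - y) × x + s * (μ x - x) ≡ t
    entry′ x y = s , t , r , first , cong (λ z → lookup z zero) same-coordinates
        , cong (λ z → lookup z (suc (suc zero))) same-coordinates , cong (λ z → lookup z (suc (suc (suc zero)))) same-coordinates
      where
      alongσ = in-frame σ₍ x ₎ (affine (B∈ x)) (R-direction cπ) (⊝-affine (affine (B∈ x)) (affine (D∈ x 1#))) (R≢𝟘 cπ) (D∦B x)
                 (Bσ x) Rσ₍ x ₎ (on-difference σ₍ x ₎ (Bσ x) (Dσ x 1#)) (affine (D∈ x y)) (Dσ x y)
      alongπ = in-frame π₍ y ₎ (affine (E∈ y)) (R-direction cπ) (⊝-affine (affine (E∈ y)) (affine (D∈ 1# y))) (R≢𝟘 cπ) (D∦E y)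
                 (Eπ y) Rπ₍ y ₎ (on-difference π₍ y ₎ (Eπ y) (Dπ 1# y)) (affine (D∈ x y)) (Dπ x y)
      s = proj₁ alongσ
      t = proj₁ alongπ
      eσ = expand _ _ _ _ _ _ _ _ _ _ (B-coordinates x) (proj₂ (D-row x)) (proj₂ (proj₂ alongσ))
      eπ = expand _ _ _ _ _ _ _ _ _ _ (E-coordinates y) (proj₂ (D-column y)) (proj₂ (proj₂ alongπ))
      r = proj₁ eσ
      r′ = proj₁ eπ
      first : D x y ≡ comb b (s * μ x ∷ 1# ∷ s ∷ (x + s * (μ x - x)) ∷ r ∷ [])
      first = trans (proj₂ eσ) (simplify
        (solve 2 (λ s m → :0 :+ s :* (m :- :0) := s :* m) refl s (μ x)) (solve 1 (λ s → :1 :+ s :* (:1 :- :1) := :1) refl s)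
        (solve 1 (λ s → :0 :+ s :* (:1 :- :0) := s) refl s) refl)
      second : D x y ≡ comb b (t * ν y ∷ 1# ∷ (y + t * (ν y - y)) ∷ t ∷ r′ ∷ [])
      second = trans (proj₂ eπ) (simplify
        (solve 2 (λ s m → :0 :+ s :* (m :- :0) := s :* m) refl t (ν y)) (solve 1 (λ s → :1 :+ s :* (:1 :- :1) := :1) refl t)
        refl (solve 1 (λ s → :0 :+ s :* (:1 :- :0) := s) refl t))
      same-coordinates : s * μ x ∷ 1# ∷ s ∷ (x + s * (μ x - x)) ∷ r ∷ [] ≡ t * ν y ∷ 1# ∷ (y + t * (ν y - y)) ∷ t ∷ r′ ∷ []
      same-coordinates = comb-injective independent (trans (sym first) second)

    abstract
      entry : ∀ x y → ∃₂ λ s t → ∃ λ r → D x y ≡ comb b (s * μ x ∷ 1# ∷ s ∷ (x + s * (μ x - x)) ∷ r ∷ [])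
        × s * μ x ≡ t * ν y × s ≡ y + t * (ν y - y) × x + s * (μ x - x) ≡ t
      entry = entry′

    -- s and t are eliminated from the three equations of entry.
    transversality : ∀ x y → ν y * (x * (μ x - 1#) - y * (μ x - x)) ≡ μ x * (y * (x - 1#))
    transversality x y = let s , t , _ , _ , e₁ , e₂ , e₃ = entry x y in diff⇒≡ (trans
        (solve 6 (λ x y s t m n →
            n :* (x :* (m :- :1) :- y :* (m :- x)) :- m :* (y :* (x :- :1))
            := (:1 :- (m :- x) :* (n :- y)) :* (s :* m :- t :* n)
               :- m :* ((s :- (y :+ t :* (n :- y))) :+ (n :- y) :* (:- (x :+ s :* (m :- x) :- t)))
               :+ n :* ((:- (x :+ s :* (m :- x) :- t)) :+ (m :- x) :* (s :- (y :+ t :* (n :- y)))))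
          refl x y s t (μ x) (ν y))
        (trans (substitute (≡⇒diff e₁) (≡⇒diff e₂) (≡⇒diff e₃))
          (solve 4 (λ x y m n → (:1 :- (m :- x) :* (n :- y)) :* :0 :- m :* (:0 :+ (n :- y) :* (:- :0))
             :+ n :* ((:- :0) :+ (m :- x) :* :0) := :0) refl x y (μ x) (ν y))))
      where
      substitute : ∀ {a b c} → a ≡ 0# → b ≡ 0# → c ≡ 0# →
        (1# - (μ x - x) * (ν y - y)) * a - μ x * (b + (ν y - y) * (- c)) + ν y * ((- c) + (μ x - x) * b)
        ≡ (1# - (μ x - x) * (ν y - y)) * 0# - μ x * (0# + (ν y - y) * (- 0#)) + ν y * ((- 0#) + (μ x - x) * 0#)
      substitute refl refl refl = refl

    generic : ∃ λ x → x ≢ 0# × x ≢ 1#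
    generic = let x , x∉ = element-off 7≤q (0# ∷ 1# ∷ []) (s≤s (s≤s z≤n))
              in x , (λ e → x∉ (here e)) , (λ e → x∉ (there (here e)))

    module _ {x₀} (x₀≢0 : x₀ ≢ 0#) (x₀≢1 : x₀ ≢ 1#) where

      -- Modulo `R` the point `D x₀ 1#` would be `A + v`, a point of `σ`, although distinct columns
      -- have no affine point in common.
      μ≢0 : μ x₀ ≢ 0#
      μ≢0 e = σ-parallel x₀≢0 (affine (D∈ x₀ 1#)) (subst (_on σ) (sym eq)
          (span-⊕ (span-⊕ Aσ (on-difference σ Aσ E₁σ)) (span-· _ (Rπ cσ)))) (Dσ x₀ 1#)
        where
        r = proj₁ (D-row x₀)
        eq : D x₀ 1# ≡ A ⊕ v ⊕ r · R
        eq = trans (proj₂ (D-row x₀)) (trans (simplify e refl refl e)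
          (vec-identity (0# ⊡ #0 ⊞ (1# ⊡ #1 ⊞ (1# ⊡ #2 ⊞ (0# ⊡ #3 ⊞ (r ⊡ #4 ⊞ ∅))))) (#1 ⊞ #2 ⊞ r ⊡ #4)
            (λ { (w ∷ a ∷ v ∷ u ∷ R ∷ []) → solve 6 (λ w a v u R r →
              :0 :* w :+ (:1 :* a :+ (:1 :* v :+ (:0 :* u :+ (r :* R :+ :0)))) := a :+ v :+ r :* R) refl w a v u R r }) b))

      μ≢1 : μ x₀ ≢ 1#
      μ≢1 e = σ-parallel₂ x₀≢1 (affine (D∈ x₀ 1#)) (Dσ x₀ 1#) (subst (_on σ₍ 1# ₎) (sym eq)
          (span-⊕ (Dσ 1# 1#) (span-· r Rσ₍ 1# ₎)))
        where
        r = proj₁ (D-row x₀)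
        eq : D x₀ 1# ≡ D 1# 1# ⊕ r · R
        eq = trans (proj₂ (D-row x₀)) (trans (simplify e refl refl e)
          (trans (vec-identity (1# ⊡ #0 ⊞ (1# ⊡ #1 ⊞ (1# ⊡ #2 ⊞ (1# ⊡ #3 ⊞ (r ⊡ #4 ⊞ ∅)))))
              ((1# ⊡ #0 ⊞ (1# ⊡ #1 ⊞ (1# ⊡ #2 ⊞ (1# ⊡ #3 ⊞ (0# ⊡ #4 ⊞ ∅))))) ⊞ r ⊡ #4)
            (λ { (w ∷ a ∷ v ∷ u ∷ R ∷ []) → solve 6 (λ w a v u R r →
              :1 :* w :+ (:1 :* a :+ (:1 :* v :+ (:1 :* u :+ (r :* R :+ :0))))
              := :1 :* w :+ (:1 :* a :+ (:1 :* v :+ (:1 :* u :+ (:0 :* R :+ :0)))) :+ r :* R) refl w a v u R r }) b)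
            (cong (_⊕ r · R) (sym D₁₁-coordinates))))

      -- Otherwise the fractional-linear function ν would have a pole.
      μ-fixed : μ x₀ ≡ x₀
      μ-fixed with μ x₀ ≟ᶠ x₀
      ... | yes e = e
      ... | no ne = ⊥-elim (*-≢0 x₀≢0 (diff≢0 μ≢1) x₀[μ-1]≡0)
        where
        i = proj₁ (inverse (μ x₀ - x₀) (diff≢0 ne))
        ii : (μ x₀ - x₀) * i ≡ 1#
        ii = proj₂ (inverse (μ x₀ - x₀) (diff≢0 ne))
        -- At this zero of the factor multiplying `ν y` in `transversality` the right side must
        -- vanish too, which forces `y` to be `0#`; but the numerator of `y` is nonzero.
        y = x₀ * (μ x₀ - 1#) * i
        pole : x₀ * (μ x₀ - 1#) - y * (μ x₀ - x₀) ≡ 0#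
        pole = trans (solve 3 (λ a d i → a :- a :* i :* d := a :* (:1 :- d :* i)) refl (x₀ * (μ x₀ - 1#)) (μ x₀ - x₀) i)
          (trans (cong (x₀ * (μ x₀ - 1#) *_) (≡⇒diff (sym ii))) (zeroʳ _))
        y≡0 : y ≡ 0#
        y≡0 = cancelˡ (diff≢0 x₀≢1) (trans (*-comm _ _) (cancelˡ μ≢0
          (trans (sym (transversality x₀ y)) (trans (cong (ν y *_) pole) (zeroʳ _)))))
        x₀[μ-1]≡0 : x₀ * (μ x₀ - 1#) ≡ 0#
        x₀[μ-1]≡0 = trans (solve 2 (λ a b → a := a :- :0 :* b) refl (x₀ * (μ x₀ - 1#)) (μ x₀ - x₀))
          (trans (cong (λ z → x₀ * (μ x₀ - 1#) - z * (μ x₀ - x₀)) (sym y≡0)) pole)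

      -- Once `μ x₀ ≡ x₀`, this one column determines `ν` through `transversality`; the row at `x₀`
      -- determines `μ` in turn.
      ν-identity : ∀ y → ν y ≡ y
      ν-identity y = cancelˡ-≡ (*-≢0 x₀≢0 (diff≢0 x₀≢1)) (trans
        (solve 3 (λ x y n → x :* (x :- :1) :* n := n :* (x :* (x :- :1) :- y :* (x :- x))) refl x₀ y (ν y))
        (trans (subst (λ m → ν y * (x₀ * (m - 1#) - y * (m - x₀)) ≡ m * (y * (x₀ - 1#))) μ-fixed (transversality x₀ y))
          (solve 2 (λ x y → x :* (y :* (x :- :1)) := x :* (x :- :1) :* y) refl x₀ y)))

      μ-identity : ∀ x → μ x ≡ x
      μ-identity x = diff⇒≡ (cancelˡ (diff≢0 (x₀≢1 ∘ sym)) (cancelˡ x₀≢0 (trans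
        (solve 3 (λ x y m → y :* ((:1 :- y) :* (m :- x)) := y :* (x :* (m :- :1) :- y :* (m :- x)) :- m :* (y :* (x :- :1)))
          refl x x₀ (μ x))
        (≡⇒diff (subst (λ n → n * (x * (μ x - 1#) - x₀ * (μ x - x)) ≡ μ x * (x₀ * (x - 1#))) (ν-identity x₀) (transversality x x₀))))))

    D-coordinates′ : ∀ x y → ∃ λ r → D x y ≡ comb b (x * y ∷ 1# ∷ y ∷ x ∷ r ∷ [])
    D-coordinates′ x y = r , trans e (simplify (trans (cong₂ _*_ s≡y μ≡x) (*-comm y x)) refl s≡y
        (trans (cong (λ m → x + s * (m - x)) μ≡x) (solve 2 (λ x s → x :+ s :* (x :- x) := x) refl x s)))
      where
      x₀≢0 = proj₁ (proj₂ generic)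
      x₀≢1 = proj₂ (proj₂ generic)
      s = proj₁ (entry x y)
      t = proj₁ (proj₂ (entry x y))
      r = proj₁ (proj₂ (proj₂ (entry x y)))
      e = proj₁ (proj₂ (proj₂ (proj₂ (entry x y))))
      e₂ = proj₁ (proj₂ (proj₂ (proj₂ (proj₂ (proj₂ (entry x y))))))
      μ≡x : μ x ≡ x
      μ≡x = μ-identity x₀≢0 x₀≢1 x
      s≡y : s ≡ y
      s≡y = trans e₂ (trans (cong (λ n → y + t * (n - y)) (ν-identity x₀≢0 x₀≢1 y)) (solve 2 (λ y t → y :+ t :* (y :- y) := y) refl y t))

    abstract
      D-coordinates : ∀ x y → ∃ λ r → D x y ≡ comb b (x * y ∷ 1# ∷ y ∷ x ∷ r ∷ [])
      D-coordinates = D-coordinates′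

    f : Fin q → Fin q → Fin q
    f x y = proj₁ (D-coordinates x y)

    N : Fin q × Fin q → V 5
    N (x , y) = comb b (x * y ∷ 1# ∷ y ∷ x ∷ f x y ∷ [])

    N∈ : ∀ x y → N (x , y) ∈ C
    N∈ x y = subst (_∈ C) (proj₂ (D-coordinates x y)) (D∈ x y)

    N-injective : ∀ {a c} → N a ≡ N c → a ≡ c
    N-injective {x , y} {x′ , y′} e = cong₂ _,_
        (cong (λ z → lookup z (suc (suc (suc zero)))) eq) (cong (λ z → lookup z (suc (suc zero))) eq)
      where
      eq : x * y ∷ 1# ∷ y ∷ x ∷ f x y ∷ [] ≡ x′ * y′ ∷ 1# ∷ y′ ∷ x′ ∷ f x′ y′ ∷ []
      eq = comb-injective independent e

    -- `N` is injective on `q²` pairs, and 𝒞 has `q²` points.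
    N-all : ∀ {P} → P ∈ C → ∃₂ λ x y → P ≡ N (x , y)
    N-all {P} P∈ =
      let (x , y) , _ , e = surjective {xs = pairs} _≟ᵛ_ pairs-unique
            (ℕₚ.≤-reflexive (trans C-size (sym (trans (grid-length _,_ elements elements)
              (cong₂ ℕ._*_ (allFin-length q) (allFin-length q))))))
            (λ a P → N a ≡ P) (λ a P → N a ≟ᵛ P) (λ (x , y) _ → N (x , y) , N∈ x y , refl)
            (λ _ _ e e′ → N-injective (trans e (sym e′))) P P∈
      in x , y , sym e
      where
      pairs : List (Fin q × Fin q)
      pairs = grid _,_ elements elements
      pairs-unique : Unique pairs
      pairs-unique = grid-unique _,_ (allFin-unique q) (allFin-unique q) (λ _ _ _ _ e → cong proj₁ e , cong proj₂ e)

    standard : StandardForm A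
    standard = record
      { w = w ; v = v ; u = u ; R = R ; independent = independent
      ; w-direction = w-direction ; v-direction = v-direction ; u-direction = u-direction ; R-direction′ = R-direction cπ
      ; f = f ; N∈ = N∈ ; N-all = N-all ; column = σ₍_₎ ; row = π₍_₎ ; R-column = Rσ₍_₎ ; R-row = Rπ₍_₎
      ; N-column = Nσ ; N-row = Nπ ; column-only = λ {x} {x′} {y} o → σ-only x x′ y o ; row-only = λ {x} {y} {y′} o → π-only x y y′ o }
      where
      Nσ : ∀ x y → N (x , y) on σ₍ x ₎
      Nσ x y = subst (_on σ₍ x ₎) (proj₂ (D-coordinates x y)) (Dσ x y)
      Nπ : ∀ x y → N (x , y) on π₍ y ₎
      Nπ x y = subst (_on π₍ y ₎) (proj₂ (D-coordinates x y)) (Dπ x y)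
      σ-only : ∀ x x′ y → N (x′ , y) on σ₍ x ₎ → x′ ≡ x
      σ-only x x′ y o with x′ ≟ᶠ x
      ... | yes e = e
      ... | no ne = ⊥-elim (σ-parallel₂ ne (affine (N∈ x′ y)) (Nσ x′ y) o)
      π-only : ∀ x y y′ → N (x , y′) on π₍ y ₎ → y′ ≡ y
      π-only x y y′ o with y′ ≟ᶠ y
      ... | yes e = e
      ... | no ne = ⊥-elim (π-parallel₂ ne (affine (N∈ x y′)) (Nπ x y′) o)

  opaque
    standard-form : ∀ {A} → A ∈ C → StandardForm A
    standard-form {A} A∈ with outside _≟ᵛ_ C-unique (A ∷ []) (subst (1 ℕ.<_) (sym C-size)
        (ℕₚ.≤-trans (s≤s (s≤s z≤n)) (ℕₚ.*-mono-≤ 7≤q 1≤q)))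
    ... | B , B∈ , B∉ with join A∈ B∈ (λ e → B∉ (here (sym e)))
    ... | π , Aπ , Bπ with center π
    ... | R , cπ with partner cπ A∈ Aπ
    ... | σ , π≉σ , Aσ , Rσ with pick σ (A ∷ []) (s≤s z≤n)
    ... | E , E∈ , Eσ , E∉ = Net.standard A∈ cπ (partner-center cπ σ π≉σ A∈ Aπ Aσ Rσ) π≉σ Aπ Aσ B∈ E∈ Bπ Eσ
            (λ e → B∉ (here (sym e))) (λ e → E∉ (here (sym e)))

-- Polynomials over a finite field, and functions quadratic along lines.

module Polynomials {q : ℕ} (F : FField q) where
  open LinearAlgebra F
  open Counting

  eval : ∀ {n} → V n → Fin q → Fin q
  eval [] t = 0#
  eval (c ∷ cs) t = c + t * eval cs t

  -- Synthetic division by `t - r`; the remainder is `eval cs r`.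
  quotient : ∀ {n} → V (suc n) → Fin q → V n
  quotient (c ∷ []) r = []
  quotient (c ∷ cs@(_ ∷ _)) r = eval cs r ∷ quotient cs r

  factor : ∀ {n} (cs : V (suc n)) r t → eval cs t - eval cs r ≡ (t - r) * eval (quotient cs r) t
  factor (c ∷ []) r t = solve 3 (λ c r t → c :+ t :* :0 :- (c :+ r :* :0) := (t :- r) :* :0) refl c r t
  factor (c ∷ cs@(_ ∷ _)) r t = trans
    (solve 5 (λ c r t a b → c :+ t :* a :- (c :+ r :* b) := t :* (a :- b) :+ (t :- r) :* b) refl c r t (eval cs t) (eval cs r))
    (trans (cong (λ z → t * z + (t - r) * eval cs r) (factor cs r t))
      (solve 4 (λ r t a b → t :* ((t :- r) :* a) :+ (t :- r) :* b := (t :- r) :* (b :+ t :* a)) refl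
        r t (eval (quotient cs r) t) (eval cs r)))

  vanishing : ∀ {n} (cs : V (suc n)) r → quotient cs r ≡ 𝟘 → eval cs r ≡ 0# → cs ≡ 𝟘
  vanishing (c ∷ []) r _ e = cong (_∷ []) (trans (solve 2 (λ c r → c := c :+ r :* :0) refl c r) e)
  vanishing (c ∷ cs@(_ ∷ _)) r q≡0 e = cong₂ _∷_
    (trans (sym (trans (cong (λ z → c + r * z) (cong Vec.head q≡0)) (solve 2 (λ c r → c :+ r :* :0 := c) refl c r))) e)
    (vanishing cs r (cong Vec.tail q≡0) (cong Vec.head q≡0))

  few-roots : ∀ {n} (cs : V n) (rs : List (Fin q)) → Unique rs → n ℕ.≤ length rs → (∀ {r} → r ∈ rs → eval cs r ≡ 0#) → cs ≡ 𝟘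
  few-roots [] rs u le roots = refl
  few-roots cs@(_ ∷ _) (r ∷ rs) (r∉ ∷ u) (s≤s le) roots = vanishing cs r
    (few-roots (quotient cs r) rs u le (λ {t} t∈ → cancelˡ (diff≢0 (λ e → All.lookup r∉ t∈ (sym e)))
      (trans (sym (factor cs r t)) (trans (cong₂ _-_ (roots (there t∈)) (roots (here refl))) (-‿inverseʳ 0#)))))
    (roots (here refl))

  zero-polynomial : ∀ {n} (cs : V n) → n ℕ.≤ q → (∀ t → eval cs t ≡ 0#) → cs ≡ 𝟘
  zero-polynomial cs le z = few-roots cs (allFin q) (allFin-unique q) (subst (_ ℕ.≤_) (sym (allFin-length q)) le) (λ _ → z _)

  Quadratic : (Fin q → Fin q) → Set
  Quadratic g = ∃₂ λ a b → ∃ λ c → ∀ x → g x ≡ a + b * x + c * (x * x)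

  BiQuadratic : (Fin q → Fin q → Fin q) → Set
  BiQuadratic f = ∃₂ λ a b → ∃₂ λ c d → ∃₂ λ e k → ∀ x y → f x y ≡ a + b * x + c * y + (d * (x * x) + e * (x * y) + k * (y * y))

  module _ (7≤q : 7 ℕ.≤ q) (2≢0 : 1# + 1# ≢ 0#) (f : Fin q → Fin q → Fin q)
    (quadratic : ∀ m n → m ≢ 0# → Quadratic (λ x → f x (m * x + n))) where

    κ : Fin q
    κ = proj₁ (inverse (1# + 1#) 2≢0)
    2κ : (1# + 1#) * κ ≡ 1#
    2κ = proj₂ (inverse (1# + 1#) 2≢0)

    -- The polynomial identity holds modulo 2κ - 1.
    halved : ∀ {x y} z → x ≡ y + z * ((1# + 1#) * κ - 1#) → x ≡ y
    halved {x} {y} z e = trans e (trans (cong (λ k → y + z * (k - 1#)) 2κ) (solve 2 (λ y z → y :+ z :* (:1 :- :1) := y) refl y z))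

    -- The assumption speaks of lines of nonzero slope only. In the coordinates `x = s + t`,
    -- `y = s - t` the axes have slopes `1#` and `- 1#`, so it applies to them.
    G : Fin q → Fin q → Fin q
    G s t = f (s + t) (s - t)

    G-first : ∀ t → Quadratic (λ s → G s t)
    G-first t =
      let a , b , c , e = quadratic 1# (- (t + t)) 1≢0
      in a + b * t + c * (t * t) , b + (c + c) * t , c , λ s → trans
        (cong (f (s + t)) (solve 2 (λ s t → s :- t := :1 :* (s :+ t) :+ (:- (t :+ t))) refl s t))
        (trans (e (s + t)) (solve 5 (λ a b c s t → a :+ b :* (s :+ t) :+ c :* ((s :+ t) :* (s :+ t))
          := (a :+ b :* t :+ c :* (t :* t)) :+ (b :+ (c :+ c) :* t) :* s :+ c :* (s :* s)) refl a b c s t))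

    G-second : ∀ s → Quadratic (λ t → G s t)
    G-second s =
      let a , b , c , e = quadratic (- 1#) (s + s) (-≢0 1≢0)
      in a + b * s + c * (s * s) , b + (c + c) * s , c , λ t → trans
        (cong (f (s + t)) (solve 2 (λ s t → s :- t := (:- :1) :* (s :+ t) :+ (s :+ s)) refl s t))
        (trans (e (s + t)) (solve 5 (λ a b c s t → a :+ b :* (s :+ t) :+ c :* ((s :+ t) :* (s :+ t))
          := (a :+ b :* s :+ c :* (s :* s)) :+ (b :+ (c :+ c) :* s) :* t :+ c :* (t :* t)) refl a b c s t))

    G-diagonal : ∀ c → c ≢ 1# → c ≢ - 1# → Quadratic (λ t → G (c * t) t)
    G-diagonal k k≢1 k≢-1 =
      let i , ki = inverse (k + 1#) k+1≢0
          a , b , c , e = quadratic ((k - 1#) * i) 0# (*-≢0 (diff≢0 k≢1) (inverse≢0 ki))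
      in a , b * (k + 1#) , c * ((k + 1#) * (k + 1#)) , λ t → trans
        (cong₂ f (solve 2 (λ k t → k :* t :+ t := (k :+ :1) :* t) refl k t) (slope i ki t))
        (trans (e ((k + 1#) * t)) (solve 5 (λ a b c k t → a :+ b :* ((k :+ :1) :* t) :+ c :* ((k :+ :1) :* t :* ((k :+ :1) :* t))
          := a :+ b :* (k :+ :1) :* t :+ c :* ((k :+ :1) :* (k :+ :1)) :* (t :* t)) refl a b c k t))
      where
      k+1≢0 : k + 1# ≢ 0#
      k+1≢0 e = k≢-1 (trans (solve 1 (λ k → k := (k :+ :1) :- :1) refl k)
        (trans (cong (_- 1#) e) (solve 0 (:0 :- :1 := :- :1) refl)))
      slope : ∀ i → (k + 1#) * i ≡ 1# → ∀ t → k * t - t ≡ (k - 1#) * i * ((k + 1#) * t) + 0#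
      slope i ki t = sym (trans (solve 3 (λ k i t → (k :- :1) :* i :* ((k :+ :1) :* t) :+ :0 := (k :- :1) :* t :* ((k :+ :1) :* i)) refl k i t)
        (trans (cong ((k - 1#) * t *_) ki) (solve 2 (λ k t → (k :- :1) :* t :* :1 := k :* t :- t) refl k t)))

    -- Lagrange interpolation at `0#`, `1#` and `- 1#`, with `κ` as one half.
    interpolate : ∀ {g} → Quadratic g → ∀ s →
      g s ≡ g 0# + (g 1# - g (- 1#)) * κ * s + ((g 1# + g (- 1#)) * κ - g 0#) * (s * s)
    interpolate {g} (a , b , c , e) s = trans (e s) (trans
      (halved (- (b * s + (a + c) * (s * s))) (solve 5 (λ a b c s κ → a :+ b :* s :+ c :* (s :* s)
        := ((a :+ b :* :0 :+ c :* (:0 :* :0))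
            :+ ((a :+ b :* :1 :+ c :* (:1 :* :1)) :- (a :+ b :* (:- :1) :+ c :* ((:- :1) :* (:- :1)))) :* κ :* s
            :+ (((a :+ b :* :1 :+ c :* (:1 :* :1)) :+ (a :+ b :* (:- :1) :+ c :* ((:- :1) :* (:- :1)))) :* κ
                :- (a :+ b :* :0 :+ c :* (:0 :* :0))) :* (s :* s))
           :+ (:- (b :* s :+ (a :+ c) :* (s :* s))) :* ((:1 :+ :1) :* κ :- :1)) refl a b c s κ))
      (sym (three (e 0#) (e 1#) (e (- 1#)))))
      where
      three : ∀ {x y z x′ y′ z′} → x ≡ x′ → y ≡ y′ → z ≡ z′ →
        x + (y - z) * κ * s + ((y + z) * κ - x) * (s * s) ≡ x′ + (y′ - z′) * κ * s + ((y′ + z′) * κ - x′) * (s * s)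
      three refl refl refl = refl

    record Nine : Set where
      field
        α₀ β₀ γ₀ α₁ β₁ γ₁ α₂ β₂ γ₂ : Fin q
        form : ∀ s t → G s t ≡ (α₀ + β₀ * t + γ₀ * (t * t)) + (α₁ + β₁ * t + γ₁ * (t * t)) * s
                               + (α₂ + β₂ * t + γ₂ * (t * t)) * (s * s)

    -- Interpolation in `s` expresses `G s t` through three functions of `t`, each of them
    -- quadratic. This bounds the degree in each variable, but not yet the total degree.
    nine : Nine
    nine =
      let a , b , c , e = G-second 0#
          a₁ , b₁ , c₁ , e₁ = G-second 1#
          a₂ , b₂ , c₂ , e₂ = G-second (- 1#)
      in record
        { α₀ = a ; β₀ = b ; γ₀ = c
        ; α₁ = (a₁ - a₂) * κ ; β₁ = (b₁ - b₂) * κ ; γ₁ = (c₁ - c₂) * κ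
        ; α₂ = (a₁ + a₂) * κ - a ; β₂ = (b₁ + b₂) * κ - b ; γ₂ = (c₁ + c₂) * κ - c
        ; form = λ s t → trans (interpolate (G-first t) s) (trans (three s (e t) (e₁ t) (e₂ t))
            (expand s t a b c a₁ b₁ c₁ a₂ b₂ c₂)) }
      where
      three : ∀ s {x y z x′ y′ z′} → x ≡ x′ → y ≡ y′ → z ≡ z′ →
        x + (y - z) * κ * s + ((y + z) * κ - x) * (s * s) ≡ x′ + (y′ - z′) * κ * s + ((y′ + z′) * κ - x′) * (s * s)
      three s refl refl refl = refl
      first : ∀ t a₁ b₁ c₁ a₂ b₂ c₂ → ((a₁ + b₁ * t + c₁ * (t * t)) - (a₂ + b₂ * t + c₂ * (t * t))) * κ
        ≡ (a₁ - a₂) * κ + (b₁ - b₂) * κ * t + (c₁ - c₂) * κ * (t * t)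
      first t a₁ b₁ c₁ a₂ b₂ c₂ = solve 8 (λ t κ a₁ b₁ c₁ a₂ b₂ c₂ →
        ((a₁ :+ b₁ :* t :+ c₁ :* (t :* t)) :- (a₂ :+ b₂ :* t :+ c₂ :* (t :* t))) :* κ
        := (a₁ :- a₂) :* κ :+ (b₁ :- b₂) :* κ :* t :+ (c₁ :- c₂) :* κ :* (t :* t)) refl t κ a₁ b₁ c₁ a₂ b₂ c₂
      second : ∀ t a b c a₁ b₁ c₁ a₂ b₂ c₂ →
        ((a₁ + b₁ * t + c₁ * (t * t)) + (a₂ + b₂ * t + c₂ * (t * t))) * κ - (a + b * t + c * (t * t))
        ≡ ((a₁ + a₂) * κ - a) + ((b₁ + b₂) * κ - b) * t + ((c₁ + c₂) * κ - c) * (t * t)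
      second t a b c a₁ b₁ c₁ a₂ b₂ c₂ = solve 11 (λ t κ a b c a₁ b₁ c₁ a₂ b₂ c₂ →
        ((a₁ :+ b₁ :* t :+ c₁ :* (t :* t)) :+ (a₂ :+ b₂ :* t :+ c₂ :* (t :* t))) :* κ :- (a :+ b :* t :+ c :* (t :* t))
        := ((a₁ :+ a₂) :* κ :- a) :+ ((b₁ :+ b₂) :* κ :- b) :* t :+ ((c₁ :+ c₂) :* κ :- c) :* (t :* t))
        refl t κ a b c a₁ b₁ c₁ a₂ b₂ c₂
      expand : ∀ s t a b c a₁ b₁ c₁ a₂ b₂ c₂ →
        let g = a + b * t + c * (t * t) ; g₁ = a₁ + b₁ * t + c₁ * (t * t) ; g₂ = a₂ + b₂ * t + c₂ * (t * t) in
        g + (g₁ - g₂) * κ * s + ((g₁ + g₂) * κ - g) * (s * s)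
        ≡ g + ((a₁ - a₂) * κ + (b₁ - b₂) * κ * t + (c₁ - c₂) * κ * (t * t)) * s
            + (((a₁ + a₂) * κ - a) + ((b₁ + b₂) * κ - b) * t + ((c₁ + c₂) * κ - c) * (t * t)) * (s * s)
      expand s t a b c a₁ b₁ c₁ a₂ b₂ c₂ = cong₂ (λ x y → (a + b * t + c * (t * t)) + x * s + y * (s * s))
        (first t a₁ b₁ c₁ a₂ b₂ c₂) (second t a b c a₁ b₁ c₁ a₂ b₂ c₂)

    open Nine nine

    -- Comparing coefficients of t⁴ and t³ along the line s = k t.
    leading : ∀ k → k ≢ 0# → k ≢ 1# → k ≢ - 1# → γ₂ ≡ 0# × γ₁ + β₂ * k ≡ 0#
    leading k k≢0 k≢1 k≢-1 =
      let a , b , c , e = G-diagonal k k≢1 k≢-1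
          zeros = zero-polynomial ((α₀ - a) ∷ (β₀ + α₁ * k - b) ∷ (γ₀ + β₁ * k + α₂ * (k * k) - c)
                    ∷ (k * (γ₁ + β₂ * k)) ∷ ((k * k) * γ₂) ∷ []) (ℕₚ.≤-trans (ℕₚ.m≤n+m 5 2) 7≤q)
                    (λ t → trans (collect a b c t) (≡⇒diff (trans (sym (form (k * t) t)) (e t))))
      in cancelˡ (*-≢0 k≢0 k≢0) (cong (λ v → Vec.head (Vec.tail (Vec.tail (Vec.tail (Vec.tail v))))) zeros)
       , cancelˡ k≢0 (cong (λ v → Vec.head (Vec.tail (Vec.tail (Vec.tail v)))) zeros)
      where
      collect : ∀ a b c t →
        (α₀ - a) + t * ((β₀ + α₁ * k - b) + t * ((γ₀ + β₁ * k + α₂ * (k * k) - c) + t * (k * (γ₁ + β₂ * k) + t * ((k * k) * γ₂ + t * 0#))))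
        ≡ ((α₀ + β₀ * t + γ₀ * (t * t)) + (α₁ + β₁ * t + γ₁ * (t * t)) * (k * t) + (α₂ + β₂ * t + γ₂ * (t * t)) * (k * t * (k * t)))
          - (a + b * t + c * (t * t))
      collect a b c t = solve 14 (λ a b c t k α₀ β₀ γ₀ α₁ β₁ γ₁ α₂ β₂ γ₂ →
        (α₀ :- a) :+ t :* ((β₀ :+ α₁ :* k :- b) :+ t :* ((γ₀ :+ β₁ :* k :+ α₂ :* (k :* k) :- c)
          :+ t :* (k :* (γ₁ :+ β₂ :* k) :+ t :* ((k :* k) :* γ₂ :+ t :* :0))))
        := ((α₀ :+ β₀ :* t :+ γ₀ :* (t :* t)) :+ (α₁ :+ β₁ :* t :+ γ₁ :* (t :* t)) :* (k :* t)
             :+ (α₂ :+ β₂ :* t :+ γ₂ :* (t :* t)) :* (k :* t :* (k :* t)))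
           :- (a :+ b :* t :+ c :* (t :* t)))
        refl a b c t k α₀ β₀ γ₀ α₁ β₁ γ₁ α₂ β₂ γ₂

    -- `γ₁ + β₂ k` is linear in `k`; two admissible values of `k` annihilate it, so both
    -- coefficients vanish.
    higher-vanish : γ₂ ≡ 0# × γ₁ ≡ 0# × β₂ ≡ 0#
    higher-vanish =
      let k , k∉ = element-off 7≤q (0# ∷ 1# ∷ - 1# ∷ []) (s≤s (s≤s (s≤s z≤n)))
          l , l∉ = element-off 7≤q (k ∷ 0# ∷ 1# ∷ - 1# ∷ []) (s≤s (s≤s (s≤s (s≤s z≤n))))
          γ₂≡0 , ek = leading k (λ e → k∉ (here e)) (λ e → k∉ (there (here e))) (λ e → k∉ (there (there (here e))))
          _ , el = leading l (λ e → l∉ (there (here e))) (λ e → l∉ (there (there (here e)))) (λ e → l∉ (there (there (there (here e)))))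
          β₂≡0 = cancelˡ (diff≢0 (λ e → l∉ (here e))) (trans
            (solve 4 (λ l k b c → (l :- k) :* b := (c :+ b :* l) :- (c :+ b :* k)) refl l k β₂ γ₁)
            (trans (cong₂ _-_ el ek) (-‿inverseʳ 0#)))
      in γ₂≡0 , trans (solve 3 (λ c b k → c := (c :+ b :* k) :- b :* k) refl γ₁ β₂ k)
           (trans (cong₂ (λ x y → x - y * k) ek β₂≡0) (solve 1 (λ k → :0 :- :0 :* k := :0) refl k)) , β₂≡0

    biquadratic′ : BiQuadratic f
    biquadratic′ = α₀ , κ * (α₁ + β₀) , κ * (α₁ - β₀) , κ * κ * (γ₀ + β₁ + α₂) , κ * κ * ((1# + 1#) * (α₂ - γ₀))
        , κ * κ * (γ₀ - β₁ + α₂) , λ x y → begin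
      f x y                                          ≡⟨ cong₂ f (sum x y) (difference x y) ⟩
      G ((x + y) * κ) ((x - y) * κ)                  ≡⟨ form _ _ ⟩
      _                                              ≡⟨ kill ((x + y) * κ) ((x - y) * κ) higher-vanish ⟩
      _                                              ≡⟨ solve 9 (λ x y κ α₀ β₀ γ₀ α₁ β₁ α₂ →
          (α₀ :+ β₀ :* ((x :- y) :* κ) :+ γ₀ :* ((x :- y) :* κ :* ((x :- y) :* κ)))
            :+ (α₁ :+ β₁ :* ((x :- y) :* κ)) :* ((x :+ y) :* κ) :+ α₂ :* ((x :+ y) :* κ :* ((x :+ y) :* κ))
          := α₀ :+ κ :* (α₁ :+ β₀) :* x :+ κ :* (α₁ :- β₀) :* y
            :+ (κ :* κ :* (γ₀ :+ β₁ :+ α₂) :* (x :* x) :+ κ :* κ :* ((:1 :+ :1) :* (α₂ :- γ₀)) :* (x :* y)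
                :+ κ :* κ :* (γ₀ :- β₁ :+ α₂) :* (y :* y))) refl x y κ α₀ β₀ γ₀ α₁ β₁ α₂ ⟩
      _                                              ∎
      where
      open ≡-Reasoning
      sum : ∀ x y → x ≡ (x + y) * κ + (x - y) * κ
      sum x y = halved (- x) (solve 3 (λ x y κ → x := (x :+ y) :* κ :+ (x :- y) :* κ :+ (:- x) :* ((:1 :+ :1) :* κ :- :1)) refl x y κ)
      difference : ∀ x y → y ≡ (x + y) * κ - (x - y) * κ
      difference x y = halved (- y) (solve 3 (λ x y κ → y := (x :+ y) :* κ :- (x :- y) :* κ :+ (:- y) :* ((:1 :+ :1) :* κ :- :1)) refl x y κ)
      drop : ∀ {c c′ b} → c ≡ 0# → c′ ≡ 0# → b ≡ 0# → ∀ s t →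
        (α₀ + β₀ * t + γ₀ * (t * t)) + (α₁ + β₁ * t + c′ * (t * t)) * s + (α₂ + b * t + c * (t * t)) * (s * s)
        ≡ (α₀ + β₀ * t + γ₀ * (t * t)) + (α₁ + β₁ * t) * s + α₂ * (s * s)
      drop refl refl refl s t = solve 6 (λ s t z α₁ β₁ α₂ →
        z :+ (α₁ :+ β₁ :* t :+ :0 :* (t :* t)) :* s :+ (α₂ :+ :0 :* t :+ :0 :* (t :* t)) :* (s :* s)
        := z :+ (α₁ :+ β₁ :* t) :* s :+ α₂ :* (s :* s)) refl s t (α₀ + β₀ * t + γ₀ * (t * t)) α₁ β₁ α₂
      kill : ∀ s t → γ₂ ≡ 0# × γ₁ ≡ 0# × β₂ ≡ 0# →
        (α₀ + β₀ * t + γ₀ * (t * t)) + (α₁ + β₁ * t + γ₁ * (t * t)) * s + (α₂ + β₂ * t + γ₂ * (t * t)) * (s * s)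
        ≡ (α₀ + β₀ * t + γ₀ * (t * t)) + (α₁ + β₁ * t) * s + α₂ * (s * s)
      kill s t (e , e′ , e″) = drop e e′ e″ s t

    abstract
      biquadratic : BiQuadratic f
      biquadratic = biquadratic′

-- The remaining coordinate is quadratic along transversal lines.

module Surface {q : ℕ} (F : FField q) (7≤q : 7 ℕ.≤ q)
  (h : Vec (Fin q) 5) (C : List (Vec (Fin q) 5)) (CPlane : Geo.Plane F → Set)
  (hyp : Geo.Config.Hypotheses F h C CPlane) {A : Vec (Fin q) 5}
  (standard : Coordinates.StandardForm F 7≤q h C CPlane hyp A) where
  open Counting
  open Coordinates F 7≤q h C CPlane hyp public
  open Polynomials F public using (Quadratic; BiQuadratic)
  open StandardForm standard public

  R≢𝟘 : R ≢ 𝟘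
  R≢𝟘 e = 1≢0 (cong (λ z → lookup z (suc (suc (suc (suc zero))))) (independent (0# ∷ 0# ∷ 0# ∷ 0# ∷ 1# ∷ []) (trans
    (vec-identity (0# ⊡ #0 ⊞ (0# ⊡ #1 ⊞ (0# ⊡ #2 ⊞ (0# ⊡ #3 ⊞ (1# ⊡ #4 ⊞ ∅))))) #4
      (λ { (w ∷ a ∷ v ∷ u ∷ r ∷ []) → solve 5 (λ w a v u r →
        :0 :* w :+ (:0 :* a :+ (:0 :* v :+ (:0 :* u :+ (:1 :* r :+ :0)))) := r) refl w a v u r }) basis) e)))

  N-coordinates : ∀ {x y x′ y′} → N x y ≡ N x′ y′ → x ≡ x′ × y ≡ y′
  N-coordinates {x} {y} {x′} {y′} e =
    cong (λ z → lookup z (suc (suc (suc zero)))) eq , cong (λ z → lookup z (suc (suc zero))) eq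
    where
    eq : x * y ∷ 1# ∷ y ∷ x ∷ f x y ∷ [] ≡ x′ * y′ ∷ 1# ∷ y′ ∷ x′ ∷ f x′ y′ ∷ []
    eq = comb-injective independent e

  dot-N : ∀ ψ x y → dot ψ (N x y) ≡ x * y * dot ψ w + (dot ψ A + y * dot ψ v + x * dot ψ u + f x y * dot ψ R)
  dot-N ψ x y = trans (dot-comb ψ basis (x * y ∷ 1# ∷ y ∷ x ∷ f x y ∷ [])) (solve 8 (λ x y k w a v u r →
      x :* y :* w :+ (:1 :* a :+ (y :* v :+ (x :* u :+ (k :* r :+ :0)))) := x :* y :* w :+ (a :+ y :* v :+ x :* u :+ k :* r))
    refl x y (f x y) (dot ψ w) (dot ψ A) (dot ψ v) (dot ψ u) (dot ψ R))

  -- On τ the coordinate y is a fractional-linear function of x, and it is bijective, hence linear.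
  module Transversal {m n : Fin q} (m≢0 : m ≢ 0#) (τ : Block) (oτ : N 0# n on τ) (iτ : N 1# (m + n) on τ) where

    τ≉column : ∀ x → ¬ τ ≈ column x
    τ≉column x e = 0≢1 (trans (column-only (≈-on τ (column x) e oτ)) (sym (column-only (≈-on τ (column x) e iτ))))

    τ≉row : ∀ y → ¬ τ ≈ row y
    τ≉row y e = m≢0 (trans (solve 2 (λ m n → m := m :+ n :- n) refl m n)
      (≡⇒diff (trans (row-only (≈-on τ (row y) e iτ)) (sym (row-only (≈-on τ (row y) e oτ))))))

    same-row : ∀ {x x′ y} → N x y on τ → N x′ y on τ → x ≡ x′
    same-row {x} {x′} {y} p p′ = proj₁ (N-coordinates (meet-unique τ (row y) (τ≉row y) (N∈ x y) (N∈ x′ y) p p′ (N-row x y) (N-row x′ y)))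

    same-column : ∀ {x y y′} → N x y on τ → N x y′ on τ → y ≡ y′
    same-column {x} {y} {y′} p p′ = proj₂ (N-coordinates (meet-unique τ (column x) (τ≉column x) (N∈ x y) (N∈ x y′) p p′ (N-column x y) (N-column x y′)))

    abstract
      -- `τ` meets each row at most once and has as many points as there are rows.
      at-row : ∀ y → ∃ λ x → N x y on τ
      at-row y =
        let P , P∈ , x , e = surjective _≟ᶠ_ (pts-unique τ) (ℕₚ.≤-reflexive (trans (allFin-length q) (sym (pts-length τ))))
              (λ P y → ∃ λ x → P ≡ N x y) (λ P y → Finₚ.any? (λ x → P ≟ᵛ N x y))
              (λ P P∈ → let x , y , e = N-all (proj₁ (pts⁻ τ P∈)) in y , ∈-allFin y , x , e)
              (λ {P} {P′} {y} P∈ P′∈ (x , e) (x′ , e′) → trans e (trans (cong (λ z → N z y)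
                 (same-row (subst (_on τ) e (proj₂ (pts⁻ τ P∈))) (subst (_on τ) e′ (proj₂ (pts⁻ τ P′∈))))) (sym e′)))
              y (∈-allFin y)
        in x , subst (_on τ) e (proj₂ (pts⁻ τ P∈))

    -- A hyperplane through `τ` and `R`; because it contains `R`, its equation does not involve `f`.
    φ-data : ∃ λ φ → φ ≢ 𝟘 × Kills φ (R ∷ gens (plane τ))
    φ-data = annihilator (R ∷ gens (plane τ))

    φ : V 5
    φ = proj₁ φ-data

    a b c d : Fin q
    a = dot φ A
    b = dot φ u
    c = dot φ v
    d = dot φ w

    φR : dot φ R ≡ 0#
    φR = VAll.head (proj₂ (proj₂ φ-data))

    equation : ∀ {x y} → N x y on τ → x * y * d + (a + y * c + x * b) ≡ 0#
    equation {x} {y} o = trans (solve 7 (λ x y k a b c d → x :* y :* d :+ (a :+ y :* c :+ x :* b)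
        := x :* y :* d :+ (a :+ y :* c :+ x :* b :+ k :* :0)) refl x y (f x y) a b c d)
      (trans (cong (λ z → x * y * d + (a + y * c + x * b + f x y * z)) (sym φR))
      (trans (sym (dot-N φ x y)) (kills-span φ (VAll.tail (proj₂ (proj₂ φ-data))) o)))

    -- If `d` were nonzero, `x` would drop out of the equation in the row `y₁ = - b / d`. That row
    -- does carry a point of `τ`, so the equation factors as `(y - y₁) (d x + c) = 0`, and the
    -- points in all other rows would lie in one column.
    d≡0 : d ≡ 0#
    d≡0 with d ≟ᶠ 0#
    ... | yes e = e
    ... | no d≢0 = ⊥-elim (y₃∉ (there (here (same-column′))))
      where
      i = proj₁ (inverse d d≢0)
      di : d * i ≡ 1#
      di = proj₂ (inverse d d≢0)
      y₁ = - (b * i)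
      x₁ = proj₁ (at-row y₁)
      y₂ = proj₁ (element-off 7≤q (y₁ ∷ []) (s≤s z≤n))
      y₂∉ = proj₂ (element-off 7≤q (y₁ ∷ []) (s≤s z≤n))
      y₃ = proj₁ (element-off 7≤q (y₁ ∷ y₂ ∷ []) (s≤s (s≤s z≤n)))
      y₃∉ = proj₂ (element-off 7≤q (y₁ ∷ y₂ ∷ []) (s≤s (s≤s z≤n)))
      b≡ : b ≡ - (d * y₁)
      b≡ = trans (solve 1 (λ b → b := b :* :1) refl b) (trans (cong (b *_) (sym di))
        (solve 3 (λ b d i → b :* (d :* i) := :- (d :* (:- (b :* i)))) refl b d i))
      a≡ : a ≡ - (y₁ * c)
      a≡ = diff⇒≡ (trans (solve 5 (λ x y a c d → a :- (:- (y :* c)) := x :* y :* d :+ (a :+ y :* c :+ x :* (:- (d :* y)))) refl x₁ y₁ a c d)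
        (trans (cong (λ z → x₁ * y₁ * d + (a + y₁ * c + x₁ * z)) (sym b≡)) (equation (proj₂ (at-row y₁)))))
      level : ∀ {x y} → y ≢ y₁ → N x y on τ → d * x + c ≡ 0#
      level {x} {y} ne o = cancelˡ (diff≢0 ne) (trans
        (solve 5 (λ x y y₁ c d → (y :- y₁) :* (d :* x :+ c) := x :* y :* d :+ ((:- (y₁ :* c)) :+ y :* c :+ x :* (:- (d :* y₁))))
          refl x y y₁ c d)
        (trans (cong₂ (λ α β → x * y * d + (α + y * c + x * β)) (sym a≡) (sym b≡)) (equation o)))
      o₂ = proj₂ (at-row y₂)
      o₃ = proj₂ (at-row y₃)
      x₃≡x₂ : proj₁ (at-row y₃) ≡ proj₁ (at-row y₂)
      x₃≡x₂ = diff⇒≡ (cancelˡ d≢0 (trans (solve 4 (λ d x z c → d :* (x :- z) := (d :* x :+ c) :- (d :* z :+ c)) refl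
        d (proj₁ (at-row y₃)) (proj₁ (at-row y₂)) c)
        (trans (cong₂ _-_ (level (λ e → y₃∉ (here e)) o₃) (level (λ e → y₂∉ (here e)) o₂)) (-‿inverseʳ 0#))))
      same-column′ : y₃ ≡ y₂
      same-column′ = same-column (subst (λ x → N x y₃ on τ) x₃≡x₂ o₃) o₂

    linear : ∀ {x y} → N x y on τ → a + y * c + x * b ≡ 0#
    linear {x} {y} o = trans (solve 5 (λ x y a b c → a :+ y :* c :+ x :* b := x :* y :* :0 :+ (a :+ y :* c :+ x :* b)) refl x y a b c)
      (trans (cong (λ z → x * y * z + (a + y * c + x * b)) (sym d≡0)) (equation o))

    -- With `c` zero the two given points force `a` and `b` to vanish, and `φ` would kill the whole
    -- basis.
    c≢0 : c ≢ 0#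
    c≢0 c≡0 = proj₁ (proj₂ φ-data) (basis-detects φ independent (d≡0 ∷ a≡0 ∷ c≡0 ∷ b≡0 ∷ φR ∷ []))
      where
      a≡0 : a ≡ 0#
      a≡0 = trans (solve 3 (λ a b n → a := a :+ n :* :0 :+ :0 :* b) refl a b n)
        (trans (cong (λ z → a + n * z + 0# * b) (sym c≡0)) (linear oτ))
      b≡0 : b ≡ 0#
      b≡0 = trans (solve 2 (λ b k → b := :0 :+ k :* :0 :+ :1 :* b) refl b (m + n))
        (trans (cong₂ (λ y z → y + (m + n) * z + 1# * b) (sym a≡0) (sym c≡0)) (linear iτ))

    on-line : ∀ {x y} → N x y on τ → y ≡ m * x + n
    on-line {x} {y} o = diff⇒≡ (cancelˡ c≢0 (trans
      (solve 7 (λ x y m n a b c → c :* (y :- (m :* x :+ n)) := (a :+ y :* c :+ x :* b) :- (a :+ n :* c :+ :0 :* b)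
          :- x :* ((a :+ (m :+ n) :* c :+ :1 :* b) :- (a :+ n :* c :+ :0 :* b))) refl x y m n a b c)
      (trans (three (linear o) (linear oτ) (linear iτ)) (solve 1 (λ x → :0 :- :0 :- x :* (:0 :- :0) := :0) refl x))))
      where
      three : ∀ {e g k} → e ≡ 0# → g ≡ 0# → k ≡ 0# → e - g - x * (k - g) ≡ 0# - 0# - x * (0# - 0#)
      three refl refl refl = refl

    line-on : ∀ x → N x (m * x + n) on τ
    line-on x = subst (λ z → N z (m * x + n) on τ) (cancelˡ-≡ m≢0 (trans
        (solve 3 (λ m x n → m :* x := (m :* x :+ n) :- n) refl m (proj₁ r) n)
        (trans (cong (_- n) (sym (on-line (proj₂ r)))) (solve 3 (λ m x n → (m :* x :+ n) :- n := m :* x) refl m x n)))) (proj₂ r)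
      where r = at-row (m * x + n)

    -- Otherwise τ, a column and a row would share the line through N 0 n in direction R.
    R∉τ : ¬ R on τ
    R∉τ Rτ = absurd (at-most-two τ (column 0#) (row n) (shift-affine 1# (affine (N∈ 0# n)) R-direction′) X∉
        (on-shift τ 1# oτ Rτ) (on-shift (column 0#) 1# (N-column 0# n) (R-column 0#)) (on-shift (row n) 1# (N-row 0# n) (R-row n)))
      where
      X∉ : N 0# n ⊕ 1# · R ∉ C
      X∉ X∈ = shift-distinct 1≢0 R≢𝟘 (meet-unique τ (column 0#) (τ≉column 0#) (N∈ 0# n) X∈ oτ (on-shift τ 1# oτ Rτ)
        (N-column 0# n) (on-shift (column 0#) 1# (N-column 0# n) (R-column 0#)))
      absurd : τ ≈ column 0# ⊎ τ ≈ row n ⊎ column 0# ≈ row n → ⊥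
      absurd (inj₁ e) = τ≉column 0# e
      absurd (inj₂ (inj₁ e)) = τ≉row n e
      absurd (inj₂ (inj₂ e)) = 1≢0 (column-only (≈-on (row n) (column 0#) (≈-sym (column 0#) (row n) e) (N-row 1# n)))

    -- A hyperplane through `τ` avoiding `R`: its equation can be solved for `f` along `τ`.
    ψ-data : ∃ λ ψ → Kills ψ (gens (plane τ)) × dot ψ R ≢ 0#
    ψ-data = pick-right (separate (gens (plane τ)) R)
      where
      pick-right : R on τ ⊎ (∃ λ ψ → Kills ψ (gens (plane τ)) × dot ψ R ≢ 0#) → ∃ λ ψ → Kills ψ (gens (plane τ)) × dot ψ R ≢ 0#
      pick-right (inj₁ o) = ⊥-elim (R∉τ o)
      pick-right (inj₂ r) = r

    quadratic-on-line : Quadratic (λ x → f x (m * x + n))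
    quadratic-on-line = - (i * (dot ψ A + n * dot ψ v)) , - (i * (n * dot ψ w + m * dot ψ v + dot ψ u)) , - (i * (m * dot ψ w)) , λ x →
        trans (trans (sym (*-identityʳ _)) (cong (f x (m * x + n) *_) (sym ei)))
        (trans (solve 10 (λ x m n k e i w a v u →
            k :* (e :* i) := i :* (x :* (m :* x :+ n) :* w :+ (a :+ (m :* x :+ n) :* v :+ x :* u :+ k :* e))
              :+ ((:- (i :* (a :+ n :* v))) :+ (:- (i :* (n :* w :+ m :* v :+ u))) :* x :+ (:- (i :* (m :* w))) :* (x :* x)))
          refl x m n (f x (m * x + n)) e i (dot ψ w) (dot ψ A) (dot ψ v) (dot ψ u))
        (trans (cong (λ z → i * z + rest x) (trans (sym (dot-N′ x)) (kills-span ψ (proj₁ (proj₂ ψ-data)) (line-on x))))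
          (trans (cong (_+ rest x) (zeroʳ i)) (+-identityˡ (rest x)))))
      where
      ψ = proj₁ ψ-data
      e = dot ψ R
      i = proj₁ (inverse e (proj₂ (proj₂ ψ-data)))
      ei : e * i ≡ 1#
      ei = proj₂ (inverse e (proj₂ (proj₂ ψ-data)))
      rest : Fin q → Fin q
      rest x = - (i * (dot ψ A + n * dot ψ v)) + - (i * (n * dot ψ w + m * dot ψ v + dot ψ u)) * x + - (i * (m * dot ψ w)) * (x * x)
      dot-N′ : ∀ x → dot ψ (N x (m * x + n)) ≡ x * (m * x + n) * dot ψ w
        + (dot ψ A + (m * x + n) * dot ψ v + x * dot ψ u + f x (m * x + n) * e)
      dot-N′ x = dot-N ψ x (m * x + n)

  quadratic-lines : ∀ m n → m ≢ 0# → Quadratic (λ x → f x (m * x + n))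
  quadratic-lines m n m≢0 =
    let τ , o , i = join (N∈ 0# n) (N∈ 1# (m + n)) (λ e → 0≢1 (proj₁ (N-coordinates e)))
    in Transversal.quadratic-on-line m≢0 τ o i

-- Parabolas over the lines through `A`, and their tangents.

module Tangents {q : ℕ} (F : FField q) (7≤q : 7 ℕ.≤ q) (2≢0 : FField._+_ F (FField.1# F) (FField.1# F) ≢ FField.0# F)
  (h : Vec (Fin q) 5) (C : List (Vec (Fin q) 5)) (CPlane : Geo.Plane F → Set)
  (hyp : Geo.Config.Hypotheses F h C CPlane) {A : Vec (Fin q) 5} (A∈ : A ∈ C)
  (standard : Coordinates.StandardForm F 7≤q h C CPlane hyp A) where
  open Counting
  open Surface F 7≤q h C CPlane hyp standard
  open Polynomials F using (zero-polynomial; biquadratic)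

  coefficients : BiQuadratic f
  coefficients = biquadratic 7≤q 2≢0 f quadratic-lines

  p₀ p₁ p₂ p₃ p₄ p₅ : Fin q
  p₀ = proj₁ coefficients
  p₁ = proj₁ (proj₂ coefficients)
  p₂ = proj₁ (proj₂ (proj₂ coefficients))
  p₃ = proj₁ (proj₂ (proj₂ (proj₂ coefficients)))
  p₄ = proj₁ (proj₂ (proj₂ (proj₂ (proj₂ coefficients))))
  p₅ = proj₁ (proj₂ (proj₂ (proj₂ (proj₂ (proj₂ coefficients)))))

  f-form : ∀ x y → f x y ≡ p₀ + p₁ * x + p₂ * y + (p₃ * (x * x) + p₄ * (x * y) + p₅ * (y * y))
  f-form = proj₂ (proj₂ (proj₂ (proj₂ (proj₂ (proj₂ coefficients)))))

  A-coordinates : A ≡ comb basis (0# ∷ 1# ∷ 0# ∷ 0# ∷ 0# ∷ [])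
  A-coordinates = vec-identity #1 (0# ⊡ #0 ⊞ (1# ⊡ #1 ⊞ (0# ⊡ #2 ⊞ (0# ⊡ #3 ⊞ (0# ⊡ #4 ⊞ ∅)))))
    (λ { (w ∷ a ∷ v ∷ u ∷ r ∷ []) → solve 5 (λ w a v u r → a
        := :0 :* w :+ (:1 :* a :+ (:0 :* v :+ (:0 :* u :+ (:0 :* r :+ :0))))) refl w a v u r }) basis

  -- `A` is itself some `N x y`; comparing coordinates shows that it lies over the origin.
  f-origin : f 0# 0# ≡ 0#
  f-origin =
    let x , y , e = N-all A∈
        eq : 0# ∷ 1# ∷ 0# ∷ 0# ∷ 0# ∷ [] ≡ x * y ∷ 1# ∷ y ∷ x ∷ f x y ∷ []
        eq = comb-injective independent (trans (sym A-coordinates) e)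
        0≡x = cong (λ z → lookup z (suc (suc (suc zero)))) eq
        0≡y = cong (λ z → lookup z (suc (suc zero))) eq
    in trans (cong₂ f 0≡x 0≡y) (sym (cong (λ z → lookup z (suc (suc (suc (suc zero))))) eq))

  p₀≡0 : p₀ ≡ 0#
  p₀≡0 = trans (solve 6 (λ p₀ p₁ p₂ p₃ p₄ p₅ → p₀
      := p₀ :+ p₁ :* :0 :+ p₂ :* :0 :+ (p₃ :* (:0 :* :0) :+ p₄ :* (:0 :* :0) :+ p₅ :* (:0 :* :0))) refl p₀ p₁ p₂ p₃ p₄ p₅)
    (trans (sym (f-form 0# 0#)) f-origin)

  -- The tangent plane of the surface at A meets Σ∞ in ⟨U , W⟩.
  U W : V 5
  U = u ⊕ p₁ · R
  W = v ⊕ p₂ · R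

  UW : Vec (V 5) 2
  UW = U ∷ W ∷ []

  -- Over `(k t, l t)` the point of the surface is `A + t X + t² Y`: `X` collects the terms linear
  -- in `t` and `Y` the quadratic ones.
  X Y : Fin q → Fin q → V 5
  X k l = comb UW (k ∷ l ∷ [])
  Y k l = comb basis (k * l ∷ 0# ∷ 0# ∷ 0# ∷ (p₃ * (k * k) + p₄ * (k * l) + p₅ * (l * l)) ∷ [])

  X-coordinates : ∀ k l → X k l ≡ comb basis (0# ∷ 0# ∷ l ∷ k ∷ (p₁ * k + p₂ * l) ∷ [])
  X-coordinates k l = vec-identity (k ⊡ (#3 ⊞ p₁ ⊡ #4) ⊞ (l ⊡ (#2 ⊞ p₂ ⊡ #4) ⊞ ∅))
    (0# ⊡ #0 ⊞ (0# ⊡ #1 ⊞ (l ⊡ #2 ⊞ (k ⊡ #3 ⊞ ((p₁ * k + p₂ * l) ⊡ #4 ⊞ ∅)))))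
    (λ { (w ∷ a ∷ v ∷ u ∷ r ∷ []) → solve 9 (λ w a v u r k l p₁ p₂ → k :* (u :+ p₁ :* r) :+ (l :* (v :+ p₂ :* r) :+ :0)
        := :0 :* w :+ (:0 :* a :+ (l :* v :+ (k :* u :+ ((p₁ :* k :+ p₂ :* l) :* r :+ :0))))) refl w a v u r k l p₁ p₂ }) basis

  UW-independent : Independent UW
  UW-independent (k ∷ l ∷ []) e =
    let eq = independent (0# ∷ 0# ∷ l ∷ k ∷ (p₁ * k + p₂ * l) ∷ []) (trans (sym (X-coordinates k l)) e)
    in cong₂ _∷_ (cong (λ z → lookup z (suc (suc (suc zero)))) eq)
         (cong (_∷ []) (cong (λ z → lookup z (suc (suc zero))) eq))

  direction-sum : ∀ {d e} k → Direction d → Direction e → Direction (d ⊕ k · e)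
  direction-sum {d} {e} k hd he = trans (linear-vec (dot-linear h) (#0 ⊞ k ⊡ #1) (d ∷ e ∷ []))
    (trans (cong₂ (λ x y → x + k * y) hd he) (solve 1 (λ k → :0 :+ k :* :0 := :0) refl k))

  U-direction : Direction U
  U-direction = direction-sum p₁ u-direction R-direction′

  W-direction : Direction W
  W-direction = direction-sum p₂ v-direction R-direction′

  tangent-line : Line
  tangent-line = record { lgens = UW ; lindep = UW-independent }

  module Parabola (k l : Fin q) (kl≢0 : ¬ (k ≡ 0# × l ≡ 0#)) where

    frame : Vec (V 5) 3
    frame = A ∷ X k l ∷ Y k l ∷ []

    frame-coordinates : ∀ a b c → comb frame (a ∷ b ∷ c ∷ []) ≡ comb basis
      (c * (k * l) ∷ a ∷ b * l ∷ b * k ∷ (b * (p₁ * k + p₂ * l) + c * (p₃ * (k * k) + p₄ * (k * l) + p₅ * (l * l))) ∷ [])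
    frame-coordinates a b c = trans (cong (λ x → a · A ⊕ (b · x ⊕ (c · Y k l ⊕ 𝟘))) (X-coordinates k l))
      (trans (vec-identity
          (a ⊡ #1 ⊞ (b ⊡ (0# ⊡ #0 ⊞ (0# ⊡ #1 ⊞ (l ⊡ #2 ⊞ (k ⊡ #3 ⊞ (g ⊡ #4 ⊞ ∅)))))
            ⊞ (c ⊡ ((k * l) ⊡ #0 ⊞ (0# ⊡ #1 ⊞ (0# ⊡ #2 ⊞ (0# ⊡ #3 ⊞ (Q ⊡ #4 ⊞ ∅))))) ⊞ ∅)))
          ((c * (k * l)) ⊡ #0 ⊞ (a ⊡ #1 ⊞ ((b * l) ⊡ #2 ⊞ ((b * k) ⊡ #3 ⊞ ((b * g + c * Q) ⊡ #4 ⊞ ∅)))))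
          (λ { (w ∷ A ∷ v ∷ u ∷ r ∷ []) → solve 12 (λ w A v u r a b c k l g Q →
              a :* A :+ (b :* (:0 :* w :+ (:0 :* A :+ (l :* v :+ (k :* u :+ (g :* r :+ :0)))))
                :+ (c :* (k :* l :* w :+ (:0 :* A :+ (:0 :* v :+ (:0 :* u :+ (Q :* r :+ :0))))) :+ :0))
              := c :* (k :* l) :* w :+ (a :* A :+ (b :* l :* v :+ (b :* k :* u :+ ((b :* g :+ c :* Q) :* r :+ :0)))))
              refl w A v u r a b c k l g Q }) basis) refl)
      where
      g = p₁ * k + p₂ * l
      Q = p₃ * (k * k) + p₄ * (k * l) + p₅ * (l * l)

    curve : Fin q → V 5
    curve t = comb frame (1# ∷ t ∷ t * t ∷ [])

    curve≡N : ∀ t → curve t ≡ N (k * t) (l * t)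
    curve≡N t = trans (frame-coordinates 1# t (t * t)) (five
        (solve 3 (λ k l t → t :* t :* (k :* l) := k :* t :* (l :* t)) refl k l t) (*-comm t l) (*-comm t k)
        (trans (solve 8 (λ k l t p₁ p₂ p₃ p₄ p₅ →
            t :* (p₁ :* k :+ p₂ :* l) :+ t :* t :* (p₃ :* (k :* k) :+ p₄ :* (k :* l) :+ p₅ :* (l :* l))
            := :0 :+ p₁ :* (k :* t) :+ p₂ :* (l :* t)
               :+ (p₃ :* (k :* t :* (k :* t)) :+ p₄ :* (k :* t :* (l :* t)) :+ p₅ :* (l :* t :* (l :* t))))
            refl k l t p₁ p₂ p₃ p₄ p₅)
          (trans (cong (λ p → p + p₁ * (k * t) + p₂ * (l * t)
               + (p₃ * (k * t * (k * t)) + p₄ * (k * t * (l * t)) + p₅ * (l * t * (l * t)))) (sym p₀≡0))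
            (sym (f-form (k * t) (l * t))))))
      where
      five : ∀ {a a′ b b′ c c′ d d′} → a ≡ a′ → b ≡ b′ → c ≡ c′ → d ≡ d′ →
        comb basis (a ∷ 1# ∷ b ∷ c ∷ d ∷ []) ≡ comb basis (a′ ∷ 1# ∷ b′ ∷ c′ ∷ d′ ∷ [])
      five refl refl refl refl = refl

    curve∈ : ∀ t → curve t ∈ C
    curve∈ t = subst (_∈ C) (sym (curve≡N t)) (N∈ (k * t) (l * t))

    nonzero-scalar : ∀ {t} → k * t ≡ 0# → l * t ≡ 0# → t ≡ 0#
    nonzero-scalar {t} e e′ with k ≟ᶠ 0# | l ≟ᶠ 0#
    ... | no k≢0 | _ = cancelˡ k≢0 e
    ... | yes _ | no l≢0 = cancelˡ l≢0 e′
    ... | yes k≡0 | yes l≡0 = ⊥-elim (kl≢0 (k≡0 , l≡0))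

    curve-injective : ∀ {t s} → curve t ≡ curve s → t ≡ s
    curve-injective {t} {s} e =
      let ek , el = N-coordinates (trans (sym (curve≡N t)) (trans e (curve≡N s)))
          split : ∀ m → m * t ≡ m * s → m * (t - s) ≡ 0#
          split m e = trans (solve 3 (λ m t s → m :* (t :- s) := m :* t :- m :* s) refl m t s) (≡⇒diff e)
      in diff⇒≡ (nonzero-scalar (split k ek) (split l el))

    curve-origin : curve 0# ≡ A
    curve-origin = vec-identity (1# ⊡ #0 ⊞ (0# ⊡ #1 ⊞ ((0# * 0#) ⊡ #2 ⊞ ∅))) #0
      (λ { (a ∷ x ∷ y ∷ []) → solve 3 (λ a x y → :1 :* a :+ (:0 :* x :+ (:0 :* :0 :* y :+ :0)) := a) refl a x y }) frame

    -- If Y vanished, the points A + t X would be collinear points of 𝒞.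
    Y≢𝟘 : Y k l ≢ 𝟘
    Y≢𝟘 Y≡0 =
      let τ , Aτ , Bτ = join A∈ (curve∈ 1#) A≢B
          Xτ = span-·-cancel 1≢0 (span-cancel (subst (_on τ) (flat 1#) Bτ) Aτ)
          Eτ = subst (_on τ) (sym (flat (- 1#))) (on-shift τ (- 1#) Aτ Xτ)
      in arc-directions τ A∈ (curve∈ 1#) (curve∈ (- 1#)) Aτ Bτ Eτ A≢B A≢E B≢E (∥X 1#) (∥X (- 1#))
      where
      flat : ∀ t → curve t ≡ A ⊕ t · X k l
      flat t = trans (cong (λ y → 1# · A ⊕ (t · X k l ⊕ ((t * t) · y ⊕ 𝟘))) Y≡0)
        (vec-identity (1# ⊡ #0 ⊞ (t ⊡ #1 ⊞ ((t * t) ⊡ ∅ ⊞ ∅))) (#0 ⊞ t ⊡ #1)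
          (λ { (a ∷ x ∷ []) → solve 3 (λ a x t → :1 :* a :+ (t :* x :+ (t :* t :* :0 :+ :0)) := a :+ t :* x) refl a x t })
          (A ∷ X k l ∷ []))
      ∥X : ∀ t → curve t ⊝ A ∥ X k l
      ∥X t = subst (_∥ X k l) (sym (trans (cong (_⊝ A) (flat t)) (shift-unshift A (X k l) t))) (∥-multiple t (X k l))
      A≢B : A ≢ curve 1#
      A≢B e = 0≢1 (curve-injective (trans curve-origin e))
      A≢E : A ≢ curve (- 1#)
      A≢E e = -≢0 1≢0 (sym (curve-injective (trans curve-origin e)))
      B≢E : curve 1# ≢ curve (- 1#)
      B≢E e = 2≢0 (trans (cong (1# +_) (curve-injective e)) (-‿inverseʳ 1#))

    frame-independent′ : Independent frame
    frame-independent′ (a ∷ b ∷ c ∷ []) e =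
      cong₂ _∷_ a≡0 (cong₂ _∷_ b≡0 (cong (_∷ []) (c≡0 (c ≟ᶠ 0#))))
      where
      eq = independent (c * (k * l) ∷ a ∷ b * l ∷ b * k ∷ (b * (p₁ * k + p₂ * l) + c * (p₃ * (k * k) + p₄ * (k * l) + p₅ * (l * l))) ∷ []) (trans (sym (frame-coordinates a b c)) e)
      a≡0 : a ≡ 0#
      a≡0 = cong (λ z → lookup z (suc zero)) eq
      b≡0 : b ≡ 0#
      b≡0 = nonzero-scalar (trans (*-comm k b) (cong (λ z → lookup z (suc (suc (suc zero)))) eq))
              (trans (*-comm l b) (cong (λ z → lookup z (suc (suc zero))) eq))
      cY : c · Y k l ≡ 𝟘
      cY = trans (vec-identity (c ⊡ #0) (0# ⊡ #1 ⊞ (0# ⊡ #2 ⊞ (c ⊡ #0 ⊞ ∅)))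
          (λ { (y ∷ a ∷ x ∷ []) → solve 4 (λ y a x c → c :* y := :0 :* a :+ (:0 :* x :+ (c :* y :+ :0))) refl y a x c })
          (Y k l ∷ A ∷ X k l ∷ []))
        (trans (cong₂ (λ s t → s · A ⊕ (t · X k l ⊕ (c · Y k l ⊕ 𝟘))) (sym a≡0) (sym b≡0)) e)
      c≡0 : Dec (c ≡ 0#) → c ≡ 0#
      c≡0 (yes p) = p
      c≡0 (no c≢0) = ⊥-elim (Y≢𝟘 (·-cancel c≢0 cY))

    parabola-plane : Plane
    parabola-plane = record { gens = frame ; indep = frame-independent′ }

    points-on : ∀ t → InSpan frame (curve t)
    points-on t = (1# ∷ t ∷ t * t ∷ []) , refl

    -- Through (A1) this makes the plane of the parabola a block.
    five-points : MeetsInMoreThanFour parabola-plane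
    five-points = List.map curve (List.take 5 elements)
      , trans (Listₚ.length-map curve (List.take 5 elements)) (trans (Listₚ.length-take 5 elements)
          (ℕₚ.m≤n⇒m⊓n≡m (subst (5 ℕ.≤_) (sym (allFin-length q)) (ℕₚ.≤-trans (ℕₚ.m≤n+m 5 2) 7≤q))))
      , map-unique curve (Uniqueₚ.take⁺ 5 (allFin-unique q)) (λ _ _ → curve-injective)
      , All.tabulate (λ P∈ → section (∈-map⁻ curve P∈))
      where
      section : ∀ {P} → (∃ λ t → t ∈ List.take 5 elements × P ≡ curve t) → Sect parabola-plane P
      section (t , _ , refl) = curve∈ t , points-on t

    parabola : Block
    parabola = block parabola-plane (A1-five parabola-plane five-points)

    A-on : A on parabola
    A-on = span-here _ A

    X-on : X k l on parabola
    X-on = span-there A (span-here _ (X k l))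

    Y-on : Y k l on parabola
    Y-on = span-there A (span-there (X k l) (span-here _ (Y k l)))

    -- A point of the plane that belongs to 𝒞 lies over `(b k, b l)`, and a point of 𝒞 is determined
    -- by what it lies over; hence `b` is its parameter.
    section-points : ∀ {P} → P ∈ C → P on parabola → ∃ λ t → P ≡ curve t
    section-points {P} P∈ ((a ∷ b ∷ c ∷ []) , e) =
      let x , y , e′ = N-all P∈
          eq = comb-injective independent {cs = x * y ∷ 1# ∷ y ∷ x ∷ f x y ∷ []}
            {ds = c * (k * l) ∷ a ∷ b * l ∷ b * k ∷ (b * (p₁ * k + p₂ * l) + c * (p₃ * (k * k) + p₄ * (k * l) + p₅ * (l * l))) ∷ []}
            (trans (sym e′) (trans e (frame-coordinates a b c)))
          x≡ = trans (cong (λ z → lookup z (suc (suc (suc zero)))) eq) (*-comm b k)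
          y≡ = trans (cong (λ z → lookup z (suc (suc zero))) eq) (*-comm b l)
      in b , trans e′ (trans (cong₂ N x≡ y≡) (sym (curve≡N b)))

    X-direction : Direction (X k l)
    X-direction = trans (linear-vec (dot-linear h) (k ⊡ #0 ⊞ (l ⊡ #1 ⊞ ∅)) UW)
      (trans (cong₂ (λ x y → k * x + (l * y + 0#)) U-direction W-direction)
        (solve 2 (λ k l → k :* :0 :+ (l :* :0 :+ :0) := :0) refl k l))

    Y-direction : Direction (Y k l)
    Y-direction = trans (linear-vec (dot-linear h)
        ((k * l) ⊡ #0 ⊞ (0# ⊡ #1 ⊞ (0# ⊡ #2 ⊞ (0# ⊡ #3 ⊞ (Q ⊡ #4 ⊞ ∅))))) basis)
      (trans (cong₂ (λ x y → k * l * x + (0# * dot h A + (0# * dot h v + (0# * dot h u + (Q * y + 0#))))) w-direction R-direction′)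
        (solve 6 (λ k l a v u Q → k :* l :* :0 :+ (:0 :* a :+ (:0 :* v :+ (:0 :* u :+ (Q :* :0 :+ :0)))) := :0) refl
          k l (dot h A) (dot h v) (dot h u) Q))
      where
      Q = p₃ * (k * k) + p₄ * (k * l) + p₅ * (l * l)

    -- The parabola (1 : t : t²) is the conic 2 x₀ x₂ = 2 x₁².
    M : Mat3
    M = (0# ∷ 0# ∷ 1# ∷ []) ∷ (0# ∷ - (1# + 1#) ∷ 0# ∷ []) ∷ (1# ∷ 0# ∷ 0# ∷ []) ∷ []

    M-symmetric : Symmetric M
    M-symmetric (x₀ ∷ x₁ ∷ x₂ ∷ []) (y₀ ∷ y₁ ∷ y₂ ∷ []) = solve 6 (λ x₀ x₁ x₂ y₀ y₁ y₂ →
        x₀ :* (:0 :* y₀ :+ (:0 :* y₁ :+ (:1 :* y₂ :+ :0)))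
        :+ (x₁ :* (:0 :* y₀ :+ ((:- (:1 :+ :1)) :* y₁ :+ (:0 :* y₂ :+ :0)))
        :+ (x₂ :* (:1 :* y₀ :+ (:0 :* y₁ :+ (:0 :* y₂ :+ :0))) :+ :0))
        := y₀ :* (:0 :* x₀ :+ (:0 :* x₁ :+ (:1 :* x₂ :+ :0)))
        :+ (y₁ :* (:0 :* x₀ :+ ((:- (:1 :+ :1)) :* x₁ :+ (:0 :* x₂ :+ :0)))
        :+ (y₂ :* (:1 :* x₀ :+ (:0 :* x₁ :+ (:0 :* x₂ :+ :0))) :+ :0)))
      refl x₀ x₁ x₂ y₀ y₁ y₂

    M-nondegenerate : Nondegenerate M
    M-nondegenerate (x₀ ∷ x₁ ∷ x₂ ∷ []) e = cong₂ _∷_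
      (trans (solve 3 (λ x y z → x := :1 :* x :+ (:0 :* y :+ (:0 :* z :+ :0))) refl x₀ x₁ x₂)
        (cong (λ v → lookup v (suc (suc zero))) e))
      (cong₂ _∷_ (cancelˡ (-≢0 2≢0) (trans
          (solve 3 (λ x y z → (:- (:1 :+ :1)) :* y := :0 :* x :+ ((:- (:1 :+ :1)) :* y :+ (:0 :* z :+ :0))) refl x₀ x₁ x₂)
          (cong (λ v → lookup v (suc zero)) e)))
        (cong (_∷ []) (trans (solve 3 (λ x y z → z := :0 :* x :+ (:0 :* y :+ (:1 :* z :+ :0))) refl x₀ x₁ x₂)
          (cong (λ v → lookup v zero) e))))

    M-tangent : X k l ≢ 𝟘 → TangentPointAtInfinity A parabola-plane (X k l)
    M-tangent X≢0 = (X≢0 , X-direction) , X-on , M , M-symmetric , M-nondegenerate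
      , (λ c (c∈ , cπ) → let s , e = section-points c∈ cπ in (1# ∷ s ∷ s * s ∷ []) , e
          , solve 1 (λ s → :1 :* (:0 :* :1 :+ (:0 :* s :+ (:1 :* (s :* s) :+ :0)))
              :+ (s :* (:0 :* :1 :+ ((:- (:1 :+ :1)) :* s :+ (:0 :* (s :* s) :+ :0)))
              :+ (s :* s :* (:1 :* :1 :+ (:0 :* s :+ (:0 :* (s :* s) :+ :0))) :+ :0)) := :0) refl s)
      , (1# ∷ 0# ∷ 0# ∷ []) , (0# ∷ 1# ∷ 0# ∷ [])
      , vec-identity #0 (1# ⊡ #0 ⊞ (0# ⊡ #1 ⊞ (0# ⊡ #2 ⊞ ∅)))
          (λ { (a ∷ x ∷ y ∷ []) → solve 3 (λ a x y → a := :1 :* a :+ (:0 :* x :+ (:0 :* y :+ :0))) refl a x y }) frame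
      , vec-identity #1 (0# ⊡ #0 ⊞ (1# ⊡ #1 ⊞ (0# ⊡ #2 ⊞ ∅)))
          (λ { (a ∷ x ∷ y ∷ []) → solve 3 (λ a x y → x := :0 :* a :+ (:1 :* x :+ (:0 :* y :+ :0))) refl a x y }) frame
      , solve 0 (:1 :* (:0 :* :0 :+ (:0 :* :1 :+ (:1 :* :0 :+ :0)))
              :+ (:0 :* (:0 :* :0 :+ ((:- (:1 :+ :1)) :* :1 :+ (:0 :* :0 :+ :0)))
              :+ (:0 :* (:1 :* :0 :+ (:0 :* :1 :+ (:0 :* :0 :+ :0))) :+ :0)) := :0) refl

    -- Any conic through the points A + t X + t² Y has tangent A X at A: its equation restricts to a quartic in t
    -- with linear coefficient 2 B(A , X).
    module _ (π : Block) (π≈ : π ≈ parabola) (S : Mat3) (S-symmetric : Symmetric S) (S-nondegenerate : Nondegenerate S)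
      (conic : ∀ c → Sect (plane π) c → OnConic (plane π) S c) {T : V 5} (T-direction : Direction T) (Tπ : T on π)
      (a x : V 3) (A≡ : A ≡ comb (gens (plane π)) a) (T≡ : T ≡ comb (gens (plane π)) x) (tangent : dot a (S ▹ x) ≡ 0#) where

      B : V 3 → V 3 → Fin q
      B y z = dot y (S ▹ z)

      B-linearˡ : ∀ z → Linear (λ y → B y z)
      B-linearˡ z = record
        { add = λ v w → trans (dot-comm (v ⊕ w) p) (trans (dot-⊕ p v w) (cong₂ _+_ (dot-comm p v) (dot-comm p w)))
        ; scale = λ c v → trans (dot-comm (c · v) p) (trans (dot-· p c v) (cong (c *_) (dot-comm p v)))
        ; nil = trans (dot-comm 𝟘 p) (dot-𝟘 p) }
        where p = S ▹ z

      B-linearʳ : ∀ y → Linear (B y)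
      B-linearʳ y = record
        { add = λ v w → trans (S-symmetric y (v ⊕ w)) (trans (Linear.add (B-linearˡ y) v w) (cong₂ _+_ (S-symmetric v y) (S-symmetric w y)))
        ; scale = λ c v → trans (S-symmetric y (c · v)) (trans (Linear.scale (B-linearˡ y) c v) (cong (c *_) (S-symmetric v y)))
        ; nil = trans (S-symmetric y 𝟘) (Linear.nil (B-linearˡ y)) }

      ξ-data : X k l on π
      ξ-data = ≈-on parabola π (≈-sym π parabola π≈) X-on
      η-data : Y k l on π
      η-data = ≈-on parabola π (≈-sym π parabola π≈) Y-on

      ξ η : V 3
      ξ = proj₁ ξ-data
      η = proj₁ η-data

      frame-in-π : ∀ cs → comb frame cs ≡ comb (gens (plane π)) (comb (a ∷ ξ ∷ η ∷ []) cs)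
      frame-in-π cs = trans (cong (λ vs → comb vs cs) (cong₂ _∷_ A≡ (cong₂ _∷_ (proj₂ ξ-data) (cong (_∷ []) (proj₂ η-data)))))
        (sym (comb-comb (gens (plane π)) (a ∷ ξ ∷ η ∷ []) cs))

      on-conic : ∀ t → B (comb (a ∷ ξ ∷ η ∷ []) (1# ∷ t ∷ t * t ∷ [])) (comb (a ∷ ξ ∷ η ∷ []) (1# ∷ t ∷ t * t ∷ [])) ≡ 0#
      on-conic t =
        let z , e , z0 = conic (curve t) (curve∈ t , ≈-on parabola π (≈-sym π parabola π≈) (points-on t))
            z≡ = comb-injective (indep (plane π)) {cs = z} {ds = comb (a ∷ ξ ∷ η ∷ []) (1# ∷ t ∷ t * t ∷ [])} (trans (sym e) (frame-in-π (1# ∷ t ∷ t * t ∷ [])))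
        in subst (λ z → B z z ≡ 0#) z≡ z0

      combination : Fin q → Fin q → Fin q → Lin 3
      combination c₀ c₁ c₂ = c₀ ⊡ #0 ⊞ (c₁ ⊡ #1 ⊞ (c₂ ⊡ #2 ⊞ ∅))

      Ba : Fin q → Fin q → Fin q → V 3 → Fin q
      Ba c₀ c₁ c₂ y = c₀ * B y a + (c₁ * B y ξ + (c₂ * B y η + 0#))

      B-comb : ∀ y c₀ c₁ c₂ → B y (comb (a ∷ ξ ∷ η ∷ []) (c₀ ∷ c₁ ∷ c₂ ∷ [])) ≡ Ba c₀ c₁ c₂ y
      B-comb y c₀ c₁ c₂ = linear-vec (B-linearʳ y) (combination c₀ c₁ c₂) (a ∷ ξ ∷ η ∷ [])

      B-comb-comb : ∀ c₀ c₁ c₂ → B (comb (a ∷ ξ ∷ η ∷ []) (c₀ ∷ c₁ ∷ c₂ ∷ [])) (comb (a ∷ ξ ∷ η ∷ []) (c₀ ∷ c₁ ∷ c₂ ∷ []))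
        ≡ c₀ * Ba c₀ c₁ c₂ a + (c₁ * Ba c₀ c₁ c₂ ξ + (c₂ * Ba c₀ c₁ c₂ η + 0#))
      B-comb-comb c₀ c₁ c₂ = trans (linear-vec (B-linearˡ z) (combination c₀ c₁ c₂) (a ∷ ξ ∷ η ∷ []))
        (three (B-comb a c₀ c₁ c₂) (B-comb ξ c₀ c₁ c₂) (B-comb η c₀ c₁ c₂))
        where
        z = comb (a ∷ ξ ∷ η ∷ []) (c₀ ∷ c₁ ∷ c₂ ∷ [])
        three : ∀ {r s t r′ s′ t′} → r ≡ r′ → s ≡ s′ → t ≡ t′ →
          c₀ * r + (c₁ * s + (c₂ * t + 0#)) ≡ c₀ * r′ + (c₁ * s′ + (c₂ * t′ + 0#))
        three refl refl refl = refl

      Baξ≡0 : B a ξ ≡ 0#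
      Baξ≡0 = cancelˡ 2≢0 (trans (solve 1 (λ r → (:1 :+ :1) :* r := r :+ r) refl (B a ξ))
        (trans (cong (B a ξ +_) (S-symmetric a ξ)) (cong (λ v → lookup v (suc zero)) quartic)))
        where
        -- All `q` parameters are zeros of a polynomial with five coefficients; only the linear one
        -- is used here.
        quartic : B a a ∷ (B a ξ + B ξ a) ∷ (B a η + B η a + B ξ ξ) ∷ (B ξ η + B η ξ) ∷ B η η ∷ [] ≡ 𝟘
        quartic = zero-polynomial _ (ℕₚ.≤-trans (ℕₚ.m≤n+m 5 2) 7≤q) λ t → trans
          (solve 10 (λ t aa aξ ξa aη ηa ξξ ξη ηξ ηη →
            aa :+ t :* ((aξ :+ ξa) :+ t :* ((aη :+ ηa :+ ξξ) :+ t :* ((ξη :+ ηξ) :+ t :* (ηη :+ t :* :0))))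
            := :1 :* (:1 :* aa :+ (t :* aξ :+ (t :* t :* aη :+ :0)))
               :+ (t :* (:1 :* ξa :+ (t :* ξξ :+ (t :* t :* ξη :+ :0)))
               :+ (t :* t :* (:1 :* ηa :+ (t :* ηξ :+ (t :* t :* ηη :+ :0))) :+ :0)))
            refl t (B a a) (B a ξ) (B ξ a) (B a η) (B η a) (B ξ ξ) (B ξ η) (B η ξ) (B η η))
          (trans (sym (B-comb-comb 1# t (t * t))) (on-conic t))

      Baa≡0 : B a a ≡ 0#
      Baa≡0 = trans (solve 4 (λ r s t z → r := :1 :* (:1 :* r :+ (:0 :* s :+ (:0 :* :0 :* t :+ :0))) :+ :0 :* z) refl
          (B a a) (B a ξ) (B a η) 0#)
        (trans (cong (λ z → 1# * Ba 1# 0# (0# * 0#) a + z) (solve 2 (λ r s → :0 :* :0 := :0 :* r :+ (:0 :* :0 :* s :+ :0)) refl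
            (Ba 1# 0# (0# * 0#) ξ) (Ba 1# 0# (0# * 0#) η)))
          (trans (sym (B-comb-comb 1# 0# (0# * 0#))) (on-conic 0#)))

      spanned : ∀ z → InSpan (a ∷ ξ ∷ η ∷ []) z
      spanned z =
        let cs , e = ≈-on π parabola π≈ {comb (gens (plane π)) z} (z , refl)
        in cs , comb-injective (indep (plane π)) (trans e (frame-in-π cs))

      -- Otherwise `a` would be conjugate to every vector, and nondegeneracy would give `a ≡ 𝟘`,
      -- although `A` is affine.
      Baη≢0 : B a η ≢ 0#
      Baη≢0 Baη≡0 = 1≢0 (trans (sym (affine A∈)) (trans (cong (dot h) (trans A≡ (trans (cong (comb (gens (plane π))) a≡0)
          (comb-𝟘 (gens (plane π)))))) (dot-𝟘 h)))
        where
        zero-on-span : ∀ z → InSpan (a ∷ ξ ∷ η ∷ []) z → B a z ≡ 0#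
        zero-on-span z ((c₀ ∷ c₁ ∷ c₂ ∷ []) , e) = trans (cong (B a) e) (trans (B-comb a c₀ c₁ c₂) (trans (three Baa≡0 Baξ≡0 Baη≡0)
              (solve 3 (λ c₀ c₁ c₂ → c₀ :* :0 :+ (c₁ :* :0 :+ (c₂ :* :0 :+ :0)) := :0) refl c₀ c₁ c₂)))
          where
          three : ∀ {r s t} → r ≡ 0# → s ≡ 0# → t ≡ 0# → c₀ * r + (c₁ * s + (c₂ * t + 0#)) ≡ c₀ * 0# + (c₁ * 0# + (c₂ * 0# + 0#))
          three refl refl refl = refl
        a≡0 : a ≡ 𝟘
        a≡0 = S-nondegenerate a (dot-unit-zero (S ▹ a) λ i → trans (dot-comm (S ▹ a) (unit i))
          (trans (sym (S-symmetric a (unit i))) (zero-on-span (unit i) (spanned (unit i)))))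

      -- Lying at infinity removes the component of `T` along `A`; tangency removes the one along
      -- `Y k l`, since `B a` vanishes at `ξ` but not at `η`.
      T∈line : InSpan UW T
      T∈line = along (≈-on π parabola π≈ Tπ)
        where
        along : T on parabola → InSpan UW T
        along ((c₀ ∷ c₁ ∷ c₂ ∷ []) , e) = subst (InSpan UW) (sym (trans e (trans
            (cong₂ (λ r s → r · A ⊕ (c₁ · X k l ⊕ (s · Y k l ⊕ 𝟘))) c₀≡0 c₂≡0)
            (vec-identity (0# ⊡ #0 ⊞ (c₁ ⊡ #1 ⊞ (0# ⊡ #2 ⊞ ∅))) (c₁ ⊡ #1)
              (λ { (a ∷ x ∷ y ∷ []) → solve 4 (λ a x y c → :0 :* a :+ (c :* x :+ (:0 :* y :+ :0)) := c :* x) refl a x y c₁ }) frame))))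
          (span-· c₁ ((k ∷ l ∷ []) , refl))
          where
          c₀≡0 : c₀ ≡ 0#
          c₀≡0 = trans (solve 3 (λ c₀ c₁ c₂ → c₀ := c₀ :* :1 :+ (c₁ :* :0 :+ (c₂ :* :0 :+ :0))) refl c₀ c₁ c₂)
            (trans (three (sym (affine A∈)) (sym X-direction) (sym Y-direction))
              (trans (sym (linear-vec (dot-linear h) (c₀ ⊡ #0 ⊞ (c₁ ⊡ #1 ⊞ (c₂ ⊡ #2 ⊞ ∅))) frame)) (trans (cong (dot h) (sym e)) T-direction)))
            where
            three : ∀ {r s t r′ s′ t′} → r ≡ r′ → s ≡ s′ → t ≡ t′ →
              c₀ * r + (c₁ * s + (c₂ * t + 0#)) ≡ c₀ * r′ + (c₁ * s′ + (c₂ * t′ + 0#))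
            three refl refl refl = refl
          x≡ : x ≡ comb (a ∷ ξ ∷ η ∷ []) (c₀ ∷ c₁ ∷ c₂ ∷ [])
          x≡ = comb-injective (indep (plane π)) (trans (sym T≡) (trans e (frame-in-π (c₀ ∷ c₁ ∷ c₂ ∷ []))))
          c₂≡0 : c₂ ≡ 0#
          c₂≡0 = cancelˡ Baη≢0 (trans (solve 4 (λ r s c₁ c₂ → s :* c₂ := :0 :* r :+ (c₁ :* :0 :+ (c₂ :* s :+ :0))) refl (B a a) (B a η) c₁ c₂)
            (trans (cong₂ (λ r s → r * B a a + (c₁ * s + (c₂ * B a η + 0#))) (sym c₀≡0) (sym Baξ≡0))
              (trans (sym (B-comb a c₀ c₁ c₂)) (trans (cong (B a) (sym x≡)) tangent))))

  abstract
    -- A second point `D` of the block, lying over `(k, l)`, identifies it with the parabola of this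
    -- direction, since both contain `A` and `D`.
    tangent-points-on-line : ∀ {T} → Config.t h C CPlane A T → InSpan UW T
    tangent-points-on-line {T} (π , cπ , Aπ , (_ , T-direction) , Tπ , S , S-sym , S-nondeg , conic , a , x , A≡ , T≡ , tangent) =
      let π′ = block π cπ
          D , D∈ , Dπ , D∉ = pick π′ (A ∷ []) (s≤s z≤n)
          k , l , D≡ = N-all D∈
          kl≢0 : ¬ (k ≡ 0# × l ≡ 0#)
          kl≢0 (k≡0 , l≡0) = D∉ (here (trans D≡ (trans (cong₂ N k≡0 l≡0) origin)))
          open Parabola k l kl≢0
          D≡curve : curve 1# ≡ D
          D≡curve = trans (curve≡N 1#) (trans (cong₂ N (*-identityʳ k) (*-identityʳ l)) (sym D≡))
          π≈ = same π′ parabola A∈ D∈ (λ e → D∉ (here (sym e))) Aπ Dπ A-on (subst (_on parabola) D≡curve (points-on 1#))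
      in T∈line π′ π≈ S S-sym S-nondeg conic T-direction Tπ a x A≡ T≡ tangent
      where
      origin : N 0# 0# ≡ A
      origin = trans (cong₂ (λ r s → comb basis (r ∷ 1# ∷ 0# ∷ 0# ∷ s ∷ [])) (zeroˡ 0#) f-origin) (sym A-coordinates)

    -- The coefficients of `T` on `U` and `W` name the direction of the parabola with tangent point
    -- `T`.
    line-points-tangent : ∀ {T} → T ≢ 𝟘 → InSpan UW T → Config.t h C CPlane A T
    line-points-tangent T≢0 ((k ∷ l ∷ []) , refl) = parabola-plane , isC parabola , A-on , M-tangent T≢0
      where
      kl≢0 : ¬ (k ≡ 0# × l ≡ 0#)
      kl≢0 (k≡0 , l≡0) = T≢0 (trans (cong₂ (λ k l → comb UW (k ∷ l ∷ [])) k≡0 l≡0) (comb-𝟘 UW))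
      open Parabola k l kl≢0

  tangent-points-form-line : Config.IsLineOfΣ∞ h C CPlane (Config.t h C CPlane A)
  tangent-points-form-line = tangent-line , (U-direction ∷ W-direction ∷ [])
    , λ T → (λ tT → proj₁ (proj₁ (proj₂ (proj₂ (proj₂ tT)))) , tangent-points-on-line tT)
          , λ (T≢0 , T∈) → line-points-tangent T≢0 T∈

theorem3p14 : (q : ℕ) → IsPrimePower q → IsOdd q → 7 ≤ q →
    (F : FField q) →
    (h : Vec (Fin q) 5) → Geo.Nonzero F h →
    (C : List (Vec (Fin q) 5)) → (CPlane : Geo.Plane F → Set) →
    Geo.Config.Hypotheses F h C CPlane →
    ∀ A → A ∈ C → Geo.Config.IsLineOfΣ∞ F h C CPlane (Geo.Config.t F h C CPlane A)
theorem3p14 q _ odd 7≤q F h _ C CPlane hyp A A∈ =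
  Tangents.tangent-points-form-line F 7≤q (FieldTheory.odd⇒2≢0 F odd) h C CPlane hyp A∈
    (Coordinates.standard-form F 7≤q h C CPlane hyp A∈)
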